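{- There exist absolute constants $c, C > 0$ such that for all integers $k > s \geq 3$ and every sufficiently large integer $n$ (in terms of $k$ and $s$), $$\left(\frac{c \cdot r_k(n)}{n}\right)^{2(s-2)} n^2 \;\leq\; f_{s,k}(n) \;\leq\; \left(\frac{r_k(n)}{n}\right)^{C} n^2.$$
   Context: A $k$-term arithmetic progression is a set of the form $\{x, x+d, \dots, x+(k-1)d\}$ of integers with common difference $d \neq 0$. A set of integers is $k$-AP free if it contains no such progression. $r_k(n)$ denotes the maximum size of a $k$-AP free subset of $\{1,\dots,n\}$. For a finite set $A$ of integers, $f_s(A)$ denotes the number of $s$-term arithmetic progressions contained in $A$. For integers $k > s \geq 3$ and $n\ge 1$, $f_{s,k}(n)$ is the maximum of $f_s(A)$ over all sets $A$ of $n$ nonnegative integers that are $k$-AP free. -}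

module Defs where

open import Data.Nat using (ℕ; zero; suc; _+_; _*_; _≤_; _⊔_; _≟_)
open import Data.List using (List; length; filter; upTo; map; foldr; cartesianProduct)
open import Data.List.Relation.Unary.All using (All; all?)
open import Data.List.Relation.Unary.Unique.Propositional using (Unique)
open import Data.List.Membership.Propositional using (_∈_)
open import Data.List.Membership.DecPropositional _≟_ using (_∈?_)
open import Data.Product using (_×_; Σ; ∃; proj₁; proj₂; _,_)
open import Relation.Nullary using (¬_; Dec)
open import Relation.Binary.PropositionalEquality using (_≡_)

-- A finite set of nonnegative integers is a duplicate-free list of naturals.

APin : ℕ → List ℕ → ℕ → ℕ → Set
APin s A x d = All (λ i → x + i * d ∈ A) (upTo s)

APin? : ∀ s A x d → Dec (APin s A x d)
APin? s A x d = all? (λ i → (x + i * d) ∈? A) (upTo s)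

-- A is k-AP free: no k-term AP (common difference d ≥ 1; an AP with
-- negative difference is the same set as one with positive difference).
KAPFree : ℕ → List ℕ → Set
KAPFree k A = ∀ x d → 1 ≤ d → ¬ APin k A x d

maxL : List ℕ → ℕ
maxL = foldr _⊔_ 0

-- f_s(A): number of s-term APs contained in A, each AP counted once as a
-- set, i.e. pairs (x , d) with d ≥ 1 (x ≤ max A and d ≤ max A necessarily).
fs : ℕ → List ℕ → ℕ
fs s A = length (filter (λ p → APin? s A (proj₁ p) (proj₂ p))
                        (cartesianProduct (upTo (suc (maxL A))) (map suc (upTo (maxL A)))))

IsRk : ℕ → ℕ → ℕ → Set
IsRk k n r =
  (Σ (List ℕ) λ A → Unique A × All (λ a → 1 ≤ a × a ≤ n) A × KAPFree k A × length A ≡ r)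
  × (∀ A → Unique A → All (λ a → 1 ≤ a × a ≤ n) A → KAPFree k A → length A ≤ r)

IsFsk : ℕ → ℕ → ℕ → ℕ → Set
IsFsk s k n m =
  (Σ (List ℕ) λ A → Unique A × length A ≡ n × KAPFree k A × fs s A ≡ m)
  × (∀ A → Unique A → length A ≡ n → KAPFree k A → fs s A ≤ m)

module Submission where

-- Upper bound.  If A is k-AP free with n elements and m = δ n² progressions of
-- length s ≥ 3, then δ n² pairs of A have their sum in 2·A.  Dependent random
-- choice gives A₁ ⊆ A of size ≫ δ n with O(δ^-5) n differences; a translate of the
-- set of popular differences meets half of A₁, and this part A₂ has only δ^-O(1) n
-- values a + c - 2b.  A random dilation modulo P, reduced modulo N ≈ δ^-O(1) n and
-- cut into windows of length n, sends a δ^O(1)-proportion of A₂ into [1, n] so that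
-- no new midpoint relation appears; its image is k-AP free, so r_k(n) ≥ c δ^C n.
-- The factor c is absorbed by raising the exponent, since δ ≤ 1/2.
--
-- Lower bound.  Stack s translates of a k-AP free set as far-apart rows: a k-term
-- progression, k > s, must stay in a single row, while progressions meeting every
-- row once are plentiful for suitable translates.  Far-apart copies of this block
-- fill up n elements.
--
-- The maximum f_{s,k}(n) ranges over infinitely many sets; it exists because only
-- finitely many midpoint patterns are realised, and realisability of a pattern by
-- integers is decided by eliminating variables.

open import Defs
open import Data.Nat using (ℕ; zero; suc; _+_; _*_; _^_; _∸_; _≤_; _<_; z≤n; s≤s; _≟_; _≤?_; _<?_; NonZero; _/_; _%_; _!; >-nonZero; >-nonZero⁻¹; ≢-nonZero; pred)
open import Data.Nat.Properties
open import Data.Nat.DivMod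
open import Data.Nat.Divisibility using (_∣_; divides; _∣?_)
open import Data.Nat.Tactic.RingSolver using (solve-∀)
import Data.Nat.Divisibility as ℕ∣
import Data.Nat.Coprimality as Cop
import Data.Integer as ℤ
open ℤ using (ℤ; 0ℤ; 1ℤ)
import Data.Integer.Properties as ℤP
import Data.Integer.Tactic.RingSolver as ℤSolver
import Data.List
open import Data.List using (List; []; _∷_; [_]; _++_; length; filter; upTo; map; cartesianProduct; allFin)
open import Data.List.Properties using (length-map; length-++; length-upTo; length-tabulate; map-id; length-filter; map-tabulate; tabulate-lookup)
open import Data.List.Relation.Unary.All as All using (All; []; _∷_)
import Data.List.Relation.Unary.All.Properties as AllP
open import Data.List.Relation.Unary.Any using (here; there; any?)
open import Data.List.Relation.Unary.AllPairs using ([]; _∷_)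
open import Data.List.Relation.Unary.Unique.Propositional using (Unique)
import Data.List.Relation.Unary.Unique.Propositional.Properties as UP
open import Data.List.Relation.Unary.Unique.DecPropositional _≟_ using (unique?)
open import Data.List.Membership.Propositional using (_∈_; find; lose)
open import Data.List.Membership.Propositional.Properties
open import Data.List.Membership.DecPropositional _≟_ using (_∈?_)
import Data.List.Membership.DecPropositional as DecMem
open import Data.Fin using (Fin; zero; suc)
open import Data.Vec using (Vec; []; _∷_)
import Data.Vec as Vec
import Data.Vec.Properties as VecP
open import Data.Product using (_×_; Σ; _,_; proj₁; proj₂)
open import Data.Product.Properties using (,-injective; ≡-dec)
open import Data.Sum using (_⊎_; inj₁; inj₂; [_,_]′)
open import Data.Empty using (⊥; ⊥-elim)
open import Function using (_∘_; id; case_of_)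
open import Relation.Nullary using (¬_; Dec; yes; no; ¬?; _×-dec_; _⊎-dec_; contradiction)
import Relation.Nullary.Decidable as Dec
open import Relation.Binary.Definitions using (DecidableEquality)
open import Relation.Binary.PropositionalEquality using (_≡_; _≢_; refl; sym; trans; cong; cong₂; subst; subst₂)

-- All transport of progressions runs along maps that respect the single relation `a + c ≡ 2 * b`. A
-- progression is a sequence whose consecutive triples satisfy it, so an injective map of this kind
-- sends progressions to progressions; it need not respect general sums. Hence the upper bound only
-- has to control the values a + c - 2b on `A₂`, and popular differences do this without any
-- inequality for iterated sumsets. For the comparison with r_k(n) one direction suffices: a
-- relation in the compressed set has to come from a relation in `A₂`.
--
-- The modulus of the dilation need not be prime. It has to be coprime to the finitely many non-zero
-- values of |a + c - 2b|, which 1 plus a multiple of a factorial achieves.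
--
-- Densities appear with denominators cleared. With δ = m / n² the chain of estimates reads: at most
-- 2^12 δ^-5 n differences, at most 2^70 δ^-29 n values a + c - 2b, and r_k(n) ≥ 2^-78 δ^30 n. The
-- final exponent is 108 = 78 + 30.

private variable
  X Y : Set

-- Finite sums, averaging and counting by injections

∑ : List X → (X → ℕ) → ℕ
∑ [] f = 0
∑ (x ∷ xs) f = f x + ∑ xs f

ind : {P : Set} → Dec P → ℕ
ind (yes _) = 1
ind (no _) = 0

ind-yes : {P : Set} (d : Dec P) → P → ind d ≡ 1
ind-yes (yes _) p = refl
ind-yes (no ¬p) p = contradiction p ¬p

ind-≤1 : {P : Set} (d : Dec P) → ind d ≤ 1
ind-≤1 (yes _) = ≤-refl
ind-≤1 (no _) = z≤n

ind-× : {P Q : Set} (d : Dec P) (e : Dec Q) → ind (d ×-dec e) ≡ ind d * ind e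
ind-× (yes _) (yes _) = refl
ind-× (yes _) (no _) = refl
ind-× (no _) e = refl

ind-¬ : {P : Set} (d : Dec P) → ind d + ind (¬? d) ≡ 1
ind-¬ (yes _) = refl
ind-¬ (no _) = refl

∑-mono : ∀ (xs : List X) {f g : X → ℕ} → (∀ x → x ∈ xs → f x ≤ g x) → ∑ xs f ≤ ∑ xs g
∑-mono [] h = z≤n
∑-mono (x ∷ xs) h = +-mono-≤ (h x (here refl)) (∑-mono xs λ y y∈ → h y (there y∈))

∑-cong : ∀ (xs : List X) {f g : X → ℕ} → (∀ x → x ∈ xs → f x ≡ g x) → ∑ xs f ≡ ∑ xs g
∑-cong [] h = refl
∑-cong (x ∷ xs) h = cong₂ _+_ (h x (here refl)) (∑-cong xs λ y y∈ → h y (there y∈))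

∑-const : ∀ (xs : List X) c → ∑ xs (λ _ → c) ≡ length xs * c
∑-const [] c = refl
∑-const (x ∷ xs) c = cong (c +_) (∑-const xs c)

∑-+ : ∀ (xs : List X) (f g : X → ℕ) → ∑ xs (λ x → f x + g x) ≡ ∑ xs f + ∑ xs g
∑-+ [] f g = refl
∑-+ (x ∷ xs) f g = trans (cong (f x + g x +_) (∑-+ xs f g)) (interchange (f x) (g x) _ _)
  where
  interchange : ∀ a b c d → a + b + (c + d) ≡ a + c + (b + d)
  interchange = solve-∀

∑-*ˡ : ∀ (xs : List X) c (f : X → ℕ) → ∑ xs (λ x → c * f x) ≡ c * ∑ xs f
∑-*ˡ [] c f = sym (*-zeroʳ c)
∑-*ˡ (x ∷ xs) c f = trans (cong (c * f x +_) (∑-*ˡ xs c f)) (sym (*-distribˡ-+ c (f x) _))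

∑-*ʳ : ∀ (xs : List X) c (f : X → ℕ) → ∑ xs (λ x → f x * c) ≡ ∑ xs f * c
∑-*ʳ [] c f = refl
∑-*ʳ (x ∷ xs) c f = trans (cong (f x * c +_) (∑-*ʳ xs c f)) (sym (*-distribʳ-+ c (f x) _))

∑-swap : ∀ (xs : List X) (ys : List Y) (f : X → Y → ℕ) →
  ∑ xs (λ x → ∑ ys (f x)) ≡ ∑ ys (λ y → ∑ xs (λ x → f x y))
∑-swap [] ys f = sym (trans (∑-const ys 0) (*-zeroʳ (length ys)))
∑-swap (x ∷ xs) ys f =
  trans (cong (∑ ys (f x) +_) (∑-swap xs ys f)) (sym (∑-+ ys (f x) _))

∑-++ : ∀ (xs ys : List X) (f : X → ℕ) → ∑ (xs ++ ys) f ≡ ∑ xs f + ∑ ys f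
∑-++ [] ys f = refl
∑-++ (x ∷ xs) ys f = trans (cong (f x +_) (∑-++ xs ys f)) (sym (+-assoc (f x) _ _))

∑-map : ∀ (g : X → Y) (xs : List X) (f : Y → ℕ) → ∑ (map g xs) f ≡ ∑ xs (f ∘ g)
∑-map g [] f = refl
∑-map g (x ∷ xs) f = cong (f (g x) +_) (∑-map g xs f)

∑-× : ∀ (xs : List X) (ys : List Y) (f : X × Y → ℕ) →
  ∑ (cartesianProduct xs ys) f ≡ ∑ xs (λ x → ∑ ys (λ y → f (x , y)))
∑-× [] ys f = refl
∑-× (x ∷ xs) ys f = trans (∑-++ (map (x ,_) ys) _ f)
  (cong₂ _+_ (∑-map (x ,_) ys f) (∑-× xs ys f))

∑-filter : ∀ {P : X → Set} (P? : ∀ x → Dec (P x)) (xs : List X) (f : X → ℕ) →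
  ∑ (filter P? xs) f ≡ ∑ xs (λ x → ind (P? x) * f x)
∑-filter P? [] f = refl
∑-filter P? (x ∷ xs) f with P? x
... | yes _ = cong₂ _+_ (sym (+-identityʳ (f x))) (∑-filter P? xs f)
... | no _ = ∑-filter P? xs f

length-filter-∑ : ∀ {P : X → Set} (P? : ∀ x → Dec (P x)) (xs : List X) →
  length (filter P? xs) ≡ ∑ xs (λ x → ind (P? x))
length-filter-∑ P? [] = refl
length-filter-∑ P? (x ∷ xs) with P? x
... | yes _ = cong suc (length-filter-∑ P? xs)
... | no _ = length-filter-∑ P? xs

∑-member : ∀ {xs : List X} (f : X → ℕ) {x} → x ∈ xs → f x ≤ ∑ xs f
∑-member f (here refl) = m≤m+n _ _
∑-member f (there x∈) = ≤-trans (∑-member f x∈) (m≤n+m _ _)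

pigeonhole-∷ : ∀ x (xs : List X) (f g : X → ℕ) → ∑ (x ∷ xs) f ≤ ∑ (x ∷ xs) g →
  Σ X λ y → y ∈ x ∷ xs × f y ≤ g y
pigeonhole-∷ x [] f g h =
  x , here refl , subst₂ _≤_ (+-identityʳ _) (+-identityʳ _) h
pigeonhole-∷ x (x′ ∷ xs) f g h with f x ≤? g x
... | yes p = x , here refl , p
... | no ¬p =
  let y , y∈ , q = pigeonhole-∷ x′ xs f g
        (+-cancelˡ-≤ (f x) _ _ (≤-trans h (+-monoˡ-≤ _ (<⇒≤ (≰⇒> ¬p)))))
  in y , there y∈ , q

pigeonhole : ∀ (xs : List X) (f g : X → ℕ) → 1 ≤ length xs → ∑ xs f ≤ ∑ xs g →
  Σ X λ x → x ∈ xs × f x ≤ g x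
pigeonhole (x ∷ xs) f g _ h = pigeonhole-∷ x xs f g h

-- Written as double sums, both sides are compared term by term through
-- `2 * (f x * f y) ≤ f x * f x + f y * f y`.
cauchy : ∀ (xs : List X) (f : X → ℕ) → ∑ xs f * ∑ xs f ≤ length xs * ∑ xs (λ x → f x * f x)
cauchy xs f = *-cancelˡ-≤ 2 (begin
  2 * (∑ xs f * ∑ xs f) ≡⟨ cong (2 *_) (sym (∑-*ʳ xs (∑ xs f) f)) ⟩
  2 * ∑ xs (λ x → f x * ∑ xs f) ≡⟨ sym (∑-*ˡ xs 2 _) ⟩
  ∑ xs (λ x → 2 * (f x * ∑ xs f)) ≡⟨ ∑-cong xs (λ x _ → cong (2 *_) (sym (∑-*ˡ xs (f x) f))) ⟩
  ∑ xs (λ x → 2 * ∑ xs (λ y → f x * f y)) ≡⟨ ∑-cong xs (λ x _ → sym (∑-*ˡ xs 2 _)) ⟩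
  ∑ xs (λ x → ∑ xs (λ y → 2 * (f x * f y))) ≤⟨ ∑-mono xs (λ x _ → ∑-mono xs (λ y _ → amgm (f x) (f y))) ⟩
  ∑ xs (λ x → ∑ xs (λ y → f x * f x + f y * f y))
    ≡⟨ ∑-cong xs (λ x _ → trans (∑-+ xs _ _) (cong (_+ Q) (∑-const xs (f x * f x)))) ⟩
  ∑ xs (λ x → length xs * (f x * f x) + Q) ≡⟨ trans (∑-+ xs _ _) (cong₂ _+_ (∑-*ˡ xs (length xs) _) (∑-const xs Q)) ⟩
  length xs * Q + length xs * Q ≡⟨ double (length xs * Q) ⟩
  2 * (length xs * Q) ∎)
  where
  open ≤-Reasoning
  Q = ∑ xs (λ x → f x * f x)
  double : ∀ a → a + a ≡ 2 * a
  double = solve-∀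
  amgm-≤ : ∀ {a b} → a ≤ b → 2 * (a * b) ≤ a * a + b * b
  amgm-≤ {a} a≤b with m≤n⇒∃[o]m+o≡n a≤b
  ... | c , refl = ≤-trans (m≤m+n _ (c * c)) (≤-reflexive (expand a c))
    where
    expand : ∀ a c → 2 * (a * (a + c)) + c * c ≡ a * a + (a + c) * (a + c)
    expand = solve-∀
  amgm : ∀ a b → 2 * (a * b) ≤ a * a + b * b
  amgm a b with ≤-total a b
  ... | inj₁ p = amgm-≤ p
  ... | inj₂ p = subst₂ _≤_ (cong (2 *_) (*-comm b a)) (+-comm (b * b) (a * a)) (amgm-≤ p)

-- A relation replaces a function because in `fs-transfer` the image of a progression comes from an
-- existence statement. The induction removes the partner of the head from `ys`; injectivity keeps
-- the other partners available.
injection-length-rel : ∀ (xs : List X) (ys : List Y) (R : X → Y → Set) → Unique xs →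
  (∀ x → x ∈ xs → Σ Y λ y → y ∈ ys × R x y) →
  (∀ x x′ y → x ∈ xs → x′ ∈ xs → R x y → R x′ y → x ≡ x′) →
  length xs ≤ length ys
injection-length-rel [] ys R u tot inj = z≤n
injection-length-rel (x ∷ xs) ys R (x∉ ∷ u) tot inj with tot x (here refl)
... | y , y∈ , Rxy with ∈-∃++ y∈
... | ys₁ , ys₂ , refl = ≤-trans (s≤s ih) (≤-reflexive lengths)
  where
  tot′ : ∀ x′ → x′ ∈ xs → Σ _ λ y′ → y′ ∈ ys₁ ++ ys₂ × R x′ y′
  tot′ x′ x′∈ with tot x′ (there x′∈)
  ... | y′ , y′∈ , Rxy′ with ∈-++⁻ ys₁ y′∈
  ... | inj₁ p = y′ , ∈-++⁺ˡ p , Rxy′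
  ... | inj₂ (there p) = y′ , ∈-++⁺ʳ ys₁ p , Rxy′
  ... | inj₂ (here refl) =
    contradiction (inj x x′ y (here refl) (there x′∈) Rxy Rxy′) (All.lookup x∉ x′∈)
  ih : length xs ≤ length (ys₁ ++ ys₂)
  ih = injection-length-rel xs (ys₁ ++ ys₂) R u tot′
    λ a b y′ a∈ b∈ → inj a b y′ (there a∈) (there b∈)
  lengths : suc (length (ys₁ ++ ys₂)) ≡ length (ys₁ ++ y ∷ ys₂)
  lengths = trans (cong suc (length-++ ys₁)) (trans (sym (+-suc (length ys₁) _)) (sym (length-++ ys₁)))

injection-length : ∀ (xs : List X) (ys : List Y) (f : X → Y) → Unique xs →
  (∀ x → x ∈ xs → f x ∈ ys) →
  (∀ x x′ → x ∈ xs → x′ ∈ xs → f x ≡ f x′ → x ≡ x′) →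
  length xs ≤ length ys
injection-length xs ys f u into inj =
  injection-length-rel xs ys (λ x y → f x ≡ y) u (λ x x∈ → f x , into x x∈ , refl)
    λ x x′ y x∈ x′∈ p q → inj x x′ x∈ x′∈ (trans p (sym q))

injection-count : ∀ {P : X → Set} (P? : ∀ x → Dec (P x)) (xs : List X) (ys : List Y) (f : X → Y) →
  Unique xs → (∀ x → x ∈ xs → P x → f x ∈ ys) →
  (∀ x x′ → x ∈ xs → x′ ∈ xs → P x → P x′ → f x ≡ f x′ → x ≡ x′) →
  ∑ xs (λ x → ind (P? x)) ≤ length ys
injection-count P? xs ys f u into inj = subst (_≤ length ys) (length-filter-∑ P? xs)
  (injection-length (filter P? xs) ys f (UP.filter⁺ P? u)
    (λ x x∈ → let x∈xs , px = ∈-filter⁻ P? x∈ in into x x∈xs px)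
    λ x x′ x∈ x′∈ → let x∈xs , px = ∈-filter⁻ P? x∈ ; x′∈xs , px′ = ∈-filter⁻ P? x′∈
                    in inj x x′ x∈xs x′∈xs px px′)

unique-map : ∀ (xs : List X) (f : X → Y) → Unique xs →
  (∀ x x′ → x ∈ xs → x′ ∈ xs → f x ≡ f x′ → x ≡ x′) → Unique (map f xs)
unique-map [] f u inj = []
unique-map (x ∷ xs) f (x∉ ∷ u) inj =
  AllP.map⁺ (All.tabulate λ x′∈ eq →
    All.lookup x∉ x′∈ (inj _ _ (here refl) (there x′∈) eq)) ∷
  unique-map xs f u (λ a b a∈ b∈ → inj a b (there a∈) (there b∈))

-- Later the differences and the values a + c - 2b are counted through one pair or triple per value,
-- so that a counting map may use the coordinates and still be injective in the value.
representatives : DecidableEquality Y → (f : X → Y) (xs : List X) →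
  Σ (List X) λ ys → Unique (map f ys) × (∀ y → y ∈ ys → y ∈ xs) ×
    (∀ x → x ∈ xs → f x ∈ map f ys)
representatives _≟Y_ f [] = [] , [] , (λ _ ()) , (λ _ ())
representatives _≟Y_ f (x ∷ xs) with representatives _≟Y_ f xs
... | ys , u , sub , cov with DecMem._∈?_ _≟Y_ (f x) (map f ys)
... | yes p = ys , u , (λ y → there ∘ sub y) , λ { _ (here refl) → p ; x′ (there q) → cov x′ q }
... | no ¬p = x ∷ ys , All.tabulate (λ {z} z∈ eq → ¬p (subst (_∈ map f ys) (sym eq) z∈)) ∷ u
  , (λ { _ (here refl) → here refl ; y (there q) → there (sub y q) })
  , λ { _ (here refl) → here refl ; x′ (there q) → there (cov x′ q) }

unique-map-injective : ∀ (f : X → Y) (xs : List X) → Unique (map f xs) →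
  ∀ x x′ → x ∈ xs → x′ ∈ xs → f x ≡ f x′ → x ≡ x′
unique-map-injective f (x ∷ xs) (x∉ ∷ u) _ _ (here refl) (here refl) eq = refl
unique-map-injective f (x ∷ xs) (x∉ ∷ u) _ _ (here refl) (there q) eq =
  contradiction eq (All.lookup x∉ (∈-map⁺ f q))
unique-map-injective f (x ∷ xs) (x∉ ∷ u) _ _ (there p) (here refl) eq =
  contradiction (sym eq) (All.lookup x∉ (∈-map⁺ f p))
unique-map-injective f (x ∷ xs) (x∉ ∷ u) a b (there p) (there q) eq =
  unique-map-injective f xs u a b p q eq

-- Enumerating the progressions of a list

∈⇒≤maxL : ∀ {x} (A : List ℕ) → x ∈ A → x ≤ maxL A
∈⇒≤maxL (y ∷ A) (here refl) = m≤m⊔n y (maxL A)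
∈⇒≤maxL (y ∷ A) (there x∈) = ≤-trans (∈⇒≤maxL A x∈) (m≤n⊔m y (maxL A))

APin-lookup : ∀ {s A x d} → APin s A x d → ∀ i → i < s → x + i * d ∈ A
APin-lookup ap i i<s = All.lookup ap (∈-upTo⁺ i<s)

APin-tabulate : ∀ {s A x d} → (∀ i → i < s → x + i * d ∈ A) → APin s A x d
APin-tabulate h = All.tabulate λ {i} i∈ → h i (∈-upTo⁻ i∈)

private
  candidates : List ℕ → List (ℕ × ℕ)
  candidates A = cartesianProduct (upTo (suc (maxL A))) (map suc (upTo (maxL A)))

  isAP? : ∀ s A (p : ℕ × ℕ) → Dec (APin s A (proj₁ p) (proj₂ p))
  isAP? s A p = APin? s A (proj₁ p) (proj₂ p)

progressions : ℕ → List ℕ → List (ℕ × ℕ)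
progressions s A = filter (isAP? s A) (candidates A)

progressions-unique : ∀ s A → Unique (progressions s A)
progressions-unique s A = UP.filter⁺ (isAP? s A) {candidates A}
  (UP.cartesianProduct⁺ (UP.upTo⁺ (suc (maxL A))) (UP.map⁺ suc-injective (UP.upTo⁺ (maxL A))))

-- The search range in `fs` misses nothing once `2 ≤ s`: the second term `x + d` lies in `A` and
-- bounds both `x` and `d` by `maxL A`.
∈-progressions⁺ : ∀ {s A x d} → 2 ≤ s → 1 ≤ d → APin s A x d → (x , d) ∈ progressions s A
∈-progressions⁺ {s} {A} {x} {suc d} 2≤s _ ap = ∈-filter⁺ (isAP? s A) {xs = candidates A}
  (∈-cartesianProduct⁺ (∈-upTo⁺ (s≤s x≤)) (∈-map⁺ suc (∈-upTo⁺ d<))) ap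
  where
  second : x + 1 * suc d ≤ maxL A
  second = ∈⇒≤maxL A (APin-lookup ap 1 2≤s)
  x≤ : x ≤ maxL A
  x≤ = ≤-trans (m≤m+n x _) second
  d< : d < maxL A
  d< = ≤-trans (≤-reflexive (sym (*-identityˡ (suc d)))) (≤-trans (m≤n+m _ x) second)

∈-progressions⁻ : ∀ {s A x d} → (x , d) ∈ progressions s A → 1 ≤ d × APin s A x d
∈-progressions⁻ {s} {A} p∈ with ∈-filter⁻ (isAP? s A) {xs = candidates A} p∈
... | p∈c , ap with ∈-map⁻ suc (proj₂ (∈-cartesianProduct⁻ (upTo (suc (maxL A))) _ p∈c))
... | _ , _ , refl = s≤s z≤n , ap

fs-lower : ∀ {s A} (L : List (ℕ × ℕ)) → 2 ≤ s → Unique L →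
  (∀ x d → (x , d) ∈ L → 1 ≤ d × APin s A x d) → length L ≤ fs s A
fs-lower {s} {A} L 2≤s u h = injection-length L (progressions s A) id u
  (λ { (x , d) p∈ → ∈-progressions⁺ 2≤s (proj₁ (h x d p∈)) (proj₂ (h x d p∈)) })
  (λ _ _ _ _ eq → eq)

KAPFree-⊆ : ∀ {k A B} → (∀ x → x ∈ B → x ∈ A) → KAPFree k A → KAPFree k B
KAPFree-⊆ sub free x d 1≤d ap = free x d 1≤d (All.map (λ {i} → sub _) ap)

KAPFree? : ∀ k A → 2 ≤ k → Dec (KAPFree k A)
KAPFree? k A 2≤k with progressions k A in eq
... | [] = yes λ x d 1≤d ap → case subst ((x , d) ∈_) eq (∈-progressions⁺ {k} {A} 2≤k 1≤d ap) of λ ()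
... | (x , d) ∷ _ = no λ free →
  let 1≤d , ap = ∈-progressions⁻ {k} {A} (subst ((x , d) ∈_) (sym eq) (here refl)) in free x d 1≤d ap

-- Maps that respect midpoint relations

increasing-AP : ∀ k (a : ℕ → ℕ) e → (∀ i → 2 + i < k → a i + a (2 + i) ≡ 2 * a (1 + i)) →
  a 1 ≡ a 0 + e → ∀ i → 1 + i < k → a i ≡ a 0 + i * e × a (1 + i) ≡ a 0 + (1 + i) * e
increasing-AP k a e mid a₁ zero _ =
  sym (+-identityʳ _) , trans a₁ (cong (a 0 +_) (sym (*-identityˡ e)))
-- The midpoint relation determines a term from the two before it, so the induction carries two
-- consecutive terms.
increasing-AP k a e mid a₁ (suc i) i<k with increasing-AP k a e mid a₁ i (<-trans (n<1+n _) i<k)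
... | p , q = q , +-cancelˡ-≡ (a i) _ _
  (trans (mid i i<k) (trans (cong (2 *_) q) (trans (step (a 0) i e) (cong (_+ (a 0 + (2 + i) * e)) (sym p)))))
  where
  step : ∀ a₀ i e → 2 * (a₀ + (1 + i) * e) ≡ a₀ + i * e + (a₀ + (2 + i) * e)
  step = solve-∀

decreasing-AP : ∀ k (a : ℕ → ℕ) e → (∀ i → 2 + i < k → a i + a (2 + i) ≡ 2 * a (1 + i)) →
  a 0 ≡ a 1 + e → ∀ i → 1 + i < k → a i + i * e ≡ a 0 × a (1 + i) + (1 + i) * e ≡ a 0
decreasing-AP k a e mid a₁ zero _ = +-identityʳ _ , trans (cong (a 1 +_) (*-identityˡ e)) (sym a₁)
decreasing-AP k a e mid a₁ (suc i) i<k with decreasing-AP k a e mid a₁ i (<-trans (n<1+n _) i<k)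
... | p , q = q , +-cancelˡ-≡ (a 0) _ _
  (trans (cong (_+ (a (2 + i) + (2 + i) * e)) (sym p))
  (trans (step₁ (a i) (a (2 + i)) i e)
  (trans (cong (_+ 2 * ((1 + i) * e)) (mid i i<k))
  (trans (step₂ (a (1 + i)) i e) (trans (cong (2 *_) q) (double (a 0)))))))
  where
  step₁ : ∀ x y i e → x + i * e + (y + (2 + i) * e) ≡ x + y + 2 * ((1 + i) * e)
  step₁ = solve-∀
  step₂ : ∀ z i e → 2 * z + 2 * ((1 + i) * e) ≡ 2 * (z + (1 + i) * e)
  step₂ = solve-∀
  double : ∀ x → 2 * x ≡ x + x
  double = solve-∀

-- The correspondence from β-values to α-values is a Freiman-type homomorphism for the equation a +
-- c = 2b alone. The index type `X` lets both sides be described by functions on one list.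
PreservesMidpoints : List X → (X → ℕ) → (X → ℕ) → Set
PreservesMidpoints L β α = ∀ x y z → x ∈ L → y ∈ L → z ∈ L →
  β x + β z ≡ 2 * β y → α x + α z ≡ 2 * α y

-- The degenerate relation `β x + β x ≡ 2 * β y` is an equality in disguise, so preservation already
-- makes the correspondence well defined.
preserves-≡ : ∀ {L : List X} (β α : X → ℕ) → PreservesMidpoints L β α →
  ∀ x y → x ∈ L → y ∈ L → β x ≡ β y → α x ≡ α y
preserves-≡ β α pres x y x∈ y∈ eq = *-cancelˡ-≡ _ _ 2
  (trans (double (α x)) (pres x y x x∈ y∈ x∈ (trans (sym (double (β x))) (cong (2 *_) eq))))
  where
  double : ∀ x → 2 * x ≡ x + x
  double = solve-∀

-- The sequence g carries both progressions; the second one may be traversed backwards.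
record Transferred (k : ℕ) (L : List X) (β α : X → ℕ) (u d x e : ℕ) : Set where
  constructor transferred
  field
    g : ℕ → X
    g∈ : ∀ i → i < k → g i ∈ L
    source : ∀ i → i < k → β (g i) ≡ u + i * d
    target : (∀ i → i < k → α (g i) ≡ x + i * e) ⊎ (∀ i → i < k → α (g i) + i * e ≡ x + pred k * e)

Transferred⇒APin : ∀ {k} {L : List X} {β α u d x e} → Transferred k L β α u d x e → APin k (map α L) x e
Transferred⇒APin {L = L} {α = α} (transferred g g∈ _ (inj₁ inc)) =
  APin-tabulate λ i i<k → subst (_∈ map α L) (inc i i<k) (∈-map⁺ α (g∈ i i<k))
Transferred⇒APin {k = zero} (transferred _ _ _ (inj₂ _)) = []
Transferred⇒APin {k = suc k} {L = L} {α = α} {x = x} {e} (transferred g g∈ _ (inj₂ dec)) =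
  APin-tabulate λ { i (s≤s i≤k) →
    let j<k = s≤s (m∸n≤m k i)
    in subst (_∈ map α L) (+-cancelʳ-≡ ((k ∸ i) * e) _ _ (trans (dec (k ∸ i) j<k) (split i i≤k)))
         (∈-map⁺ α (g∈ (k ∸ i) j<k)) }
  where
  split : ∀ i → i ≤ k → x + k * e ≡ x + i * e + (k ∸ i) * e
  split i i≤k = trans (cong (λ t → x + t * e) (sym (m+[n∸m]≡n i≤k))) (assoc x i (k ∸ i) e)
    where
    assoc : ∀ x i j e → x + (i + j) * e ≡ x + i * e + j * e
    assoc = solve-∀

-- Lifting the terms to `L` turns consecutive triples into midpoint relations between α-values, so
-- these form a progression. Its difference is non-zero because equal α-values have equal β-values;
-- its sign is that of the first step, whence the two forms of `target`.
transfer : ∀ k (L : List X) (β α : X → ℕ) → 2 ≤ k →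
  PreservesMidpoints L β α → (∀ x y → x ∈ L → y ∈ L → α x ≡ α y → β x ≡ β y) →
  ∀ u d → 1 ≤ d → APin k (map β L) u d →
  Σ ℕ λ x → Σ ℕ λ e → 1 ≤ e × Transferred k L β α u d x e
transfer {X} k@(suc k′) L β α 2≤k pres inj u d 1≤d ap = cases (≤-total (α (g 0)) (α (g 1)))
  where
  pick : ∀ i → i < k → Σ X λ x → x ∈ L × u + i * d ≡ β x
  pick i i<k = ∈-map⁻ β (APin-lookup ap i i<k)
  -- Beyond the last term `g` repeats the first one; this is only a default value.
  g : ℕ → X
  g i with i <? k
  ... | yes i<k = proj₁ (pick i i<k)
  ... | no _ = proj₁ (pick 0 (s≤s z≤n))
  g-spec : ∀ i → i < k → g i ∈ L × β (g i) ≡ u + i * d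
  g-spec i i<k with i <? k
  ... | yes p = proj₁ (proj₂ (pick i p)) , sym (proj₂ (proj₂ (pick i p)))
  ... | no ¬p = contradiction i<k ¬p
  mid : ∀ i → 2 + i < k → α (g i) + α (g (2 + i)) ≡ 2 * α (g (1 + i))
  mid i i<k =
    let p₂ , q₂ = g-spec (2 + i) i<k
        p₁ , q₁ = g-spec (1 + i) (<-trans (n<1+n _) i<k)
        p₀ , q₀ = g-spec i (<-trans (n<1+n _) (<-trans (n<1+n _) i<k))
    in pres _ _ _ p₀ p₁ p₂ (trans (cong₂ _+_ q₀ q₂) (trans (arith u i d) (cong (2 *_) (sym q₁))))
    where
    arith : ∀ u i d → u + i * d + (u + (2 + i) * d) ≡ 2 * (u + (1 + i) * d)
    arith = solve-∀
  distinct : α (g 0) ≢ α (g 1)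
  distinct eq =
    let p₀ , q₀ = g-spec 0 (s≤s z≤n)
        p₁ , q₁ = g-spec 1 2≤k
        u+0≡u+d = trans (sym q₀) (trans (inj _ _ p₀ p₁ eq) q₁)
    in <-irrefl u+0≡u+d (+-monoʳ-< u (≤-trans 1≤d (≤-reflexive (sym (*-identityˡ d)))))
  ascending : ∀ e → α (g 0) + e ≡ α (g 1) → Σ ℕ λ x → Σ ℕ λ e → 1 ≤ e × Transferred k L β α u d x e
  ascending zero eq = contradiction (trans (sym (+-identityʳ _)) eq) distinct
  ascending (suc e) eq = α (g 0) , suc e , s≤s z≤n ,
    transferred g (λ i → proj₁ ∘ g-spec i) (λ i → proj₂ ∘ g-spec i) (inj₁ inc)
    where
    inc : ∀ i → i < k → α (g i) ≡ α (g 0) + i * suc e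
    inc zero _ = sym (+-identityʳ _)
    inc (suc i) i<k = proj₂ (increasing-AP k (α ∘ g) (suc e) mid (sym eq) i i<k)
  descending : ∀ e → α (g 1) + e ≡ α (g 0) → Σ ℕ λ x → Σ ℕ λ e → 1 ≤ e × Transferred k L β α u d x e
  descending zero eq = contradiction (trans (sym eq) (+-identityʳ _)) distinct
  descending (suc e) eq = α (g k′) , suc e , s≤s z≤n ,
    transferred g (λ i → proj₁ ∘ g-spec i) (λ i → proj₂ ∘ g-spec i)
      (inj₂ λ i i<k → trans (dec i i<k) (sym (dec k′ ≤-refl)))
    where
    dec : ∀ i → i < k → α (g i) + i * suc e ≡ α (g 0)
    dec zero _ = +-identityʳ _
    dec (suc i) i<k = proj₂ (decreasing-AP k (α ∘ g) (suc e) mid (sym eq) i i<k)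
  cases : _ → _
  cases (inj₁ a₀≤a₁) = let e , eq = m≤n⇒∃[o]m+o≡n a₀≤a₁ in ascending e eq
  cases (inj₂ a₁≤a₀) = let e , eq = m≤n⇒∃[o]m+o≡n a₁≤a₀ in descending e eq

KAPFree-transfer : ∀ {k} {L : List X} {β α : X → ℕ} → 2 ≤ k →
  PreservesMidpoints L β α → (∀ x y → x ∈ L → y ∈ L → α x ≡ α y → β x ≡ β y) →
  KAPFree k (map α L) → KAPFree k (map β L)
KAPFree-transfer 2≤k pres inj free u d 1≤d ap =
  let x , e , 1≤e , t = transfer _ _ _ _ 2≤k pres inj u d 1≤d ap
  in free x e 1≤e (Transferred⇒APin t)

-- Preservation from α to β lets a target progression determine the terms of its source. The
-- delicate case is one target reached forwards from one source and backwards from another: the two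
-- sources would then run through their common end points in opposite directions, although both have
-- positive difference.
fs-transfer : ∀ {s} {L : List X} {β α : X → ℕ} → 2 ≤ s →
  PreservesMidpoints L β α → PreservesMidpoints L α β → fs s (map β L) ≤ fs s (map α L)
fs-transfer {X} {s} {L} {β} {α} 2≤s pres pres⁻ = injection-length-rel
  (progressions s (map β L)) (progressions s (map α L)) R (progressions-unique s (map β L)) total injective
  where
  R : ℕ × ℕ → ℕ × ℕ → Set
  R (u , d) (x , e) = 1 ≤ d × Transferred s L β α u d x e
  total : ∀ p → p ∈ progressions s (map β L) → Σ (ℕ × ℕ) λ q → q ∈ progressions s (map α L) × R p q
  total (u , d) p∈ =
    let 1≤d , ap = ∈-progressions⁻ {s} {map β L} p∈
        x , e , 1≤e , t = transfer s L β α 2≤s pres (preserves-≡ α β pres⁻) u d 1≤d ap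
    in (x , e) , ∈-progressions⁺ {s} {map α L} 2≤s 1≤e (Transferred⇒APin t) , 1≤d , t
  0<s : 0 < s
  0<s = <-trans (s≤s z≤n) 2≤s
  last<s : pred s < s
  last<s = ≤-reflexive (suc-pred s {{>-nonZero 0<s}})
  same : ∀ {u d u′ d′} → u + 0 * d ≡ u′ + 0 * d′ → u + 1 * d ≡ u′ + 1 * d′ → (u , d) ≡ (u′ , d′)
  same {u} {d} {u′} {d′} p₀ p₁ with trans (sym (+-identityʳ u)) (trans p₀ (+-identityʳ u′))
  ... | refl = cong (u ,_) (trans (sym (+-identityʳ d)) (trans (+-cancelˡ-≡ u _ _ p₁) (+-identityʳ d′)))
  injective : ∀ p p′ q → p ∈ progressions s (map β L) → p′ ∈ progressions s (map β L) →
    R p q → R p′ q → p ≡ p′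
  injective (u , d) (u′ , d′) (x , e) _ _ (1≤d , transferred g g∈ src tgt) (1≤d′ , transferred g′ g∈′ src′ tgt′)
    = go tgt tgt′
    where
    link : ∀ i j (i<s : i < s) (j<s : j < s) → α (g i) ≡ α (g′ j) → u + i * d ≡ u′ + j * d′
    link i j i<s j<s eq =
      trans (sym (src i i<s)) (trans (preserves-≡ α β pres⁻ _ _ (g∈ i i<s) (g∈′ j j<s) eq) (src′ j j<s))
    ends : ∀ {h h′ : ℕ → X} → (∀ i → i < s → α (h i) ≡ x + i * e) →
      (∀ i → i < s → α (h′ i) + i * e ≡ x + pred s * e) →
      α (h 0) ≡ α (h′ (pred s)) × α (h (pred s)) ≡ α (h′ 0)
    ends inc dec =
        trans (inc 0 0<s) (trans (+-identityʳ x) (sym (+-cancelʳ-≡ _ _ _ (dec (pred s) last<s))))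
      , trans (inc _ last<s) (trans (sym (dec 0 0<s)) (+-identityʳ _))
    pred-pos : pred s ≡ suc (pred (pred s))
    pred-pos = sym (suc-pred (pred s) {{>-nonZero (<⇒≤pred 2≤s)}})
    clash : ∀ {v c v′ c′} → 1 ≤ c → 1 ≤ c′ → v + 0 * c ≡ v′ + pred s * c′ → v + pred s * c ≡ v′ + 0 * c′ → ⊥
    clash {v} {c} {v′} {c′} 1≤c _ p₀ p₁ = <⇒≱ (begin-strict
      v + 0 * c <⟨ +-monoʳ-< v (≤-trans 1≤c (≤-trans (m≤m+n c _) (≤-reflexive (cong (_* c) (sym pred-pos))))) ⟩
      v + pred s * c ≡⟨ p₁ ⟩
      v′ + 0 * c′ ∎) (≤-trans (+-monoʳ-≤ v′ z≤n) (≤-reflexive (sym p₀)))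
      where open ≤-Reasoning
    go : _ → _ → (u , d) ≡ (u′ , d′)
    go (inj₁ inc) (inj₁ inc′) = same (link 0 0 0<s 0<s (trans (inc 0 0<s) (sym (inc′ 0 0<s))))
                                      (link 1 1 2≤s 2≤s (trans (inc 1 2≤s) (sym (inc′ 1 2≤s))))
    go (inj₂ dec) (inj₂ dec′) = same
      (link 0 0 0<s 0<s (+-cancelʳ-≡ (0 * e) _ _ (trans (dec 0 0<s) (sym (dec′ 0 0<s)))))
      (link 1 1 2≤s 2≤s (+-cancelʳ-≡ (1 * e) _ _ (trans (dec 1 2≤s) (sym (dec′ 1 2≤s)))))
    go (inj₁ inc) (inj₂ dec′) = let p , q = ends {g} {g′} inc dec′
      in ⊥-elim (clash {u} {d} {u′} {d′} 1≤d 1≤d′ (link 0 _ 0<s last<s p) (link _ 0 last<s 0<s q))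
    go (inj₂ dec) (inj₁ inc′) = let p , q = ends {g′} {g} inc′ dec
      in ⊥-elim (clash {u′} {d′} {u} {d} 1≤d′ 1≤d (sym (link _ 0 last<s 0<s (sym p))) (sym (link 0 _ 0<s last<s (sym q))))

-- Homogeneous linear systems over ℤ

dot : ∀ {n} → Vec ℤ n → Vec ℤ n → ℤ
dot [] [] = 0ℤ
dot (a ∷ f) (x ∷ xs) = a ℤ.* x ℤ.+ dot f xs

combination : ∀ {n} → ℤ → ℤ → Vec ℤ n → Vec ℤ n → Vec ℤ n
combination c h = Vec.zipWith (λ a b → c ℤ.* a ℤ.- h ℤ.* b)

dot-combination : ∀ {n} c h (f g x : Vec ℤ n) →
  dot (combination c h f g) x ≡ c ℤ.* dot f x ℤ.- h ℤ.* dot g x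
dot-combination c h [] [] [] = zero-lemma c h
  where
  zero-lemma : ∀ c h → 0ℤ ≡ c ℤ.* 0ℤ ℤ.- h ℤ.* 0ℤ
  zero-lemma = ℤSolver.solve-∀
dot-combination c h (a ∷ f) (b ∷ g) (x ∷ xs) =
  trans (cong (λ t → (c ℤ.* a ℤ.- h ℤ.* b) ℤ.* x ℤ.+ t) (dot-combination c h f g xs))
        (step c h a b x (dot f xs) (dot g xs))
  where
  step : ∀ c h a b x p q → (c ℤ.* a ℤ.- h ℤ.* b) ℤ.* x ℤ.+ (c ℤ.* p ℤ.- h ℤ.* q)
    ≡ c ℤ.* (a ℤ.* x ℤ.+ p) ℤ.- h ℤ.* (b ℤ.* x ℤ.+ q)
  step = ℤSolver.solve-∀

dot-scale : ∀ {n} c (f x : Vec ℤ n) → dot f (Vec.map (c ℤ.*_) x) ≡ c ℤ.* dot f x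
dot-scale c [] [] = sym (ℤP.*-zeroʳ c)
dot-scale c (a ∷ f) (x ∷ xs) = trans (cong (λ t → a ℤ.* (c ℤ.* x) ℤ.+ t) (dot-scale c f xs)) (step c a x (dot f xs))
  where
  step : ∀ c a x p → a ℤ.* (c ℤ.* x) ℤ.+ c ℤ.* p ≡ c ℤ.* (a ℤ.* x ℤ.+ p)
  step = ℤSolver.solve-∀

Solves : ∀ {n} → List (Vec ℤ n) → List (Vec ℤ n) → Vec ℤ n → Set
Solves E I x = (∀ f → f ∈ E → dot f x ≡ 0ℤ) × (∀ f → f ∈ I → dot f x ≢ 0ℤ)

substitute : ∀ {n} → ℤ → Vec ℤ n → Vec ℤ (suc n) → Vec ℤ n
substitute c g (h ∷ f) = combination c h f g

-- Setting the first variable to -g·x and scaling the others by c solves c x₀ + g·x = 0.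
dot-substitute : ∀ {n} c (g : Vec ℤ n) f x →
  dot f (ℤ.- dot g x ∷ Vec.map (c ℤ.*_) x) ≡ dot (substitute c g f) x
dot-substitute c g (h ∷ f) x = trans (cong (λ t → h ℤ.* ℤ.- dot g x ℤ.+ t) (dot-scale c f x))
  (trans (step c h (dot f x) (dot g x)) (sym (dot-combination c h f g x)))
  where
  step : ∀ c h p q → h ℤ.* ℤ.- q ℤ.+ c ℤ.* p ≡ c ℤ.* p ℤ.- h ℤ.* q
  step = ℤSolver.solve-∀

dot-substitute⁻ : ∀ {n} c (g : Vec ℤ n) f x₀ x → dot (c ∷ g) (x₀ ∷ x) ≡ 0ℤ →
  dot (substitute c g f) x ≡ c ℤ.* dot f (x₀ ∷ x)
dot-substitute⁻ c g (h ∷ f) x₀ x eq = trans (dot-combination c h f g x)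
  (trans (step c h x₀ (dot f x) (dot g x)) (trans (cong (λ t → c ℤ.* (h ℤ.* x₀ ℤ.+ dot f x) ℤ.- h ℤ.* t) eq)
    (drop-zero _ h)))
  where
  step : ∀ c h x₀ p q → c ℤ.* p ℤ.- h ℤ.* q ≡ c ℤ.* (h ℤ.* x₀ ℤ.+ p) ℤ.- h ℤ.* (c ℤ.* x₀ ℤ.+ q)
  step = ℤSolver.solve-∀
  drop-zero : ∀ a h → a ℤ.- h ℤ.* 0ℤ ≡ a
  drop-zero = ℤSolver.solve-∀

head-zero? : ∀ {n} (f : Vec ℤ (suc n)) → Dec (Vec.head f ≡ 0ℤ)
head-zero? f = Vec.head f ℤP.≟ 0ℤ

dot-head-zero : ∀ {n} (f : Vec ℤ (suc n)) x₀ x → Vec.head f ≡ 0ℤ → dot f (x₀ ∷ x) ≡ dot (Vec.tail f) x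
dot-head-zero (_ ∷ f) x₀ x refl = step x₀ (dot f x)
  where
  step : ∀ x₀ p → 0ℤ ℤ.* x₀ ℤ.+ p ≡ p
  step = ℤSolver.solve-∀

-- If `h * B + p` vanished with `h` non-zero, then `B ≤ ∣h∣ * B = ∣p∣`.
dot-head-large : ∀ {n} (f : Vec ℤ (suc n)) B x → Vec.head f ≢ 0ℤ → ℤ.∣ dot (Vec.tail f) x ∣ < B →
  dot f (ℤ.+ B ∷ x) ≢ 0ℤ
dot-head-large (h ∷ f) B x h≢0 small eq = <⇒≱ small (begin
  B ≡⟨ sym (*-identityˡ B) ⟩
  1 * B ≤⟨ *-monoˡ-≤ B (n≢0⇒n>0 (h≢0 ∘ ℤP.∣i∣≡0⇒i≡0)) ⟩
  ℤ.∣ h ∣ * B ≡⟨ sym (ℤP.abs-* h (ℤ.+ B)) ⟩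
  ℤ.∣ h ℤ.* ℤ.+ B ∣ ≡⟨ cong ℤ.∣_∣ (trans (cancel (h ℤ.* ℤ.+ B) (dot f x)) (cong (ℤ._- dot f x) eq)) ⟩
  ℤ.∣ 0ℤ ℤ.- dot f x ∣ ≡⟨ trans (cong ℤ.∣_∣ (ℤP.+-identityˡ (ℤ.- dot f x))) (ℤP.∣-i∣≡∣i∣ (dot f x)) ⟩
  ℤ.∣ dot f x ∣ ∎)
  where
  open ≤-Reasoning
  cancel : ∀ a p → a ≡ a ℤ.+ p ℤ.- p
  cancel = ℤSolver.solve-∀

-- An equation with leading coefficient `c ≢ 0` eliminates the first variable. Since the system is
-- homogeneous, the solution may be multiplied by `c` instead of dividing, and this changes no
-- vanishing condition. If no equation contains the first variable, it is free and is taken so large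
-- that every inequation containing it holds; only the other inequations survive.
solve? : ∀ n (E I : List (Vec ℤ n)) → Dec (Σ (Vec ℤ n) (Solves E I))
solve? zero E [] = yes ([] , (λ { [] _ → refl }) , λ _ ())
solve? zero E ([] ∷ I) = no λ { ([] , _ , ne) → ne [] (here refl) refl }
solve? (suc n) E I with any? (λ f → ¬? (head-zero? f)) E
... | yes pivot with find pivot
... | c ∷ g , f∈ , c≢0 = Dec.map′ to from (solve? n (map (substitute c g) E) (map (substitute c g) I))
  where
  to : Σ (Vec ℤ n) (Solves _ _) → Σ (Vec ℤ (suc n)) (Solves E I)
  to (x , eqs , nes) = _ ,
    (λ f f∈ → trans (dot-substitute c g f x) (eqs _ (∈-map⁺ _ f∈))) ,
    λ f f∈ eq → nes _ (∈-map⁺ _ f∈) (trans (sym (dot-substitute c g f x)) eq)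
  from : Σ (Vec ℤ (suc n)) (Solves E I) → Σ (Vec ℤ n) (Solves _ _)
  from (x₀ ∷ x , eqs , nes) = x , reduced-eqs , reduced-nes
    where
    reduced-eqs : ∀ f → f ∈ map (substitute c g) E → dot f x ≡ 0ℤ
    reduced-eqs _ f∈E with ∈-map⁻ _ f∈E
    ... | f , f∈′ , refl = trans (dot-substitute⁻ c g f x₀ x (eqs _ f∈))
      (trans (cong (c ℤ.*_) (eqs f f∈′)) (ℤP.*-zeroʳ c))
    reduced-nes : ∀ f → f ∈ map (substitute c g) I → dot f x ≢ 0ℤ
    reduced-nes _ f∈I eq with ∈-map⁻ _ f∈I
    ... | f , f∈′ , refl with ℤP.i*j≡0⇒i≡0∨j≡0 c (trans (sym (dot-substitute⁻ c g f x₀ x (eqs _ f∈))) eq)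
    ... | inj₁ c≡0 = c≢0 c≡0
    ... | inj₂ z = nes f f∈′ z
solve? (suc n) E I | no none =
  Dec.map′ to from (solve? n (map Vec.tail E) (map Vec.tail (filter head-zero? I)))
  where
  head≡0 : ∀ f → f ∈ E → Vec.head f ≡ 0ℤ
  head≡0 f f∈ with head-zero? f
  ... | yes eq = eq
  ... | no ne = contradiction (lose f∈ ne) none
  to : Σ (Vec ℤ n) (Solves _ _) → Σ (Vec ℤ (suc n)) (Solves E I)
  to (x , eqs , nes) = ℤ.+ B ∷ x ,
    (λ f f∈ → trans (dot-head-zero f (ℤ.+ B) x (head≡0 f f∈)) (eqs _ (∈-map⁺ _ f∈))) , large
    where
    size : Vec ℤ (suc n) → ℕ
    size f = ℤ.∣ dot (Vec.tail f) x ∣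
    B = suc (∑ I size)
    large : ∀ f → f ∈ I → dot f (ℤ.+ B ∷ x) ≢ 0ℤ
    large f f∈ with head-zero? f
    ... | yes z = λ eq → nes _ (∈-map⁺ _ (∈-filter⁺ head-zero? f∈ z)) (trans (sym (dot-head-zero f (ℤ.+ B) x z)) eq)
    ... | no nz = dot-head-large f B x nz (s≤s (∑-member size f∈))
  from : Σ (Vec ℤ (suc n)) (Solves E I) → Σ (Vec ℤ n) (Solves _ _)
  from (x₀ ∷ x , eqs , nes) = x , reduced-eqs , reduced-nes
    where
    reduced-eqs : ∀ f → f ∈ map Vec.tail E → dot f x ≡ 0ℤ
    reduced-eqs _ f∈E with ∈-map⁻ _ f∈E
    ... | f , f∈′ , refl = trans (sym (dot-head-zero f x₀ x (head≡0 f f∈′))) (eqs f f∈′)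
    reduced-nes : ∀ f → f ∈ map Vec.tail (filter head-zero? I) → dot f x ≢ 0ℤ
    reduced-nes _ f∈I eq with ∈-map⁻ _ f∈I
    ... | f , f∈′ , refl with ∈-filter⁻ head-zero? {xs = I} f∈′
    ... | f∈″ , z = nes f f∈″ (trans (dot-head-zero f x₀ x z) eq)

-- Vanishing patterns of linear forms

SamePattern : ∀ {n} → List (Vec ℤ n) → Vec ℤ n → Vec ℤ n → Set
SamePattern F x y = ∀ f → f ∈ F → (dot f x ≡ 0ℤ → dot f y ≡ 0ℤ) × (dot f y ≡ 0ℤ → dot f x ≡ 0ℤ)

-- Each form of `F` is in turn imposed as an equation and as an inequation. Every leaf of this
-- binary tree is one system decided by `solve?`, and a solvable leaf contributes one
-- representative.
patterns : ∀ {n} (F E I : List (Vec ℤ n)) →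
  Σ (List (Vec ℤ n)) λ ys → ∀ x → Solves E I x → Σ (Vec ℤ n) λ y → y ∈ ys × Solves E I y × SamePattern F x y
patterns {n} [] E I with solve? n E I
... | yes (y , sol) = [ y ] , λ x _ → y , here refl , sol , λ _ ()
... | no none = [] , λ x sol → contradiction (x , sol) none
patterns {n} (f ∷ F) E I with patterns F (f ∷ E) I | patterns F E (f ∷ I)
... | ys , spec | zs , spec′ = ys ++ zs , cover
  where
  cover : ∀ x → Solves E I x → Σ (Vec ℤ n) λ y → y ∈ ys ++ zs × Solves E I y × SamePattern (f ∷ F) x y
  cover x (eqs , nes) with dot f x ℤP.≟ 0ℤ
  ... | yes z with spec x ((λ { _ (here refl) → z ; g (there g∈) → eqs g g∈ }) , nes)
  ... | y , y∈ , (eqs′ , nes′) , same = y , ∈-++⁺ˡ y∈ , ((λ g g∈ → eqs′ g (there g∈)) , nes′) ,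
    λ { _ (here refl) → (λ _ → eqs′ f (here refl)) , λ _ → z ; g (there g∈) → same g g∈ }
  cover x (eqs , nes) | no nz with spec′ x (eqs , λ { _ (here refl) → nz ; g (there g∈) → nes g g∈ })
  ... | y , y∈ , (eqs′ , nes′) , same = y , ∈-++⁺ʳ ys y∈ , (eqs′ , λ g g∈ → nes′ g (there g∈)) ,
    λ { _ (here refl) → (λ eq → contradiction eq nz) , (λ eq → contradiction eq (nes′ f (here refl)))
      ; g (there g∈) → same g g∈ }

unit : ∀ {n} → Fin n → Vec ℤ n
unit zero = 1ℤ ∷ Vec.replicate _ 0ℤ
unit (suc i) = 0ℤ ∷ unit i

dot-zero : ∀ {n} (x : Vec ℤ n) → dot (Vec.replicate n 0ℤ) x ≡ 0ℤ
dot-zero [] = refl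
dot-zero (a ∷ x) = trans (ℤP.+-identityˡ _) (dot-zero x)

dot-unit : ∀ {n} (i : Fin n) x → dot (unit i) x ≡ Vec.lookup x i
dot-unit zero (a ∷ x) = trans (cong (λ t → 1ℤ ℤ.* a ℤ.+ t) (dot-zero x)) (trans (ℤP.+-identityʳ _) (ℤP.*-identityˡ a))
dot-unit (suc i) (a ∷ x) = trans (ℤP.+-identityˡ _) (dot-unit i x)

midpoint : ∀ {n} → Fin n → Fin n → Fin n → Vec ℤ n
midpoint i j l = combination 1ℤ ℤ.-1ℤ (combination 1ℤ (ℤ.+ 2) (unit i) (unit j)) (unit l)

dot-midpoint : ∀ {n} (i j l : Fin n) x →
  dot (midpoint i j l) x ≡ Vec.lookup x i ℤ.+ Vec.lookup x l ℤ.- ℤ.+ 2 ℤ.* Vec.lookup x j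
dot-midpoint i j l x = trans (dot-combination 1ℤ ℤ.-1ℤ (combination 1ℤ (ℤ.+ 2) (unit i) (unit j)) (unit l) x)
  (trans (cong₂ (λ a b → 1ℤ ℤ.* a ℤ.- ℤ.-1ℤ ℤ.* b)
    (trans (dot-combination 1ℤ (ℤ.+ 2) (unit i) (unit j) x)
      (cong₂ (λ a b → 1ℤ ℤ.* a ℤ.- ℤ.+ 2 ℤ.* b) (dot-unit i x) (dot-unit j x))) (dot-unit l x))
    (step (Vec.lookup x i) (Vec.lookup x j) (Vec.lookup x l)))
  where
  step : ∀ a b c → 1ℤ ℤ.* (1ℤ ℤ.* a ℤ.- ℤ.+ 2 ℤ.* b) ℤ.- ℤ.-1ℤ ℤ.* c ≡ a ℤ.+ c ℤ.- ℤ.+ 2 ℤ.* b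
  step = ℤSolver.solve-∀

midpoint-ℕ⁺ : ∀ a b c → a + c ≡ 2 * b → ℤ.+ a ℤ.+ ℤ.+ c ℤ.- ℤ.+ 2 ℤ.* ℤ.+ b ≡ 0ℤ
midpoint-ℕ⁺ a b c eq = ℤP.i≡j⇒i-j≡0 (trans (cong ℤ.+_ eq) (ℤP.pos-* 2 b))

midpoint-ℕ⁻ : ∀ a b c → ℤ.+ a ℤ.+ ℤ.+ c ℤ.- ℤ.+ 2 ℤ.* ℤ.+ b ≡ 0ℤ → a + c ≡ 2 * b
midpoint-ℕ⁻ a b c eq = ℤP.+-injective (trans (ℤP.i-j≡0⇒i≡j _ _ eq) (sym (ℤP.pos-* 2 b)))

-- Existence of the extremal numbers

argmax : ∀ (xs : List X) (val : X → ℕ) → 1 ≤ length xs → Σ X λ x → x ∈ xs × (∀ y → y ∈ xs → val y ≤ val x)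
argmax (x ∷ []) val _ = x , here refl , λ { _ (here refl) → ≤-refl }
argmax (x ∷ x′ ∷ xs) val _ with argmax (x′ ∷ xs) val (s≤s z≤n)
... | m , m∈ , top with val m ≤? val x
... | yes m≤x = x , here refl , λ { _ (here refl) → ≤-refl ; y (there y∈) → ≤-trans (top y y∈) m≤x }
... | no m≰x = m , there m∈ , λ { _ (here refl) → <⇒≤ (≰⇒> m≰x) ; y (there y∈) → top y y∈ }

∈⇒nonempty : ∀ {x : X} {xs} → x ∈ xs → 1 ≤ length xs
∈⇒nonempty (here _) = s≤s z≤n
∈⇒nonempty (there _) = s≤s z≤n

nonempty⇒∈ : ∀ (xs : List X) → 1 ≤ length xs → Σ X (_∈ xs)
nonempty⇒∈ (x ∷ _) _ = x , here refl

-- `Q` may hold for infinitely many `x`; it is enough that members of the finite list `cs`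
-- satisfying `Q` dominate all of them.
maximum-exists : ∀ (cs : List X) {Q : X → Set} (Q? : ∀ x → Dec (Q x)) (val : X → ℕ) →
  (∀ x → Q x → Σ X λ c → c ∈ cs × Q c × val x ≤ val c) → Σ X Q →
  Σ X λ m → Q m × (∀ x → Q x → val x ≤ val m)
maximum-exists cs Q? val dom (x₀ , q₀) with dom x₀ q₀
... | c₀ , c₀∈ , qc₀ , _ with argmax (filter Q? cs) val (∈⇒nonempty (∈-filter⁺ Q? c₀∈ qc₀))
... | m , m∈ , top = m , proj₂ (∈-filter⁻ Q? {xs = cs} m∈) ,
  λ x q → let c , c∈ , qc , x≤c = dom x q in ≤-trans x≤c (top c (∈-filter⁺ Q? c∈ qc))

sublists : List X → List (List X)
sublists [] = [ [] ]
sublists (x ∷ xs) = map (x ∷_) (sublists xs) ++ sublists xs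

filter∈sublists : ∀ {P : X → Set} (P? : ∀ x → Dec (P x)) xs → filter P? xs ∈ sublists xs
filter∈sublists P? [] = here refl
filter∈sublists P? (x ∷ xs) with P? x
... | yes _ = ∈-++⁺ˡ (∈-map⁺ (x ∷_) (filter∈sublists P? xs))
... | no _ = ∈-++⁺ʳ (map (x ∷_) (sublists xs)) (filter∈sublists P? xs)

interval : ℕ → List ℕ
interval n = map suc (upTo n)

∈-interval⁺ : ∀ {n a} → 1 ≤ a → a ≤ n → a ∈ interval n
∈-interval⁺ {a = suc a} _ a≤n = ∈-map⁺ suc (∈-upTo⁺ a≤n)

∈-interval⁻ : ∀ {n a} → a ∈ interval n → 1 ≤ a × a ≤ n
∈-interval⁻ a∈ with ∈-map⁻ suc a∈
... | b , b∈ , refl = s≤s z≤n , ∈-upTo⁻ b∈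

-- Any admissible list has the same elements as a filtered copy of `interval n`, so sublists of the
-- interval are enough candidates.
IsRk-exists : ∀ k n → 2 ≤ k → Σ ℕ (IsRk k n)
IsRk-exists k n 2≤k =
  let M , (u , bd , free) , top = maximum-exists (sublists (interval n)) Q? length dominated ([] , [] , [] , empty-free)
  in length M , (M , u , bd , free , refl) , λ A uA bA fA → top A (uA , bA , fA)
  where
  Q : List ℕ → Set
  Q A = Unique A × All (λ a → 1 ≤ a × a ≤ n) A × KAPFree k A
  Q? : ∀ A → Dec (Q A)
  Q? A = unique? A ×-dec All.all? (λ a → (1 ≤? a) ×-dec (a ≤? n)) A ×-dec KAPFree? k A 2≤k
  empty-free : KAPFree k []
  empty-free x d _ ap = case APin-lookup ap 0 (<-trans (s≤s z≤n) 2≤k) of λ ()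
  dominated : ∀ A → Q A → Σ (List ℕ) λ C → C ∈ sublists (interval n) × Q C × length A ≤ length C
  dominated A (u , bd , free) = C , filter∈sublists (_∈? A) (interval n) ,
    (UP.filter⁺ (_∈? A) (UP.map⁺ suc-injective (UP.upTo⁺ n)) ,
     All.tabulate (λ a∈ → ∈-interval⁻ {n} (proj₁ (∈-filter⁻ (_∈? A) a∈))) ,
     KAPFree-⊆ (λ x x∈ → proj₂ (∈-filter⁻ (_∈? A) {xs = interval n} x∈)) free) ,
    injection-length A C id u (λ a a∈ →
      let 1≤a , a≤n = All.lookup bd a∈ in ∈-filter⁺ (_∈? A) (∈-interval⁺ 1≤a a≤n) a∈) (λ _ _ _ _ eq → eq)
    where
    C = filter (_∈? A) (interval n)

map-lookup-allFin : ∀ (A : List ℕ) → map (Data.List.lookup A) (allFin (length A)) ≡ A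
map-lookup-allFin A = trans (map-tabulate id (Data.List.lookup A)) (tabulate-lookup A)

-- Adding ∑ |xⱼ| to every coordinate makes x nonnegative and keeps its midpoint relations.
shifted : ∀ {n} → Vec ℤ n → Fin n → ℕ
shifted {n} x i = ℤ.∣ Vec.lookup x i ℤ.+ ℤ.+ ∑ (allFin n) (λ j → ℤ.∣ Vec.lookup x j ∣) ∣

shifted-spec : ∀ {n} (x : Vec ℤ n) i → ℤ.+ shifted x i ≡ Vec.lookup x i ℤ.+ ℤ.+ ∑ (allFin n) (λ j → ℤ.∣ Vec.lookup x j ∣)
shifted-spec {n} x i = ℤP.0≤i⇒+∣i∣≡i (nonneg (Vec.lookup x i) _ (∑-member (λ j → ℤ.∣ Vec.lookup x j ∣) (∈-allFin i)))
  where
  nonneg : ∀ a b → ℤ.∣ a ∣ ≤ b → 0ℤ ℤ.≤ a ℤ.+ ℤ.+ b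
  nonneg (ℤ.+ a) b _ = ℤ.+≤+ z≤n
  nonneg (ℤ.-[1+ a ]) b h = ℤP.≤-trans (ℤ.+≤+ z≤n) (ℤP.≤-reflexive (sym (ℤP.⊖-≥ h)))

midpoints : ∀ n → List (Vec ℤ n)
midpoints n = map (λ { (i , j , l) → midpoint i j l }) (cartesianProduct (allFin n) (cartesianProduct (allFin n) (allFin n)))

midpoint∈midpoints : ∀ {n} (i j l : Fin n) → midpoint i j l ∈ midpoints n
midpoint∈midpoints i j l = ∈-map⁺ (λ { (i , j , l) → midpoint i j l })
  (∈-cartesianProduct⁺ (∈-allFin i) (∈-cartesianProduct⁺ (∈-allFin j) (∈-allFin l)))

-- Read `A` as a vector in ℤ^n. Distinctness (through degenerate relations), freedom from k-term
-- progressions and the value of `fs` depend only on which forms in `midpoints n` vanish, so the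
-- representative of the pattern of `A` is admissible and has at least as many progressions.
IsFsk-exists : ∀ s k n → 2 ≤ s → 2 ≤ k →
  (Σ (List ℕ) λ A → Unique A × length A ≡ n × KAPFree k A) → Σ ℕ (IsFsk s k n)
IsFsk-exists s k n 2≤s 2≤k start with patterns (midpoints n) [] []
... | reps , spec =
  let M , (u , len , free) , top = maximum-exists (map realise reps) Q? (fs s) dominated start
  in fs s M , (M , u , len , free , refl) , λ A uA lA fA → top A (uA , lA , fA)
  where
  realise : Vec ℤ n → List ℕ
  realise x = map (shifted x) (allFin n)
  Q : List ℕ → Set
  Q A = Unique A × length A ≡ n × KAPFree k A
  Q? : ∀ A → Dec (Q A)
  Q? A = unique? A ×-dec (length A ≟ n) ×-dec KAPFree? k A 2≤k
  dominated : ∀ A → Q A → Σ (List ℕ) λ C → C ∈ map realise reps × Q C × fs s A ≤ fs s C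
  dominated A (u , refl , free) with spec (Vec.tabulate (λ i → ℤ.+ Data.List.lookup A i)) ((λ _ ()) , λ _ ())
  ... | y , y∈ , _ , same = realise y , ∈-map⁺ realise y∈ ,
    ( unique-map (allFin n) β (UP.allFin⁺ n) (λ i j i∈ j∈ eq → α-injective i j (preserves-≡ β α β→α i j i∈ j∈ eq))
    , trans (length-map β (allFin n)) (length-tabulate {n = n} id)
    , KAPFree-transfer 2≤k β→α (preserves-≡ α β α→β) (subst (KAPFree k) (sym A≡) free) ) ,
    subst (λ B → fs s B ≤ fs s (realise y)) A≡ (fs-transfer {L = allFin n} {α} {β} 2≤s α→β β→α)
    where
    α β : Fin (length A) → ℕ
    α = Data.List.lookup A
    β = shifted y
    A≡ : map α (allFin n) ≡ A
    A≡ = map-lookup-allFin A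
    x : Vec ℤ n
    x = Vec.tabulate (λ i → ℤ.+ α i)
    α-injective : ∀ i j → α i ≡ α j → i ≡ j
    α-injective i j = unique-map-injective α (allFin n) (subst Unique (sym A≡) u) i j (∈-allFin i) (∈-allFin j)
    dot-x : ∀ i j l → dot (midpoint i j l) x ≡ ℤ.+ α i ℤ.+ ℤ.+ α l ℤ.- ℤ.+ 2 ℤ.* ℤ.+ α j
    dot-x i j l rewrite dot-midpoint i j l x | VecP.lookup∘tabulate (λ i → ℤ.+ α i) i
      | VecP.lookup∘tabulate (λ i → ℤ.+ α i) j | VecP.lookup∘tabulate (λ i → ℤ.+ α i) l = refl
    dot-y : ∀ i j l → dot (midpoint i j l) y ≡ ℤ.+ β i ℤ.+ ℤ.+ β l ℤ.- ℤ.+ 2 ℤ.* ℤ.+ β j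
    dot-y i j l = trans (dot-midpoint i j l y)
      (trans (step (Vec.lookup y i) (Vec.lookup y j) (Vec.lookup y l) _)
        (cong₂ ℤ._-_ (cong₂ ℤ._+_ (sym (shifted-spec y i)) (sym (shifted-spec y l)))
          (cong (ℤ.+ 2 ℤ.*_) (sym (shifted-spec y j)))))
      where
      step : ∀ a b c t → a ℤ.+ c ℤ.- ℤ.+ 2 ℤ.* b ≡ a ℤ.+ t ℤ.+ (c ℤ.+ t) ℤ.- ℤ.+ 2 ℤ.* (b ℤ.+ t)
      step = ℤSolver.solve-∀
    α→β : PreservesMidpoints (allFin n) α β
    α→β i j l _ _ _ eq = midpoint-ℕ⁻ (β i) (β j) (β l) (trans (sym (dot-y i j l))
      (proj₁ (same _ (midpoint∈midpoints i j l)) (trans (dot-x i j l) (midpoint-ℕ⁺ (α i) (α j) (α l) eq))))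
    β→α : PreservesMidpoints (allFin n) β α
    β→α i j l _ _ _ eq = midpoint-ℕ⁻ (α i) (α j) (α l) (trans (sym (dot-x i j l))
      (proj₂ (same _ (midpoint∈midpoints i j l)) (trans (dot-y i j l) (midpoint-ℕ⁺ (β i) (β j) (β l) eq))))

-- A Balog–Szemerédi–Gowers argument

length-× : ∀ (xs : List X) (ys : List Y) → length (cartesianProduct xs ys) ≡ length xs * length ys
length-× [] ys = refl
length-× (x ∷ xs) ys = trans (length-++ (map (x ,_) ys)) (cong₂ _+_ (length-map (x ,_) ys) (length-× xs ys))

module DependentRandomChoice (A : List X) {G : X → X → Set} (G? : ∀ a b → Dec (G a b)) (m : ℕ) where

  n : ℕ
  n = length A

  codegree : X → X → ℕ
  codegree a a′ = ∑ A (λ b → ind (G? a b) * ind (G? a′ b))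

  -- With δ = m / n² the threshold for the codegree is δ² n / 32. The factor 32 leaves room for poor
  -- pairs to be at most a sixteenth of all pairs in `choice`.
  rich? : ∀ a a′ → Dec (m * m ≤ n * n * n * 32 * codegree a a′)
  rich? a a′ = _ ≤? _

  poor : X → X → ℕ
  poor a a′ = ind (¬? (rich? a a′))

  poor-bound : ∀ a a′ → n * n * n * 32 * codegree a a′ * poor a a′ ≤ m * m
  poor-bound a a′ with rich? a a′
  ... | yes _ = ≤-trans (≤-reflexive (*-zeroʳ (n * n * n * 32 * codegree a a′))) z≤n
  ... | no p = ≤-trans (≤-reflexive (*-identityʳ (n * n * n * 32 * codegree a a′))) (<⇒≤ (≰⇒> p))

  neighbourhood : X → List X
  neighbourhood b = filter (λ a → G? a b) A

  degree : X → ℕ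
  degree b = ∑ A (λ a → ind (G? a b))

  poor-pairs : X → ℕ
  poor-pairs b = ∑ A (λ a → ∑ A (λ a′ → ind (G? a b) * ind (G? a′ b) * poor a a′))

  poor-pairs-neighbourhood : ∀ b →
    ∑ (neighbourhood b) (λ a → ∑ (neighbourhood b) (poor a)) ≡ poor-pairs b
  poor-pairs-neighbourhood b = trans (∑-filter (λ a → G? a b) A _) (∑-cong A λ a _ →
    trans (cong (ind (G? a b) *_) (∑-filter (λ a → G? a b) A _))
      (trans (sym (∑-*ˡ A (ind (G? a b)) _)) (∑-cong A λ a′ _ → sym (*-assoc (ind (G? a b)) _ _))))

  total-poor : n * n * n * 32 * ∑ A poor-pairs ≤ n * (n * (m * m))
  total-poor = begin
    n * n * n * 32 * ∑ A poor-pairs ≡⟨ cong (n * n * n * 32 *_) regroup ⟩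
    n * n * n * 32 * ∑ A (λ a → ∑ A (λ a′ → codegree a a′ * poor a a′))
      ≡⟨ trans (sym (∑-*ˡ A (n * n * n * 32) _)) (∑-cong A λ a _ → trans (sym (∑-*ˡ A (n * n * n * 32) _))
            (∑-cong A λ a′ _ → sym (*-assoc (n * n * n * 32) (codegree a a′) (poor a a′)))) ⟩
    ∑ A (λ a → ∑ A (λ a′ → n * n * n * 32 * codegree a a′ * poor a a′))
      ≤⟨ ∑-mono A (λ a _ → ∑-mono A (λ a′ _ → poor-bound a a′)) ⟩
    ∑ A (λ a → ∑ A (λ a′ → m * m)) ≡⟨ trans (∑-cong A (λ _ _ → ∑-const A (m * m))) (∑-const A (n * (m * m))) ⟩
    n * (n * (m * m)) ∎
    where
    open ≤-Reasoning
    regroup : ∑ A poor-pairs ≡ ∑ A (λ a → ∑ A (λ a′ → codegree a a′ * poor a a′))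
    regroup = trans (∑-swap A A _) (∑-cong A λ a _ → trans (∑-swap A A _) (∑-cong A λ a′ _ → ∑-*ʳ A (poor a a′) _))

  -- By `cauchy` the squared degrees sum to at least m² / n, while poor pairs, having small
  -- codegree, occur at most m² / (32 n) times in all neighbourhoods together. Hence some `b`
  -- satisfies m² + 32 n² · poor ≤ 2 n² · degree², and dropping either summand on the left gives one
  -- of the two conclusions.
  choice : 1 ≤ n → m ≤ ∑ A (λ a → ∑ A (λ b → ind (G? a b))) →
    Σ X λ b → m * m ≤ 2 * (n * n) * (length (neighbourhood b) * length (neighbourhood b))
      × ∑ (neighbourhood b) (λ a → ∑ (neighbourhood b) (poor a)) * 16 ≤ length (neighbourhood b) * length (neighbourhood b)
  choice 1≤n edges = b , ≤-trans (m≤m+n (m * m) (n * n * 32 * S)) h′ ,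
    *-cancelˡ-≤ {S * 16} {K * K} (2 * (n * n)) {{>-nonZero (*-mono-≤ {1} {2} (s≤s z≤n) (*-mono-≤ 1≤n 1≤n))}}
      (≤-trans (≤-reflexive (rescale n S)) (≤-trans (m≤n+m (n * n * 32 * S) (m * m)) h′))
    where
    open ≤-Reasoning
    D = ∑ A (λ b → degree b * degree b)
    m≤ : m ≤ ∑ A degree
    m≤ = ≤-trans edges (≤-reflexive (∑-swap A A _))
    scaled : n * (n * (m * m) + n * n * 32 * ∑ A poor-pairs) ≤ n * (2 * (n * n) * D)
    scaled = begin
      n * (n * (m * m) + n * n * 32 * ∑ A poor-pairs) ≡⟨ e₁ n (m * m) (∑ A poor-pairs) ⟩
      n * (n * (m * m)) + n * n * n * 32 * ∑ A poor-pairs ≤⟨ +-monoʳ-≤ _ total-poor ⟩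
      n * (n * (m * m)) + n * (n * (m * m)) ≡⟨ e₂ n (m * m) ⟩
      2 * (n * n) * (m * m) ≤⟨ *-monoʳ-≤ (2 * (n * n)) (≤-trans (*-mono-≤ m≤ m≤) (cauchy A degree)) ⟩
      2 * (n * n) * (n * D) ≡⟨ e₃ n D ⟩
      n * (2 * (n * n) * D) ∎
      where
      e₁ : ∀ n M B → n * (n * M + n * n * 32 * B) ≡ n * (n * M) + n * n * n * 32 * B
      e₁ = solve-∀
      e₂ : ∀ n M → n * (n * M) + n * (n * M) ≡ 2 * (n * n) * M
      e₂ = solve-∀
      e₃ : ∀ n D → 2 * (n * n) * (n * D) ≡ n * (2 * (n * n) * D)
      e₃ = solve-∀
    average : ∑ A (λ b → m * m + n * n * 32 * poor-pairs b) ≤ ∑ A (λ b → 2 * (n * n) * (degree b * degree b))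
    average = begin
      ∑ A (λ b → m * m + n * n * 32 * poor-pairs b)
        ≡⟨ trans (∑-+ A _ _) (cong₂ _+_ (∑-const A (m * m)) (∑-*ˡ A (n * n * 32) poor-pairs)) ⟩
      n * (m * m) + n * n * 32 * ∑ A poor-pairs ≤⟨ *-cancelˡ-≤ n {{>-nonZero 1≤n}} scaled ⟩
      2 * (n * n) * D ≡⟨ sym (∑-*ˡ A (2 * (n * n)) _) ⟩
      ∑ A (λ b → 2 * (n * n) * (degree b * degree b)) ∎
    picked : Σ X λ b → b ∈ A × m * m + n * n * 32 * poor-pairs b ≤ 2 * (n * n) * (degree b * degree b)
    picked = pigeonhole A (λ b → m * m + n * n * 32 * poor-pairs b) (λ b → 2 * (n * n) * (degree b * degree b)) 1≤n average
    b : X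
    b = proj₁ picked
    S K : ℕ
    S = ∑ (neighbourhood b) (λ a → ∑ (neighbourhood b) (poor a))
    K = length (neighbourhood b)
    deg≡ : degree b ≡ length (neighbourhood b)
    deg≡ = sym (length-filter-∑ (λ a → G? a b) A)
    h′ : m * m + n * n * 32 * S ≤ 2 * (n * n) * (length (neighbourhood b) * length (neighbourhood b))
    h′ = subst₂ (λ s d → m * m + n * n * 32 * s ≤ 2 * (n * n) * (d * d)) (sym (poor-pairs-neighbourhood b)) deg≡ (proj₂ (proj₂ picked))
    rescale : ∀ n S → 2 * (n * n) * (S * 16) ≡ n * n * 32 * S
    rescale = solve-∀

module FewBadPairs (A : List X) {B : X → X → Set} (B? : ∀ a b → Dec (B a b)) where

  private
    N = length A

  bad : X → ℕ
  bad a = ∑ A (λ x → ind (B? a x))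

  tame? : ∀ a → Dec (4 * bad a ≤ N)
  tame? a = _ ≤? _

  tame : List X
  tame = filter tame? A

  -- Markov's inequality: each element outside `tame` has more than N / 4 bad partners, so N² / 16
  -- bad pairs allow at most N / 4 such elements.
  many-tame : ∑ A bad * 16 ≤ N * N → N ≤ 2 * length tame
  many-tame few with N ≟ 0
  ... | yes N≡0 = ≤-trans (≤-reflexive N≡0) z≤n
  ... | no N≢0 = +-cancelʳ-≤ (2 * wild) N (2 * length tame) (begin
    N + 2 * wild ≤⟨ +-monoʳ-≤ N (≤-trans (*-monoˡ-≤ wild {2} {4} (s≤s (s≤s z≤n))) 4wild≤N) ⟩
    N + N ≡⟨ sym (cong₂ _+_ split split) ⟩
    length tame + wild + (length tame + wild) ≡⟨ double (length tame) wild ⟩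
    2 * length tame + 2 * wild ∎)
    where
    open ≤-Reasoning
    wild = ∑ A (λ a → ind (¬? (tame? a)))
    split : length tame + wild ≡ N
    split = trans (cong (_+ wild) (length-filter-∑ tame? A)) (trans (sym (∑-+ A _ _))
      (trans (∑-cong A (λ a _ → ind-¬ (tame? a))) (trans (∑-const A 1) (*-identityʳ N))))
    wild-bound : ∀ a → ind (¬? (tame? a)) * N ≤ 4 * bad a
    wild-bound a with tame? a
    ... | yes _ = z≤n
    ... | no p = ≤-trans (≤-reflexive (*-identityˡ N)) (<⇒≤ (≰⇒> p))
    sixteen : ∀ S → 4 * (4 * S) ≡ S * 16
    sixteen = solve-∀
    4wild≤N : 4 * wild ≤ N
    4wild≤N = *-cancelʳ-≤ (4 * wild) N N {{>-nonZero (n≢0⇒n>0 N≢0)}} (begin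
      4 * wild * N ≡⟨ *-assoc 4 wild N ⟩
      4 * (wild * N) ≡⟨ cong (4 *_) (sym (∑-*ʳ A N _)) ⟩
      4 * ∑ A (λ a → ind (¬? (tame? a)) * N) ≤⟨ *-monoʳ-≤ 4 (∑-mono A (λ a _ → wild-bound a)) ⟩
      4 * ∑ A (λ a → 4 * bad a) ≡⟨ trans (cong (4 *_) (∑-*ˡ A 4 bad)) (sixteen (∑ A bad)) ⟩
      ∑ A bad * 16 ≤⟨ few ⟩
      N * N ∎)
    double : ∀ a b → a + b + (a + b) ≡ 2 * a + 2 * b
    double = solve-∀

  -- Each of `a` and `b` rules out at most a quarter of the list. The remaining `x` are the middle
  -- vertices of the paths of length four from `a` to `b`.
  common : ∀ a b → a ∈ tame → b ∈ tame → N ≤ 2 * ∑ A (λ x → ind (¬? (B? a x)) * ind (¬? (B? b x)))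
  common a b a∈ b∈ = *-cancelˡ-≤ {N} {2 * C} 2 (+-cancelʳ-≤ (N + N) (2 * N) (2 * (2 * C)) (begin
    2 * N + (N + N) ≡⟨ e₁ N ⟩
    4 * N ≤⟨ *-monoʳ-≤ 4 cover ⟩
    4 * (C + (bad a + bad b)) ≡⟨ e₂ C (bad a) (bad b) ⟩
    2 * (2 * C) + (4 * bad a + 4 * bad b) ≤⟨ +-monoʳ-≤ (2 * (2 * C)) (+-mono-≤ (small a∈) (small b∈)) ⟩
    2 * (2 * C) + (N + N) ∎))
    where
    open ≤-Reasoning
    C = ∑ A (λ x → ind (¬? (B? a x)) * ind (¬? (B? b x)))
    small : ∀ {a} → a ∈ tame → 4 * bad a ≤ N
    small a∈ = proj₂ (∈-filter⁻ tame? {xs = A} a∈)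
    pointwise : ∀ {P Q : Set} (p : Dec P) (q : Dec Q) → 1 ≤ ind (¬? p) * ind (¬? q) + (ind p + ind q)
    pointwise (yes _) q = s≤s z≤n
    pointwise (no _) (yes _) = s≤s z≤n
    pointwise (no _) (no _) = s≤s z≤n
    cover : N ≤ C + (bad a + bad b)
    cover = begin
      N ≡⟨ sym (trans (∑-const A 1) (*-identityʳ N)) ⟩
      ∑ A (λ _ → 1) ≤⟨ ∑-mono A (λ x _ → pointwise (B? a x) (B? b x)) ⟩
      ∑ A (λ x → ind (¬? (B? a x)) * ind (¬? (B? b x)) + (ind (B? a x) + ind (B? b x)))
        ≡⟨ trans (∑-+ A _ _) (cong (C +_) (∑-+ A _ _)) ⟩
      C + (bad a + bad b) ∎
    e₁ : ∀ N → 2 * N + (N + N) ≡ 4 * N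
    e₁ = solve-∀
    e₂ : ∀ C a b → 4 * (C + (a + b)) ≡ 2 * (2 * C) + (4 * a + 4 * b)
    e₂ = solve-∀

-- Difference sets

diff : ℕ × ℕ → ℤ
diff (a , b) = ℤ.+ a ℤ.- ℤ.+ b

diff-cancelʳ : ∀ {a a′ b} → diff (a , b) ≡ diff (a′ , b) → a ≡ a′
diff-cancelʳ {a} {a′} {b} eq = ℤP.+-injective (trans (add (ℤ.+ a) (ℤ.+ b)) (trans (cong (ℤ._+ ℤ.+ b) eq) (sym (add (ℤ.+ a′) (ℤ.+ b)))))
  where
  add : ∀ p q → p ≡ p ℤ.- q ℤ.+ q
  add = ℤSolver.solve-∀

diff-cancelˡ : ∀ {a b b′} → diff (a , b) ≡ diff (a , b′) → b ≡ b′
diff-cancelˡ {a} {b} {b′} eq = ℤP.+-injective (trans (add (ℤ.+ a) (ℤ.+ b)) (trans (cong (λ t → ℤ.+ a ℤ.- t) eq) (sym (add (ℤ.+ a) (ℤ.+ b′)))))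
  where
  add : ∀ p q → q ≡ p ℤ.- (p ℤ.- q)
  add = ℤSolver.solve-∀

module SumGraph (P A : List ℕ) where

  edge? : ∀ a b → Dec (a + b ∈ P)
  edge? a b = a + b ∈? P

  paths : ℕ → ℕ → ℕ
  paths a x = ∑ A (λ y → ind (edge? a y) * ind (edge? x y))

  -- a - b = (a + y) - (x + y) - (b + z) + (x + z), all four sums lying in P.
  few-differences : Unique A → (A′ : List ℕ) → Unique A′ → (E : List (ℕ × ℕ)) → Unique (map diff E) → (K c : ℕ) →
    (∀ a b → (a , b) ∈ E → c ≤ K * ∑ A′ (λ x → paths a x * paths b x)) →
    length E * c ≤ K * ((length P * length P) * (length P * length P))
  few-differences uA A′ uA′ E uE K c many = begin
    length E * c ≡⟨ sym (∑-const E c) ⟩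
    ∑ E (λ _ → c) ≤⟨ ∑-mono E (λ { (a , b) e∈ → many a b e∈ }) ⟩
    ∑ E (λ { (a , b) → K * ∑ A′ (λ x → paths a x * paths b x) }) ≡⟨ ∑-*ˡ E K (λ { (a , b) → ∑ A′ (λ x → paths a x * paths b x) }) ⟩
    K * ∑ E (λ { (a , b) → ∑ A′ (λ x → paths a x * paths b x) }) ≡⟨ cong (K *_) (sym count) ⟩
    K * ∑ Ω (λ ω → ind (Q? ω)) ≤⟨ *-monoʳ-≤ K (injection-count Q? Ω PPPP φ uΩ into injective) ⟩
    K * length PPPP ≡⟨ cong (K *_) (trans (length-× PP PP) (cong₂ _*_ (length-× P P) (length-× P P))) ⟩
    K * ((length P * length P) * (length P * length P)) ∎
    where
    open ≤-Reasoning
    Point = (ℕ × ℕ) × ℕ × ℕ × ℕ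
    Ω : List Point
    Ω = cartesianProduct E (cartesianProduct A′ (cartesianProduct A A))
    PP = cartesianProduct P P
    PPPP = cartesianProduct PP PP
    uΩ : Unique Ω
    uΩ = UP.cartesianProduct⁺ (UP.map⁻ uE) (UP.cartesianProduct⁺ uA′ (UP.cartesianProduct⁺ uA uA))
    Q : Point → Set
    Q ((a , b) , x , y , z) = (a + y ∈ P × x + y ∈ P) × (b + z ∈ P × x + z ∈ P)
    Q? : ∀ ω → Dec (Q ω)
    Q? ((a , b) , x , y , z) = (edge? a y ×-dec edge? x y) ×-dec (edge? b z ×-dec edge? x z)
    φ : Point → (ℕ × ℕ) × (ℕ × ℕ)
    φ ((a , b) , x , y , z) = (a + y , x + y) , (b + z , x + z)
    into : ∀ ω → ω ∈ Ω → Q ω → φ ω ∈ PPPP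
    into ((a , b) , x , y , z) _ ((p , q) , (r , t)) =
      ∈-cartesianProduct⁺ (∈-cartesianProduct⁺ p q) (∈-cartesianProduct⁺ r t)
    injective : ∀ ω ω′ → ω ∈ Ω → ω′ ∈ Ω → Q ω → Q ω′ → φ ω ≡ φ ω′ → ω ≡ ω′
    injective ((a , b) , x , y , z) ((a′ , b′) , x′ , y′ , z′) ω∈ ω′∈ _ _ eq
      with ,-injective eq
    ... | eq₁ , eq₂ with ,-injective eq₁ | ,-injective eq₂
    -- The four sums determine `a - b`, hence the pair, since `E` holds one pair per difference;
    -- `y`, `z` and then `x` follow by cancellation.
    ... | p₁ , p₂ | p₃ , p₄ with unique-map-injective diff E uE (a , b) (a′ , b′)
        (proj₁ (∈-cartesianProduct⁻ E _ ω∈)) (proj₁ (∈-cartesianProduct⁻ E _ ω′∈)) same-diff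
      where
      alternating : ∀ a b x y z → ℤ.+ a ℤ.- ℤ.+ b ≡ (ℤ.+ (a + y) ℤ.- ℤ.+ (x + y)) ℤ.- (ℤ.+ (b + z) ℤ.- ℤ.+ (x + z))
      alternating a b x y z = ring (ℤ.+ a) (ℤ.+ b) (ℤ.+ x) (ℤ.+ y) (ℤ.+ z)
        where
        ring : ∀ a b x y z → a ℤ.- b ≡ ((a ℤ.+ y) ℤ.- (x ℤ.+ y)) ℤ.- ((b ℤ.+ z) ℤ.- (x ℤ.+ z))
        ring = ℤSolver.solve-∀
      same-diff : diff (a , b) ≡ diff (a′ , b′)
      same-diff = trans (alternating a b x y z)
        (trans (cong₂ ℤ._-_ (cong₂ (λ p q → ℤ.+ p ℤ.- ℤ.+ q) p₁ p₂) (cong₂ (λ p q → ℤ.+ p ℤ.- ℤ.+ q) p₃ p₄))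
          (sym (alternating a′ b′ x′ y′ z′)))
    ... | refl with +-cancelˡ-≡ a y y′ p₁ | +-cancelˡ-≡ b z z′ p₃
    ... | refl | refl with +-cancelʳ-≡ y x x′ p₂
    ... | refl = refl
    count : ∑ Ω (λ ω → ind (Q? ω)) ≡ ∑ E (λ { (a , b) → ∑ A′ (λ x → paths a x * paths b x) })
    count = trans (∑-× E _ _) (∑-cong E λ { (a , b) _ → trans (∑-× A′ _ _) (∑-cong A′ λ x _ →
      trans (∑-× A A _) (trans (∑-cong A λ y _ → trans (∑-cong A λ z _ →
          trans (ind-× (edge? a y ×-dec edge? x y) (edge? b z ×-dec edge? x z))
                (cong₂ _*_ (ind-× (edge? a y) (edge? x y)) (ind-× (edge? b z) (edge? x z))))
        (∑-*ˡ A (ind (edge? a y) * ind (edge? x y)) _))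
        (∑-*ʳ A (paths b x) _))) })

module PopularDifferences (A : List ℕ) (D : List ℤ) (uD : Unique D)
  (cover : ∀ a b → a ∈ A → b ∈ A → diff (a , b) ∈ D) (1≤N : 1 ≤ length A) where

  private
    N = length A
    AA = cartesianProduct A A

  representations : ℤ → ℕ
  representations z = ∑ AA (λ p → ind (diff p ℤP.≟ z))

  -- The threshold is half the average N² / |D|, so that the unpopular differences together account
  -- for at most half of all pairs.
  popular? : ∀ z → Dec (N * N ≤ representations z * (2 * length D))
  popular? z = _ ≤? _

  1≤D : 1 ≤ length D
  1≤D = let a , a∈ = nonempty⇒∈ A 1≤N in ∈⇒nonempty (cover a a a∈ a∈)

  diff∈D : ∀ p → p ∈ AA → diff p ∈ D
  diff∈D (a , b) p∈ = let a∈ , b∈ = ∈-cartesianProduct⁻ A A p∈ in cover a b a∈ b∈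

  unpopular-pairs : 2 * ∑ AA (λ p → ind (¬? (popular? (diff p)))) ≤ N * N
  unpopular-pairs = *-cancelˡ-≤ {2 * ∑ AA u} {N * N} (length D) {{>-nonZero 1≤D}} (begin
    length D * (2 * ∑ AA u) ≡⟨ rearrange (length D) (∑ AA u) ⟩
    ∑ AA u * (2 * length D) ≤⟨ *-monoˡ-≤ (2 * length D) by-value ⟩
    ∑ D (λ z → ind (¬? (popular? z)) * representations z) * (2 * length D) ≡⟨ sym (∑-*ʳ D (2 * length D) _) ⟩
    ∑ D (λ z → ind (¬? (popular? z)) * representations z * (2 * length D)) ≤⟨ ∑-mono D (λ z _ → small z) ⟩
    ∑ D (λ z → N * N) ≡⟨ ∑-const D (N * N) ⟩
    length D * (N * N) ∎)
    where
    open ≤-Reasoning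
    u : ℕ × ℕ → ℕ
    u p = ind (¬? (popular? (diff p)))
    rearrange : ∀ d s → d * (2 * s) ≡ s * (2 * d)
    rearrange = solve-∀
    small : ∀ z → ind (¬? (popular? z)) * representations z * (2 * length D) ≤ N * N
    small z with popular? z
    ... | yes _ = z≤n
    ... | no p = ≤-trans (≤-reflexive (cong (_* (2 * length D)) (*-identityˡ (representations z)))) (<⇒≤ (≰⇒> p))
    by-value : ∑ AA u ≤ ∑ D (λ z → ind (¬? (popular? z)) * representations z)
    by-value = begin
      ∑ AA u ≤⟨ ∑-mono AA (λ p p∈ → ≤-trans (≤-reflexive (sym (trans (cong (u p *_) (ind-yes (diff p ℤP.≟ diff p) refl)) (*-identityʳ (u p)))))
                  (∑-member (λ z → ind (¬? (popular? z)) * ind (diff p ℤP.≟ z)) (diff∈D p p∈))) ⟩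
      ∑ AA (λ p → ∑ D (λ z → ind (¬? (popular? z)) * ind (diff p ℤP.≟ z))) ≡⟨ ∑-swap AA D _ ⟩
      ∑ D (λ z → ∑ AA (λ p → ind (¬? (popular? z)) * ind (diff p ℤP.≟ z))) ≡⟨ ∑-cong D (λ z _ → ∑-*ˡ AA (ind (¬? (popular? z))) _) ⟩
      ∑ D (λ z → ind (¬? (popular? z)) * representations z) ∎

  translate : ℕ → List ℕ
  translate t = filter (λ a → popular? (diff (a , t))) A

  -- At least half of the pairs `(a , t)` have a popular difference, so some `t` has one with at
  -- least half of the `a`.
  large-translate : Σ ℕ λ t → t ∈ A × N ≤ 2 * length (translate t)
  large-translate =
    let t , t∈ , h = pigeonhole A (λ _ → N) (λ t → 2 * ∑ A (λ a → ind (popular? (diff (a , t))))) 1≤N average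
    in t , t∈ , ≤-trans h (≤-reflexive (cong (2 *_) (sym (length-filter-∑ (λ a → popular? (diff (a , t))) A))))
    where
    open ≤-Reasoning
    Good Bad : ℕ
    Good = ∑ AA (λ p → ind (popular? (diff p)))
    Bad = ∑ AA (λ p → ind (¬? (popular? (diff p))))
    total : Good + Bad ≡ N * N
    total = trans (sym (∑-+ AA _ _)) (trans (∑-cong AA (λ p _ → ind-¬ (popular? (diff p))))
      (trans (∑-const AA 1) (trans (*-identityʳ (length AA)) (length-× A A))))
    double : ∀ g b → 2 * (g + b) ≡ 2 * g + 2 * b
    double = solve-∀
    average : ∑ A (λ _ → N) ≤ ∑ A (λ t → 2 * ∑ A (λ a → ind (popular? (diff (a , t)))))
    average = begin
      ∑ A (λ _ → N) ≡⟨ ∑-const A N ⟩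
      N * N ≤⟨ +-cancelʳ-≤ (N * N) (N * N) (2 * Good) (begin
        N * N + N * N ≡⟨ cong₂ _+_ (sym (+-identityʳ (N * N))) refl ⟩
        N * N + 0 + N * N ≡⟨ +-comm (N * N + 0) (N * N) ⟩
        2 * (N * N) ≡⟨ cong (2 *_) (sym total) ⟩
        2 * (Good + Bad) ≡⟨ double Good Bad ⟩
        2 * Good + 2 * Bad ≤⟨ +-monoʳ-≤ (2 * Good) unpopular-pairs ⟩
        2 * Good + N * N ∎) ⟩
      2 * Good ≡⟨ cong (2 *_) (trans (∑-× A A _) (∑-swap A A _)) ⟩
      2 * ∑ A (λ t → ∑ A (λ a → ind (popular? (diff (a , t))))) ≡⟨ sym (∑-*ˡ A 2 _) ⟩
      ∑ A (λ t → 2 * ∑ A (λ a → ind (popular? (diff (a , t))))) ∎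

  defect : ℕ × ℕ × ℕ → ℤ
  defect (a , b , c) = ℤ.+ a ℤ.+ ℤ.+ c ℤ.- ℤ.+ 2 ℤ.* ℤ.+ b

  -- If a - t = x₁ - y₁ and b - t = x₂ - y₂ then a + c - 2b = (x₁ - x₂) + (y₂ - b) + (c - y₁).
  few-defects : Unique A → ∀ t (V : List (ℕ × ℕ × ℕ)) → Unique (map defect V) →
    (∀ a b c → (a , b , c) ∈ V → a ∈ translate t × b ∈ translate t × c ∈ translate t) →
    length V * ((N * N) * (N * N)) ≤ (2 * length D) * (2 * length D) * (length D * (length D * length D))
  few-defects uA t V uV V⊆ = begin
    length V * ((N * N) * (N * N)) ≡⟨ sym (∑-const V _) ⟩
    ∑ V (λ _ → (N * N) * (N * N)) ≤⟨ ∑-mono V (λ { (a , b , c) v∈ → many a b c v∈ }) ⟩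
    ∑ V (λ v → K * pairs v) ≡⟨ ∑-*ˡ V K pairs ⟩
    K * ∑ V pairs ≡⟨ cong (K *_) (sym count) ⟩
    K * ∑ Ω (λ ω → ind (Q? ω)) ≤⟨ *-monoʳ-≤ K (injection-count Q? Ω DDD φ uΩ into injective) ⟩
    K * length DDD ≡⟨ cong (K *_) (trans (length-× D _) (cong (length D *_) (length-× D D))) ⟩
    K * (length D * (length D * length D)) ∎
    where
    open ≤-Reasoning
    K = (2 * length D) * (2 * length D)
    pairs : ℕ × ℕ × ℕ → ℕ
    pairs (a , b , c) = representations (diff (a , t)) * representations (diff (b , t))
    many : ∀ a b c → (a , b , c) ∈ V → (N * N) * (N * N) ≤ K * pairs (a , b , c)
    many a b c v∈ = let a∈ , b∈ , _ = V⊆ a b c v∈ in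
      ≤-trans (*-mono-≤ (proj₂ (∈-filter⁻ (λ a → popular? (diff (a , t))) {xs = A} a∈))
                        (proj₂ (∈-filter⁻ (λ a → popular? (diff (a , t))) {xs = A} b∈)))
        (≤-reflexive (rearrange (representations (diff (a , t))) (representations (diff (b , t))) (2 * length D)))
      where
      rearrange : ∀ r s d → (r * d) * (s * d) ≡ (d * d) * (r * s)
      rearrange = solve-∀
    Point = (ℕ × ℕ × ℕ) × (ℕ × ℕ) × (ℕ × ℕ)
    Ω : List Point
    Ω = cartesianProduct V (cartesianProduct AA AA)
    DDD = cartesianProduct D (cartesianProduct D D)
    uΩ : Unique Ω
    uΩ = UP.cartesianProduct⁺ (UP.map⁻ uV) (UP.cartesianProduct⁺ (UP.cartesianProduct⁺ uA uA) (UP.cartesianProduct⁺ uA uA))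
    Q : Point → Set
    Q ((a , b , c) , p , q) = diff p ≡ diff (a , t) × diff q ≡ diff (b , t)
    Q? : ∀ ω → Dec (Q ω)
    Q? ((a , b , c) , p , q) = (diff p ℤP.≟ diff (a , t)) ×-dec (diff q ℤP.≟ diff (b , t))
    φ : Point → ℤ × ℤ × ℤ
    φ ((a , b , c) , (x₁ , y₁) , (x₂ , y₂)) = diff (x₁ , x₂) , diff (y₂ , b) , diff (c , y₁)
    translate⊆ : ∀ {a} → a ∈ translate t → a ∈ A
    translate⊆ a∈ = proj₁ (∈-filter⁻ (λ a → popular? (diff (a , t))) {xs = A} a∈)
    into : ∀ ω → ω ∈ Ω → Q ω → φ ω ∈ DDD
    into ((a , b , c) , (x₁ , y₁) , (x₂ , y₂)) ω∈ _ =
      let v∈ , pq∈ = ∈-cartesianProduct⁻ V (cartesianProduct AA AA) ω∈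
          p∈ , q∈ = ∈-cartesianProduct⁻ AA AA pq∈
          x₁∈ , y₁∈ = ∈-cartesianProduct⁻ A A p∈
          x₂∈ , y₂∈ = ∈-cartesianProduct⁻ A A q∈
          _ , b∈ , c∈ = V⊆ a b c v∈
      in ∈-cartesianProduct⁺ (cover _ _ x₁∈ x₂∈)
          (∈-cartesianProduct⁺ (cover _ _ y₂∈ (translate⊆ b∈)) (cover _ _ (translate⊆ c∈) y₁∈))
    injective : ∀ ω ω′ → ω ∈ Ω → ω′ ∈ Ω → Q ω → Q ω′ → φ ω ≡ φ ω′ → ω ≡ ω′
    injective ((a , b , c) , (x₁ , y₁) , (x₂ , y₂)) ((a′ , b′ , c′) , (x₁′ , y₁′) , (x₂′ , y₂′))
      ω∈ ω′∈ (p , q) (p′ , q′) eq with ,-injective eq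
    ... | e₁ , eq′ with ,-injective eq′
    ... | e₂ , e₃ with unique-map-injective defect V uV (a , b , c) (a′ , b′ , c′)
        (proj₁ (∈-cartesianProduct⁻ V _ ω∈)) (proj₁ (∈-cartesianProduct⁻ V _ ω′∈)) same-defect
      where
      ring : ∀ a b c t x₁ y₁ x₂ y₂ → a ℤ.+ c ℤ.- ℤ.+ 2 ℤ.* b ≡
        ((x₁ ℤ.- x₂) ℤ.+ (y₂ ℤ.- b) ℤ.+ (c ℤ.- y₁)) ℤ.+ ((a ℤ.- t) ℤ.- (x₁ ℤ.- y₁)) ℤ.- ((b ℤ.- t) ℤ.- (x₂ ℤ.- y₂))
      ring = ℤSolver.solve-∀
      cancel : ∀ s p q → s ℤ.+ (p ℤ.- p) ℤ.- (q ℤ.- q) ≡ s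
      cancel = ℤSolver.solve-∀
      decompose : ∀ a b c x₁ y₁ x₂ y₂ → diff (x₁ , y₁) ≡ diff (a , t) → diff (x₂ , y₂) ≡ diff (b , t) →
        defect (a , b , c) ≡ diff (x₁ , x₂) ℤ.+ diff (y₂ , b) ℤ.+ diff (c , y₁)
      decompose a b c x₁ y₁ x₂ y₂ p q =
        trans (ring (ℤ.+ a) (ℤ.+ b) (ℤ.+ c) (ℤ.+ t) (ℤ.+ x₁) (ℤ.+ y₁) (ℤ.+ x₂) (ℤ.+ y₂))
        (trans (cong₂ (λ u v → (diff (x₁ , x₂) ℤ.+ diff (y₂ , b) ℤ.+ diff (c , y₁)) ℤ.+ (diff (a , t) ℤ.- u) ℤ.- (diff (b , t) ℤ.- v)) p q)
          (cancel (diff (x₁ , x₂) ℤ.+ diff (y₂ , b) ℤ.+ diff (c , y₁)) (diff (a , t)) (diff (b , t))))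
      same-defect : defect (a , b , c) ≡ defect (a′ , b′ , c′)
      same-defect = trans (decompose a b c x₁ y₁ x₂ y₂ p q)
        (trans (cong₂ ℤ._+_ (cong₂ ℤ._+_ e₁ e₂) e₃) (sym (decompose a′ b′ c′ x₁′ y₁′ x₂′ y₂′ p′ q′)))
    ... | refl with diff-cancelʳ {y₂} {y₂′} {b} e₂ | diff-cancelˡ {c} {y₁} {y₁′} e₃
    ... | refl | refl with diff-cancelʳ {x₁} {x₁′} {y₁} (trans p (sym p′)) | diff-cancelʳ {x₂} {x₂′} {y₂} (trans q (sym q′))
    ... | refl | refl = refl
    count : ∑ Ω (λ ω → ind (Q? ω)) ≡ ∑ V pairs
    count = trans (∑-× V _ _) (∑-cong V λ { (a , b , c) _ → trans (∑-× AA AA _)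
      (trans (∑-cong AA λ p _ → trans (∑-cong AA λ q _ → ind-× (diff p ℤP.≟ diff (a , t)) (diff q ℤP.≟ diff (b , t)))
        (∑-*ˡ AA (ind (diff p ℤP.≟ diff (a , t))) _)) (∑-*ʳ AA (representations (diff (b , t))) _)) })

-- Ruzsa's model lemma

module Dilation (N P : ℕ) {{_ : NonZero N}} {{_ : NonZero P}} where

  -- With r the residue of `t * v`, the representatives of `t * v` modulo `P` in the open interval
  -- (-P, P) are r and r - P. A collision means that `N` divides one of them, so that a non-zero `v`
  -- may disappear after dilation and reduction modulo `N`.
  Collision : ℕ → ℕ → Set
  Collision t v = N ∣ (t * v) % P ⊎ N ∣ P ∸ (t * v) % P

  collision? : ∀ t v → Dec (Collision t v)
  collision? t v = (N ∣? (t * v) % P) ⊎-dec (N ∣? P ∸ (t * v) % P)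

  -- The number x - y represents `t * v` modulo `P`, is divisible by `N`, and lies strictly between
  -- -P and P; hence it is one of the two representatives named in `Collision`.
  collision : ∀ t X Y v x y p q i j → X ≡ Y + v → t * X ≡ x + p * P → t * Y ≡ y + q * P →
    x + i * N ≡ y + j * N → x < y + P → y < x + P → Collision t v
  collision t X Y v x y p q i j refl tX tY xy x<y+P y<x+P with ≤-total y x
  ... | inj₁ y≤x with m≤n⇒∃[o]m+o≡n y≤x
  ... | u , refl = inj₁ (subst (N ∣_) (sym tv%P) N∣u)
    where
    u<P : u < P
    u<P = +-cancelˡ-< y u P x<y+P
    N∣u : N ∣ u
    N∣u = ℕ∣.∣m+n∣m⇒∣n (divides j (+-cancelˡ-≡ y _ _ (trans (arith y u (i * N)) xy))) (divides i refl)
      where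
      arith : ∀ y u m → y + (m + u) ≡ y + u + m
      arith = solve-∀
    same : t * v + q * P ≡ u + p * P
    same = +-cancelˡ-≡ y _ _ (trans (trans (swap y (t * v) (q * P)) (trans (cong (_+ t * v) (sym tY))
      (sym (*-distribˡ-+ t Y v)))) (trans tX (+-assoc y u (p * P))))
      where
      swap : ∀ a b c → a + (b + c) ≡ a + c + b
      swap = solve-∀
    tv%P : (t * v) % P ≡ u
    tv%P = trans (sym ([m+kn]%n≡m%n (t * v) q P)) (trans (cong (_% P) same) (trans ([m+kn]%n≡m%n u p P) (m<n⇒m%n≡m u<P)))
  collision t X Y v x y p q i j refl tX tY xy x<y+P y<x+P | inj₂ x≤y with m≤n⇒∃[o]m+o≡n x≤y
  ... | u , refl = wrap P∣r+u
    where
    r = (t * v) % P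
    u<P : u < P
    u<P = +-cancelˡ-< x u P y<x+P
    N∣u : N ∣ u
    N∣u = ℕ∣.∣m+n∣m⇒∣n (divides i (+-cancelˡ-≡ x _ _ (trans (arith x u (j * N)) (sym xy)))) (divides j refl)
      where
      arith : ∀ y u m → y + (m + u) ≡ y + u + m
      arith = solve-∀
    same : t * v + u + q * P ≡ p * P
    same = +-cancelˡ-≡ x _ _ (trans (swap x u (t * v) (q * P)) (trans (cong (_+ t * v) (sym tY))
      (trans (sym (*-distribˡ-+ t Y v)) tX)))
      where
      swap : ∀ x u a b → x + (a + u + b) ≡ x + u + b + a
      swap = solve-∀
    P∣r+u : P ∣ r + u
    P∣r+u = ℕ∣.∣m+n∣m⇒∣n (divides p (trans (trans (regroup ((t * v) / P) q r u P)
      (cong (λ s → s + u + q * P) (sym (m≡m%n+[m/n]*n (t * v) P)))) same)) (divides ((t * v) / P + q) refl)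
      where
      regroup : ∀ a q r u P → (a + q) * P + (r + u) ≡ (r + a * P) + u + q * P
      regroup = solve-∀
    -- Both `r` and `u` are below `P`, so their sum is 0 or `P`.
    wrap : P ∣ r + u → Collision t v
    wrap (divides zero eq) = inj₁ (subst (N ∣_) (sym (m+n≡0⇒m≡0 r eq)) (N ℕ∣.∣0))
    wrap (divides (suc zero) eq) = inj₂ (subst (N ∣_) (sym complement) N∣u)
      where
      complement : P ∸ r ≡ u
      complement = trans (cong (_∸ r) (trans (sym (*-identityˡ P)) (sym eq))) (m+n∸m≡n r u)
    wrap (divides (suc (suc l)) eq) = contradiction eq (<⇒≢ (<-≤-trans (+-mono-< (m%n<n (t * v) P) u<P)
      (≤-trans (m≤m+n (P + P) (l * P)) (≤-reflexive (+-assoc P P (l * P))))))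

  dilate-injective : ∀ v → Cop.Coprime P v → ∀ t t′ → t < P → t′ < P → (t * v) % P ≡ (t′ * v) % P → t ≡ t′
  dilate-injective v cop t t′ t<P t′<P eq = [ (λ h → go t t′ h t′<P eq) , (λ h → sym (go t′ t h t<P (sym eq))) ]′ (≤-total t t′)
    where
    go : ∀ t t′ → t ≤ t′ → t′ < P → (t * v) % P ≡ (t′ * v) % P → t ≡ t′
    go t t′ t≤t′ t′<P eq with m≤n⇒∃[o]m+o≡n t≤t′
    ... | e , refl = sym (trans (cong (t +_) e≡0) (+-identityʳ t))
      where
      P∣ve : P ∣ v * e
      P∣ve = ℕ∣.∣m+n∣m⇒∣n (divides (((t + e) * v) / P) (+-cancelˡ-≡ ((t * v) % P) _ _
        (trans (trans (sym (+-assoc ((t * v) % P) _ _)) (cong (_+ v * e) (sym (m≡m%n+[m/n]*n (t * v) P))))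
        (trans (expand t e v) (trans (m≡m%n+[m/n]*n ((t + e) * v) P) (cong (_+ ((t + e) * v) / P * P) (sym eq)))))))
        (divides ((t * v) / P) refl)
        where
        expand : ∀ t e v → t * v + v * e ≡ (t + e) * v
        expand = solve-∀
      e≡0 : e ≡ 0
      e≡0 with e ≟ 0
      ... | yes z = z
      ... | no nz = contradiction (ℕ∣.∣⇒≤ {{≢-nonZero nz}} (Cop.coprime-divisor cop P∣ve))
        (<⇒≱ (≤-<-trans (m≤n+m e t) t′<P))

  module _ (L : ℕ) (P≡ : P ≡ suc (N * L)) where

    count-multiples : ∀ (f : ℕ → ℕ) → (∀ t → t < P → f t ≤ P) → (∀ t t′ → t < P → t′ < P → f t ≡ f t′ → t ≡ t′) →
      ∑ (upTo P) (λ t → ind (N ∣? f t)) ≤ 2 + L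
    count-multiples f f≤P inj = subst (∑ (upTo P) (λ t → ind (N ∣? f t)) ≤_) (length-upTo (2 + L))
      (injection-count (λ t → N ∣? f t) (upTo P) (upTo (2 + L)) (λ t → f t / N) (UP.upTo⁺ P)
        (λ t t∈ _ → ∈-upTo⁺ (m<n*o⇒m/o<n (bound t (∈-upTo⁻ t∈))))
        λ t t′ t∈ t′∈ d d′ eq → inj t t′ (∈-upTo⁻ t∈) (∈-upTo⁻ t′∈)
          (trans (sym (m/n*n≡m d)) (trans (cong (_* N) eq) (m/n*n≡m d′))))
      where
      open ≤-Reasoning
      bound : ∀ t → t < P → f t < (2 + L) * N
      bound t t<P = begin-strict
        f t ≤⟨ f≤P t t<P ⟩
        P ≡⟨ P≡ ⟩
        1 + N * L <⟨ +-mono-≤-< (>-nonZero⁻¹ N) (≤-refl {suc (N * L)}) ⟩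
        N + suc (N * L) ≤⟨ +-monoʳ-≤ N (+-mono-≤ (>-nonZero⁻¹ N) (≤-reflexive (*-comm N L))) ⟩
        (2 + L) * N ∎

    count-collisions : ∀ v → Cop.Coprime P v → ∑ (upTo P) (λ t → ind (collision? t v)) ≤ 2 * (2 + L)
    count-collisions v cop = begin
      ∑ (upTo P) (λ t → ind (collision? t v)) ≤⟨ ∑-mono (upTo P) (λ t _ → union (N ∣? (t * v) % P) (N ∣? P ∸ (t * v) % P)) ⟩
      ∑ (upTo P) (λ t → ind (N ∣? (t * v) % P) + ind (N ∣? P ∸ (t * v) % P)) ≡⟨ ∑-+ (upTo P) _ _ ⟩
      _ ≤⟨ +-mono-≤ (count-multiples (λ t → (t * v) % P) (λ t _ → <⇒≤ (m%n<n (t * v) P)) (dilate-injective v cop))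
             (count-multiples (λ t → P ∸ (t * v) % P) (λ t _ → m∸n≤m P ((t * v) % P))
               (λ t t′ t<P t′<P eq → dilate-injective v cop t t′ t<P t′<P
                 (∸-cancelˡ-≡ (<⇒≤ (m%n<n (t * v) P)) (<⇒≤ (m%n<n (t′ * v) P)) eq))) ⟩
      2 + L + (2 + L) ≡⟨ cong (2 + L +_) (sym (+-identityʳ (2 + L))) ⟩
      2 * (2 + L) ∎
      where
      open ≤-Reasoning
      union : ∀ {A B : Set} (a : Dec A) (b : Dec B) → ind (a ⊎-dec b) ≤ ind a + ind b
      union (yes _) b = s≤s z≤n
      union (no _) (yes _) = ≤-refl
      union (no _) (no _) = ≤-refl

    -- For random `t` the expected number of collisions is at most 2 (2 + L) |W| / P. Since 2 + L ≤
    -- 2 L and 8 |W| ≤ N, this is at most one half, so some `t` has none.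
    collision-free : ∀ (W : List ℕ) → (∀ v → v ∈ W → Cop.Coprime P v) → 8 * length W ≤ N → 2 ≤ L →
      Σ ℕ λ t → ∀ v → v ∈ W → ¬ Collision t v
    collision-free W cop 8W≤N 2≤L =
      let t , _ , h = pigeonhole (upTo P) (λ t → 2 * collisions t) (λ _ → 1)
            (≤-trans (>-nonZero⁻¹ P) (≤-reflexive (sym (length-upTo P)))) average
      in t , λ v v∈ c → <⇒≱ (s≤s (s≤s z≤n)) (begin
          2 ≡⟨ cong (2 *_) (sym (ind-yes (collision? t v) c)) ⟩
          2 * ind (collision? t v) ≤⟨ *-monoʳ-≤ 2 (∑-member (λ v → ind (collision? t v)) v∈) ⟩
          2 * collisions t ≤⟨ h ⟩
          1 ∎)
      where
      open ≤-Reasoning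
      collisions : ℕ → ℕ
      collisions t = ∑ W (λ v → ind (collision? t v))
      w = length W
      average : ∑ (upTo P) (λ t → 2 * collisions t) ≤ ∑ (upTo P) (λ _ → 1)
      average = begin
        ∑ (upTo P) (λ t → 2 * collisions t) ≡⟨ ∑-*ˡ (upTo P) 2 collisions ⟩
        2 * ∑ (upTo P) collisions ≡⟨ cong (2 *_) (∑-swap (upTo P) W _) ⟩
        2 * ∑ W (λ v → ∑ (upTo P) (λ t → ind (collision? t v))) ≤⟨ *-monoʳ-≤ 2 (∑-mono W (λ v v∈ → count-collisions v (cop v v∈))) ⟩
        2 * ∑ W (λ _ → 2 * (2 + L)) ≡⟨ cong (2 *_) (∑-const W (2 * (2 + L))) ⟩
        2 * (w * (2 * (2 + L))) ≡⟨ arith₁ w L ⟩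
        w * 4 * 2 + w * 4 * L ≤⟨ +-monoˡ-≤ (w * 4 * L) (*-monoʳ-≤ (w * 4) 2≤L) ⟩
        w * 4 * L + w * 4 * L ≡⟨ arith₂ w L ⟩
        8 * w * L ≤⟨ *-monoˡ-≤ L 8W≤N ⟩
        N * L ≤⟨ n≤1+n (N * L) ⟩
        suc (N * L) ≡⟨ sym P≡ ⟩
        P ≡⟨ sym (trans (∑-const (upTo P) 1) (trans (*-identityʳ (length (upTo P))) (length-upTo P))) ⟩
        ∑ (upTo P) (λ _ → 1) ∎
        where
        arith₁ : ∀ w L → 2 * (w * (2 * (2 + L))) ≡ w * 4 * 2 + w * 4 * L
        arith₁ = solve-∀
        arith₂ : ∀ w L → w * 4 * L + w * 4 * L ≡ 8 * w * L
        arith₂ = solve-∀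

∣! : ∀ {v n} → 1 ≤ v → v ≤ n → v ∣ n !
∣! {suc v} _ v≤n = ℕ∣.∣-trans (ℕ∣.m∣m*n (v !)) (ℕ∣.m≤n⇒m!∣n! v≤n)

-- The modulus is 1 modulo every positive number up to `bound`. It is also 1 modulo `N`, as the
-- count of multiples requires, and the factor 2 makes it odd, so that the residues split into two
-- halves.
coprime-modulus : ∀ N bound v → 1 ≤ v → v ≤ bound → Cop.Coprime (suc (N * (2 * bound !))) v
coprime-modulus N bound v 1≤v v≤bound {d} (d∣P , d∣v) =
  ℕ∣.∣1⇒≡1 (ℕ∣.∣m+n∣m⇒∣n (subst (d ∣_) (+-comm 1 _) d∣P)
    (ℕ∣.∣-trans d∣v (ℕ∣.∣-trans (∣! 1≤v v≤bound) (ℕ∣.∣-trans (ℕ∣.n∣m*n 2) (ℕ∣.n∣m*n N)))))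

pigeonhole-class : ∀ (xs : List X) (cs : List Y) (_≟Y_ : DecidableEquality Y) (f : X → Y) → 1 ≤ length cs →
  (∀ x → x ∈ xs → f x ∈ cs) → Σ Y λ c → length xs ≤ length cs * length (filter (λ x → f x ≟Y c) xs)
pigeonhole-class xs cs _≟Y_ f 1≤cs f∈ =
  let c , _ , h = pigeonhole cs (λ _ → length xs) (λ c → length cs * size c) 1≤cs average in c , h
  where
  open ≤-Reasoning
  size : _ → ℕ
  size c = length (filter (λ x → f x ≟Y c) xs)
  average : ∑ cs (λ _ → length xs) ≤ ∑ cs (λ c → length cs * size c)
  average = begin
    ∑ cs (λ _ → length xs) ≡⟨ ∑-const cs (length xs) ⟩
    length cs * length xs ≡⟨ cong (length cs *_) (sym (trans (∑-const xs 1) (*-identityʳ _))) ⟩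
    length cs * ∑ xs (λ _ → 1) ≤⟨ *-monoʳ-≤ (length cs) (∑-mono xs (λ x x∈ →
      ≤-trans (≤-reflexive (sym (ind-yes (f x ≟Y f x) refl))) (∑-member (λ c → ind (f x ≟Y c)) (f∈ x x∈)))) ⟩
    length cs * ∑ xs (λ x → ∑ cs (λ c → ind (f x ≟Y c))) ≡⟨ cong (length cs *_) (∑-swap xs cs _) ⟩
    length cs * ∑ cs (λ c → ∑ xs (λ x → ind (f x ≟Y c)))
      ≡⟨ cong (length cs *_) (∑-cong cs (λ c _ → sym (length-filter-∑ (λ x → f x ≟Y c) xs))) ⟩
    length cs * ∑ cs size ≡⟨ sym (∑-*ˡ cs (length cs) size) ⟩
    ∑ cs (λ c → length cs * size c) ∎

-- Compressing a set into an interval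

module Compression (A : List ℕ) (n h N P H t : ℕ) {{_ : NonZero n}} {{_ : NonZero N}} {{_ : NonZero P}}
  (1≤h : 1 ≤ h) (N≡ : N ≡ n * h) (P≡ : P ≡ suc (H + H))
  (avoids : ∀ a b c v → a ∈ A → b ∈ A → c ∈ A → a + c ≡ 2 * b + v ⊎ 2 * b ≡ a + c + v →
    1 ≤ v → ¬ Dilation.Collision N P t v) where

  open Dilation N P

  y z : ℕ → ℕ
  y x = (t * x) % P
  z x = y x % N

  -- Residues on the same side differ by at most `H`, and 2 H < P. Thus `y a + y c` and `2 * y b`
  -- differ by less than `P`, the range in which `collision` applies.
  side : ℕ → ℕ
  side x = ind (H <? y x)

  class : ℕ → ℕ × ℕ
  class x = side x , z x / n

  classes : List (ℕ × ℕ)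
  classes = cartesianProduct (upTo 2) (upTo h)

  _≟²_ : DecidableEquality (ℕ × ℕ)
  _≟²_ = ≡-dec _≟_ _≟_

  class∈ : ∀ x → class x ∈ classes
  class∈ x = ∈-cartesianProduct⁺ (∈-upTo⁺ (s≤s (ind-≤1 (H <? y x))))
    (∈-upTo⁺ {h} (m<n*o⇒m/o<n {z x} {h} {n} (<-≤-trans (m%n<n (y x) N) (≤-reflexive (trans N≡ (*-comm n h))))))

  length-classes : length classes ≡ 2 * h
  length-classes = trans (length-× (upTo 2) (upTo h)) (cong (2 *_) (length-upTo h))

  chosen : Σ (ℕ × ℕ) λ c → length A ≤ length classes * length (filter (λ x → class x ≟² c) A)
  chosen = pigeonhole-class A classes _≟²_ class
    (≤-trans (*-mono-≤ (s≤s (z≤n {1})) 1≤h) (≤-reflexive (sym length-classes))) (λ x _ → class∈ x)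

  c₀ : ℕ × ℕ
  c₀ = proj₁ chosen

  A₀ : List ℕ
  A₀ = filter (λ x → class x ≟² c₀) A

  β : ℕ → ℕ
  β x = suc (z x % n)

  z-split : ∀ x → z x ≡ z x % n + (z x / n) * n
  z-split x = m≡m%n+[m/n]*n (z x) n

  same-side : ∀ a b → side a ≡ side b → y a ≤ y b + H
  same-side a b eq with H <? y a | H <? y b
  ... | yes _ | yes b>H = ≤-trans (≤-pred (≤-trans (m%n<n (t * a) P) (≤-reflexive P≡)))
    (+-monoˡ-≤ H (<⇒≤ b>H))
  ... | no a≤H | no _ = ≤-trans (≮⇒≥ a≤H) (m≤n+m H (y b))

  -- Within one window a relation between remainders modulo `n` is a relation between the `z`, hence
  -- a congruence modulo `N` between the `y`. If a + c and 2 b differed, their distance `v` would be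
  -- a forbidden collision.
  midpoints-lift : PreservesMidpoints A₀ β id
  midpoints-lift a b c a∈ b∈ c∈ eq = cases (≤-total (2 * b) (a + c))
    where
    a∈A = proj₁ (∈-filter⁻ (λ x → class x ≟² c₀) {xs = A} a∈)
    b∈A = proj₁ (∈-filter⁻ (λ x → class x ≟² c₀) {xs = A} b∈)
    c∈A = proj₁ (∈-filter⁻ (λ x → class x ≟² c₀) {xs = A} c∈)
    a≡ = proj₂ (∈-filter⁻ (λ x → class x ≟² c₀) {xs = A} a∈)
    b≡ = proj₂ (∈-filter⁻ (λ x → class x ≟² c₀) {xs = A} b∈)
    c≡ = proj₂ (∈-filter⁻ (λ x → class x ≟² c₀) {xs = A} c∈)
    residues : z a % n + z c % n ≡ 2 * (z b % n)
    residues = suc-injective (suc-injective (trans (cong suc (sym (+-suc _ _))) (trans eq (shift (z b % n)))))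
      where
      shift : ∀ r → 2 * suc r ≡ suc (suc (2 * r))
      shift = solve-∀
    zs : z a + z c ≡ 2 * z b
    zs = trans (cong₂ _+_ (z-split a) (z-split c))
      (trans (cong₂ (λ q q′ → z a % n + q * n + (z c % n + q′ * n)) (cong proj₂ (trans a≡ (sym b≡))) (cong proj₂ (trans c≡ (sym b≡))))
      (trans (collect (z a % n) (z c % n) (z b / n) n) (trans (cong (_+ 2 * ((z b / n) * n)) residues)
      (trans (sym (*-distribˡ-+ 2 (z b % n) _)) (cong (2 *_) (sym (z-split b)))))))
      where
      collect : ∀ r r′ q n → r + q * n + (r′ + q * n) ≡ r + r′ + 2 * (q * n)
      collect = solve-∀
    ys : y a + y c + (2 * (y b / N)) * N ≡ 2 * y b + (y a / N + y c / N) * N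
    ys = trans (cong (_+ (2 * (y b / N)) * N) (cong₂ _+_ (m≡m%n+[m/n]*n (y a) N) (m≡m%n+[m/n]*n (y c) N)))
      (trans (arith (z a) (z c) (y a / N) (y c / N) (y b / N) N)
      (trans (cong (λ s → s + 2 * ((y b / N) * N) + (y a / N + y c / N) * N) zs)
      (cong (_+ (y a / N + y c / N) * N) (trans (sym (*-distribˡ-+ 2 (z b) _)) (cong (2 *_) (sym (m≡m%n+[m/n]*n (y b) N)))))))
      where
      arith : ∀ za zc p q r N → za + p * N + (zc + q * N) + (2 * r) * N ≡ za + zc + 2 * (r * N) + (p + q) * N
      arith = solve-∀
    t[a+c] : t * (a + c) ≡ y a + y c + ((t * a) / P + (t * c) / P) * P
    t[a+c] = trans (*-distribˡ-+ t a c) (trans (cong₂ _+_ (m≡m%n+[m/n]*n (t * a) P) (m≡m%n+[m/n]*n (t * c) P))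
      (arith (y a) (y c) ((t * a) / P) ((t * c) / P) P))
      where
      arith : ∀ a c p q P → a + p * P + (c + q * P) ≡ a + c + (p + q) * P
      arith = solve-∀
    t[2b] : t * (2 * b) ≡ 2 * y b + (2 * ((t * b) / P)) * P
    t[2b] = trans (comm t b) (trans (cong (2 *_) (m≡m%n+[m/n]*n (t * b) P)) (arith (y b) ((t * b) / P) P))
      where
      comm : ∀ t b → t * (2 * b) ≡ 2 * (t * b)
      comm = solve-∀
      arith : ∀ b p P → 2 * (b + p * P) ≡ 2 * b + (2 * p) * P
      arith = solve-∀
    side≡ : ∀ {x x′} → class x ≡ c₀ → class x′ ≡ c₀ → side x ≡ side x′
    side≡ p q = cong proj₁ (trans p (sym q))
    ac<b+P : y a + y c < 2 * y b + P
    ac<b+P = ≤-<-trans (+-mono-≤ (same-side a b (side≡ a≡ b≡)) (same-side c b (side≡ c≡ b≡)))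
      (≤-trans (s≤s (≤-reflexive (arith (y b) H))) (≤-reflexive (trans (sym (+-suc (2 * y b) (H + H))) (cong (2 * y b +_) (sym P≡)))))
      where
      arith : ∀ b H → b + H + (b + H) ≡ 2 * b + (H + H)
      arith = solve-∀
    b<ac+P : 2 * y b < y a + y c + P
    b<ac+P = ≤-<-trans (≤-trans (≤-reflexive (double (y b))) (+-mono-≤ (same-side b a (side≡ b≡ a≡)) (same-side b c (side≡ b≡ c≡))))
      (≤-trans (s≤s (≤-reflexive (arith (y a) (y c) H))) (≤-reflexive (trans (sym (+-suc (y a + y c) (H + H))) (cong (y a + y c +_) (sym P≡)))))
      where
      double : ∀ b → 2 * b ≡ b + b
      double = solve-∀
      arith : ∀ a c H → a + H + (c + H) ≡ a + c + (H + H)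
      arith = solve-∀
    cases : 2 * b ≤ a + c ⊎ a + c ≤ 2 * b → a + c ≡ 2 * b
    cases (inj₁ le) with m≤n⇒∃[o]m+o≡n le
    ... | zero , e = trans (sym e) (+-identityʳ _)
    ... | v@(suc _) , e = contradiction
      (collision t (a + c) (2 * b) v (y a + y c) (2 * y b)
        ((t * a) / P + (t * c) / P) (2 * ((t * b) / P)) (2 * (y b / N)) (y a / N + y c / N) (sym e) t[a+c] t[2b] ys ac<b+P b<ac+P)
      (avoids a b c v a∈A b∈A c∈A (inj₁ (sym e)) (s≤s z≤n))
    cases (inj₂ le) with m≤n⇒∃[o]m+o≡n le
    ... | zero , e = trans (sym (+-identityʳ _)) e
    ... | v@(suc _) , e = contradiction
      (collision t (2 * b) (a + c) v (2 * y b) (y a + y c)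
        (2 * ((t * b) / P)) ((t * a) / P + (t * c) / P) (y a / N + y c / N) (2 * (y b / N)) (sym e) t[2b] t[a+c] (sym ys) b<ac+P ac<b+P)
      (avoids a b c v a∈A b∈A c∈A (inj₂ (sym e)) (s≤s z≤n))

  compressed : ∀ k → 2 ≤ k → Unique A → KAPFree k A →
    Σ (List ℕ) λ B → Unique B × All (λ b → 1 ≤ b × b ≤ n) B × KAPFree k B × length A ≤ 2 * h * length B
  compressed k 2≤k uA free = map β A₀ ,
    unique-map A₀ β (UP.filter⁺ (λ x → class x ≟² c₀) uA) (λ a b a∈ b∈ → preserves-≡ β id midpoints-lift a b a∈ b∈) ,
    AllP.map⁺ (All.tabulate {xs = A₀} λ {x} _ → s≤s z≤n , m%n<n (z x) n) ,
    KAPFree-transfer {L = A₀} {β} {id} 2≤k midpoints-lift (λ a b _ _ eq → cong β eq)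
      (KAPFree-⊆ (λ x x∈ → proj₁ (∈-filter⁻ (λ x → class x ≟² c₀) {xs = A} (subst (x ∈_) (map-id A₀) x∈))) free) ,
    ≤-trans (proj₂ chosen) (≤-reflexive (cong₂ _*_ length-classes (sym (length-map β A₀))))

model : ∀ (A W : List ℕ) n h k → 1 ≤ n → 1 ≤ h → 8 * length W ≤ n * h →
  (∀ a b c v → a ∈ A → b ∈ A → c ∈ A → a + c ≡ 2 * b + v ⊎ 2 * b ≡ a + c + v → v ∈ W) →
  2 ≤ k → Unique A → KAPFree k A →
  Σ (List ℕ) λ B → Unique B × All (λ b → 1 ≤ b × b ≤ n) B × KAPFree k B × length A ≤ 2 * h * length B
model A W n h k 1≤n 1≤h 8W≤nh defects = core (n * h) (bound !) refl refl (1≤n! bound)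
  where
  bound : ℕ
  bound = 2 * maxL A
  relevant? : ∀ v → Dec (1 ≤ v × v ≤ bound)
  relevant? v = (1 ≤? v) ×-dec (v ≤? bound)
  in-range : ∀ a b c v → a ∈ A → b ∈ A → c ∈ A → a + c ≡ 2 * b + v ⊎ 2 * b ≡ a + c + v → v ≤ bound
  in-range a b c v a∈ b∈ c∈ (inj₁ e) = ≤-trans (m≤n+m v (2 * b)) (≤-trans (≤-reflexive (sym e))
    (≤-trans (+-mono-≤ (∈⇒≤maxL A a∈) (∈⇒≤maxL A c∈)) (≤-reflexive (cong (maxL A +_) (sym (+-identityʳ (maxL A)))))))
  in-range a b c v a∈ b∈ c∈ (inj₂ e) = ≤-trans (m≤n+m v (a + c)) (≤-trans (≤-reflexive (sym e)) (*-monoʳ-≤ 2 (∈⇒≤maxL A b∈)))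
  core : ∀ N F → N ≡ n * h → F ≡ bound ! → 1 ≤ F → 2 ≤ k → Unique A → KAPFree k A →
    Σ (List ℕ) λ B → Unique B × All (λ b → 1 ≤ b × b ≤ n) B × KAPFree k B × length A ≤ 2 * h * length B
  core N F N≡ F≡ 1≤F = compressed k
    where
    P H : ℕ
    P = suc (N * (2 * F))
    H = N * F
    instance
      n≢0 : NonZero n
      n≢0 = >-nonZero 1≤n
      N≢0 : NonZero N
      N≢0 = >-nonZero (≤-trans (*-mono-≤ 1≤n 1≤h) (≤-reflexive (sym N≡)))
    open Dilation N P
    -- Coprimality to `P` is guaranteed for 1 ≤ v ≤ bound. The value 0 is the relation to be kept,
    -- and no relevant distance exceeds `bound`.
    W⁺ : List ℕ
    W⁺ = filter relevant? W
    multiplier : Σ ℕ λ t → ∀ v → v ∈ W⁺ → ¬ Collision t v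
    multiplier = collision-free (2 * F) refl W⁺
      (λ v v∈ → let 1≤v , v≤ = proj₂ (∈-filter⁻ relevant? {xs = W} v∈)
                in subst (λ f → Cop.Coprime (suc (N * (2 * f))) v) (sym F≡) (coprime-modulus N bound v 1≤v v≤))
      (≤-trans (*-monoʳ-≤ 8 (length-filter relevant? W)) (≤-trans 8W≤nh (≤-reflexive (sym N≡))))
      (*-monoʳ-≤ 2 1≤F)
    P≡ : P ≡ suc (H + H)
    P≡ = cong suc (arith N F)
      where
      arith : ∀ N f → N * (2 * f) ≡ N * f + N * f
      arith = solve-∀
    open Compression A n h N P H (proj₁ multiplier) 1≤h N≡ P≡ (λ a b c v a∈ b∈ c∈ e 1≤v →
      proj₂ multiplier v (∈-filter⁺ relevant? (defects a b c v a∈ b∈ c∈ e) (1≤v , in-range a b c v a∈ b∈ c∈ e)))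

-- Upper bound

^-distribʳ-* : ∀ k a b → (a * b) ^ k ≡ a ^ k * b ^ k
^-distribʳ-* zero a b = refl
^-distribʳ-* (suc k) a b = trans (cong (a * b *_) (^-distribʳ-* k a b)) (arith a b (a ^ k) (b ^ k))
  where
  arith : ∀ a b p q → a * b * (p * q) ≡ a * p * (b * q)
  arith = solve-∀

-- Applied with τ = 2; a literal base would be unfolded by conversion checking.
upper-arithmetic : ∀ τ m n N N₁ N₂ E V r → 2 ≤ τ →
  m ≤ τ * n * N → N ≤ τ * N₁ → N₁ ≤ τ * N₂ →
  E * (m ^ 4 * N) ≤ τ ^ 11 * n ^ 10 → V * N₁ ^ 4 ≤ τ ^ 2 * E ^ 5 →
  n * N₂ ≤ τ * (τ ^ 3 * V + n) * r → τ * m ≤ n ^ 2 →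
  m ^ 108 * n ≤ r * n ^ 216
upper-arithmetic τ m n N N₁ N₂ E V r 2≤τ m≤ N≤ N₁≤ E≤ V≤ N₂≤ τm≤ = begin
  m ^ 108 * n ≤⟨ *-monoˡ-≤ n (*-cancelˡ-≤ (τ ^ 78) {{τ^≢0 78}} final) ⟩
  r * n ^ 215 * n ≡⟨ trans (*-assoc r (n ^ 215) n) (cong (r *_) (*-comm (n ^ 215) n)) ⟩
  r * n ^ 216 ∎
  where
  open ≤-Reasoning
  1≤τ : 1 ≤ τ
  1≤τ = ≤-trans (s≤s z≤n) 2≤τ
  τ^≢0 : ∀ k → NonZero (τ ^ k)
  τ^≢0 k = m^n≢0 τ k {{>-nonZero 1≤τ}}
  m≤n² : m ≤ n ^ 2
  m≤n² = ≤-trans (≤-trans (≤-reflexive (sym (*-identityˡ m))) (*-monoˡ-≤ m 1≤τ)) τm≤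
  m≤N₁ : m ≤ τ ^ 2 * n * N₁
  m≤N₁ = ≤-trans m≤ (≤-trans (*-monoʳ-≤ (τ * n) N≤) (≤-reflexive (arith τ n N₁)))
    where
    arith : ∀ τ n x → τ * n * (τ * x) ≡ τ * (τ * 1) * n * x
    arith = solve-∀
  m≤N₂ : m ≤ τ ^ 3 * (n * N₂)
  m≤N₂ = ≤-trans m≤N₁ (≤-trans (*-monoʳ-≤ (τ ^ 2 * n) N₁≤) (≤-reflexive (arith τ n N₂)))
    where
    arith : ∀ τ n x → τ * (τ * 1) * n * (τ * x) ≡ τ * (τ * (τ * 1)) * (n * x)
    arith = solve-∀
  -- For τ = 2 and δ = m / n² this says E ≤ 2^12 δ^-5 n.
  Em⁵ : E * m ^ 5 ≤ τ ^ 12 * n ^ 11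
  Em⁵ = begin
    E * (m * m ^ 4) ≤⟨ *-monoʳ-≤ E (*-monoˡ-≤ (m ^ 4) m≤) ⟩
    E * (τ * n * N * m ^ 4) ≡⟨ arith₁ E τ n N (m ^ 4) ⟩
    τ * n * (E * (m ^ 4 * N)) ≤⟨ *-monoʳ-≤ (τ * n) E≤ ⟩
    τ * n * (τ ^ 11 * n ^ 10) ≡⟨ arith₂ τ n (τ ^ 11) (n ^ 10) ⟩
    τ ^ 12 * n ^ 11 ∎
    where
    arith₁ : ∀ E τ n N p → E * (τ * n * N * p) ≡ τ * n * (E * (p * N))
    arith₁ = solve-∀
    arith₂ : ∀ τ n p q → τ * n * (p * q) ≡ τ * p * (n * q)
    arith₂ = solve-∀
  power : ∀ a b i j k → (a ^ i * b ^ j) ^ k ≡ a ^ (i * k) * b ^ (j * k)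
  power a b i j k = trans (^-distribʳ-* k (a ^ i) (b ^ j)) (cong₂ _*_ (^-*-assoc a i k) (^-*-assoc b j k))
  -- That is V ≤ 2^70 δ^-29 n. In 29 = 4 + 25 the 4 pays for `N₁ ^ 4` and the 25 for five factors
  -- `E`.
  Vm²⁹ : V * m ^ 29 ≤ τ ^ 70 * n ^ 59
  Vm²⁹ = begin
    V * m ^ 29 ≡⟨ cong (V *_) (trans (^-distribˡ-+-* m 4 25) (cong (m ^ 4 *_) (sym (^-*-assoc m 5 5)))) ⟩
    V * (m ^ 4 * (m ^ 5) ^ 5) ≤⟨ *-monoʳ-≤ V (*-monoˡ-≤ ((m ^ 5) ^ 5) (^-monoˡ-≤ 4 m≤N₁)) ⟩
    V * ((τ ^ 2 * n * N₁) ^ 4 * (m ^ 5) ^ 5) ≡⟨ cong (λ z → V * (z * (m ^ 5) ^ 5)) (^-distribʳ-* 4 (τ ^ 2 * n) N₁) ⟩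
    V * ((τ ^ 2 * n) ^ 4 * N₁ ^ 4 * (m ^ 5) ^ 5) ≡⟨ arith₁ V ((τ ^ 2 * n) ^ 4) (N₁ ^ 4) ((m ^ 5) ^ 5) ⟩
    (τ ^ 2 * n) ^ 4 * (V * N₁ ^ 4) * (m ^ 5) ^ 5 ≤⟨ *-monoˡ-≤ ((m ^ 5) ^ 5) (*-monoʳ-≤ ((τ ^ 2 * n) ^ 4) V≤) ⟩
    (τ ^ 2 * n) ^ 4 * (τ ^ 2 * E ^ 5) * (m ^ 5) ^ 5 ≡⟨ arith₂ ((τ ^ 2 * n) ^ 4) (τ ^ 2) (E ^ 5) ((m ^ 5) ^ 5) ⟩
    (τ ^ 2 * n) ^ 4 * τ ^ 2 * (E ^ 5 * (m ^ 5) ^ 5) ≡⟨ cong ((τ ^ 2 * n) ^ 4 * τ ^ 2 *_) (sym (^-distribʳ-* 5 E (m ^ 5))) ⟩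
    (τ ^ 2 * n) ^ 4 * τ ^ 2 * (E * m ^ 5) ^ 5 ≤⟨ *-monoʳ-≤ ((τ ^ 2 * n) ^ 4 * τ ^ 2) (^-monoˡ-≤ 5 Em⁵) ⟩
    (τ ^ 2 * n) ^ 4 * τ ^ 2 * (τ ^ 12 * n ^ 11) ^ 5
      ≡⟨ cong₂ (λ p q → p * τ ^ 2 * q) (trans (cong (λ z → (τ ^ 2 * z) ^ 4) (sym (*-identityʳ n))) (power τ n 2 1 4)) (power τ n 12 11 5) ⟩
    τ ^ 8 * n ^ 4 * τ ^ 2 * (τ ^ 60 * n ^ 55) ≡⟨ arith₃ (τ ^ 8) (n ^ 4) (τ ^ 2) (τ ^ 60) (n ^ 55) ⟩
    τ ^ 8 * (τ ^ 2 * τ ^ 60) * (n ^ 4 * n ^ 55)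
      ≡⟨ cong₂ _*_ (trans (cong (τ ^ 8 *_) (sym (^-distribˡ-+-* τ 2 60))) (sym (^-distribˡ-+-* τ 8 62))) (sym (^-distribˡ-+-* n 4 55)) ⟩
    τ ^ 70 * n ^ 59 ∎
    where
    arith₁ : ∀ V a b c → V * (a * b * c) ≡ a * (V * b) * c
    arith₁ = solve-∀
    arith₂ : ∀ a b c d → a * (b * c) * d ≡ a * b * (c * d)
    arith₂ = solve-∀
    arith₃ : ∀ a b c d e → a * b * c * (d * e) ≡ a * (c * d) * (b * e)
    arith₃ = solve-∀
  nm²⁹ : n * m ^ 29 ≤ n ^ 59
  nm²⁹ = *-monoʳ-≤ n (≤-trans (^-monoˡ-≤ 29 m≤n²) (≤-reflexive (^-*-assoc n 2 29)))
  absorb : ∀ x → τ ^ 73 * x + x ≤ τ * (τ ^ 73 * x)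
  absorb x = ≤-trans (+-monoʳ-≤ (τ ^ 73 * x) (≤-trans (≤-reflexive (sym (*-identityˡ x))) (*-monoˡ-≤ x (>-nonZero⁻¹ (τ ^ 73) {{τ^≢0 73}}))))
    (≤-trans (≤-reflexive (double (τ ^ 73 * x))) (*-monoˡ-≤ (τ ^ 73 * x) 2≤τ))
    where
    double : ∀ x → x + x ≡ 2 * x
    double = solve-∀
  -- That is δ^30 n ≤ 2^78 r: one more δ comes from the size of the last subset.
  m³⁰ : m ^ 30 ≤ τ ^ 78 * (r * n ^ 59)
  m³⁰ = begin
    m * m ^ 29 ≤⟨ *-monoˡ-≤ (m ^ 29) m≤N₂ ⟩
    τ ^ 3 * (n * N₂) * m ^ 29 ≤⟨ *-monoˡ-≤ (m ^ 29) (*-monoʳ-≤ (τ ^ 3) N₂≤) ⟩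
    τ ^ 3 * (τ * (τ ^ 3 * V + n) * r) * m ^ 29 ≡⟨ arith₁ (τ ^ 3) τ V n r (m ^ 29) ⟩
    τ ^ 3 * τ * r * (τ ^ 3 * (V * m ^ 29) + n * m ^ 29) ≤⟨ *-monoʳ-≤ (τ ^ 3 * τ * r) (+-mono-≤ (*-monoʳ-≤ (τ ^ 3) Vm²⁹) nm²⁹) ⟩
    τ ^ 3 * τ * r * (τ ^ 3 * (τ ^ 70 * n ^ 59) + n ^ 59)
      ≡⟨ cong (λ z → τ ^ 3 * τ * r * (z + n ^ 59)) (trans (sym (*-assoc (τ ^ 3) (τ ^ 70) (n ^ 59))) (cong (_* n ^ 59) (sym (^-distribˡ-+-* τ 3 70)))) ⟩
    τ ^ 3 * τ * r * (τ ^ 73 * n ^ 59 + n ^ 59) ≤⟨ *-monoʳ-≤ (τ ^ 3 * τ * r) (absorb (n ^ 59)) ⟩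
    τ ^ 3 * τ * r * (τ * (τ ^ 73 * n ^ 59)) ≡⟨ arith₂ (τ ^ 3) τ r (τ ^ 73) (n ^ 59) ⟩
    τ * (τ * (τ ^ 3 * τ ^ 73)) * (r * n ^ 59) ≡⟨ cong (λ z → τ * (τ * z) * (r * n ^ 59)) (sym (^-distribˡ-+-* τ 3 73)) ⟩
    τ ^ 78 * (r * n ^ 59) ∎
    where
    arith₁ : ∀ c τ V n r p → c * (τ * (c * V + n) * r) * p ≡ c * τ * r * (c * (V * p) + n * p)
    arith₁ = solve-∀
    arith₂ : ∀ c τ r d x → c * τ * r * (τ * (d * x)) ≡ τ * (τ * (c * d)) * (r * x)
    arith₂ = solve-∀
  -- The constant is absorbed by `(τ * m) ^ 78 ≤ n ^ 156`, that is (2 δ)^78 ≤ 1.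
  final : τ ^ 78 * m ^ 108 ≤ τ ^ 78 * (r * n ^ 215)
  final = begin
    τ ^ 78 * m ^ 108 ≡⟨ trans (cong (τ ^ 78 *_) (^-distribˡ-+-* m 78 30)) (sym (*-assoc (τ ^ 78) (m ^ 78) (m ^ 30))) ⟩
    τ ^ 78 * m ^ 78 * m ^ 30 ≡⟨ cong (_* m ^ 30) (sym (^-distribʳ-* 78 τ m)) ⟩
    (τ * m) ^ 78 * m ^ 30 ≤⟨ *-mono-≤ (≤-trans (^-monoˡ-≤ 78 τm≤) (≤-reflexive (^-*-assoc n 2 78))) m³⁰ ⟩
    n ^ 156 * (τ ^ 78 * (r * n ^ 59)) ≡⟨ arith (n ^ 156) (τ ^ 78) r (n ^ 59) ⟩
    τ ^ 78 * (r * (n ^ 156 * n ^ 59)) ≡⟨ cong (λ z → τ ^ 78 * (r * z)) (sym (^-distribˡ-+-* n 156 59)) ⟩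
    τ ^ 78 * (r * n ^ 215) ∎
    where
    arith : ∀ a c r b → a * (c * (r * b)) ≡ c * (r * (a * b))
    arith = solve-∀

square-cancel-≤ : ∀ {a b} → a * a ≤ b * b → a ≤ b
square-cancel-≤ {a} {b} h with a ≤? b
... | yes p = p
... | no p = contradiction h (<⇒≱ (*-mono-< (≰⇒> p) (≰⇒> p)))

-- Every progression gives the pairs (x , x + d) and (x + d , x).
2fs≤n² : ∀ s A → 2 ≤ s → Unique A → 2 * fs s A ≤ length A ^ 2
2fs≤n² s A 2≤s uA = begin
  2 * fs s A ≡⟨ cong (fs s A +_) (+-identityʳ (fs s A)) ⟩
  fs s A + fs s A ≤⟨ +-mono-≤ below (≤-trans below (≤-reflexive (∑-swap A A _))) ⟩
  ∑ A (λ a → ∑ A (λ b → ind (a <? b))) + ∑ A (λ a → ∑ A (λ b → ind (b <? a)))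
    ≡⟨ trans (sym (∑-+ A _ _)) (∑-cong A (λ a _ → sym (∑-+ A _ _))) ⟩
  ∑ A (λ a → ∑ A (λ b → ind (a <? b) + ind (b <? a))) ≤⟨ ∑-mono A (λ a _ → ∑-mono A (λ b _ → exclusive (a <? b) (b <? a))) ⟩
  ∑ A (λ a → ∑ A (λ b → 1)) ≡⟨ trans (∑-const A (∑ A (λ _ → 1))) (cong (length A *_) (∑-const A 1)) ⟩
  length A ^ 2 ∎
  where
  open ≤-Reasoning
  exclusive : ∀ {a b} (p : Dec (a < b)) (q : Dec (b < a)) → ind p + ind q ≤ 1
  exclusive (yes p) (yes q) = contradiction q (<⇒≯ p)
  exclusive (yes _) (no _) = s≤s z≤n
  exclusive (no _) q = ind-≤1 q
  AA = cartesianProduct A A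
  ordered? : ∀ (p : ℕ × ℕ) → Dec (proj₁ p < proj₂ p)
  ordered? p = _ <? _
  below : fs s A ≤ ∑ A (λ a → ∑ A (λ b → ind (a <? b)))
  below = ≤-trans (injection-length (progressions s A) (filter ordered? AA) (λ { (x , d) → x , x + 1 * d })
      (progressions-unique s A)
      (λ { (x , d) p∈ → let 1≤d , ap = ∈-progressions⁻ {s} {A} p∈ in
        ∈-filter⁺ ordered? (∈-cartesianProduct⁺ (subst (_∈ A) (+-identityʳ x) (APin-lookup ap 0 (<-trans (s≤s z≤n) 2≤s))) (APin-lookup ap 1 2≤s))
          (≤-trans (≤-reflexive (+-comm 1 x)) (+-monoʳ-≤ x (≤-trans 1≤d (≤-reflexive (sym (*-identityˡ d)))))) })
      (λ { (x , d) (x′ , d′) _ _ eq → let p , q = ,-injective eq in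
        cong₂ _,_ p (trans (sym (*-identityˡ d)) (trans (+-cancelˡ-≡ x′ _ _ (trans (cong (_+ 1 * d) (sym p)) q)) (*-identityˡ d′))) }))
    (≤-reflexive (trans (length-filter-∑ ordered? AA) (∑-× A A _)))

model-density : ∀ (A W : List ℕ) n r k → 1 ≤ n →
  (∀ a b c v → a ∈ A → b ∈ A → c ∈ A → a + c ≡ 2 * b + v ⊎ 2 * b ≡ a + c + v → v ∈ W) →
  2 ≤ k → Unique A → KAPFree k A →
  (∀ B → Unique B → All (λ b → 1 ≤ b × b ≤ n) B → KAPFree k B → length B ≤ r) →
  n * length A ≤ 2 * (2 ^ 3 * length W + n) * r
model-density A W n r k 1≤n defects 2≤k uA free maximal =
  let B , uB , bd , fB , A≤ = model A W n h k 1≤n (s≤s z≤n) 8w≤nh defects 2≤k uA free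
  in finish (length A) (length B) A≤ (maximal B uB bd fB)
  where
  open ≤-Reasoning
  instance
    n≢0 : NonZero n
    n≢0 = >-nonZero 1≤n
  w h : ℕ
  w = 8 * length W
  -- Rounding up secures `w ≤ n * h` and costs only the summand `n` in `n * h ≤ w + n`.
  h = suc (w / n)
  8w≤nh : w ≤ n * h
  8w≤nh = ≤-trans (≤-reflexive (m≡m%n+[m/n]*n w n)) (≤-trans (+-monoˡ-≤ (w / n * n) (<⇒≤ (m%n<n w n))) (≤-reflexive (*-comm h n)))
  nh≤ : n * h ≤ w + n
  nh≤ = ≤-trans (≤-reflexive (trans (*-comm n h) (+-comm n (w / n * n)))) (+-monoˡ-≤ n (m/n*n≤m w n))
  arith : ∀ n h r → n * (2 * h * r) ≡ 2 * (n * h) * r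
  arith = solve-∀
  finish : ∀ a b → a ≤ 2 * h * b → b ≤ r → n * a ≤ 2 * (w + n) * r
  finish a b a≤ b≤r = begin
    n * a ≤⟨ *-monoʳ-≤ n (≤-trans a≤ (*-monoʳ-≤ (2 * h) b≤r)) ⟩
    n * (2 * h * r) ≡⟨ arith n h r ⟩
    2 * (n * h) * r ≤⟨ *-monoˡ-≤ r (*-monoʳ-≤ 2 nh≤) ⟩
    2 * (w + n) * r ∎

-- Chaining the estimates for a set with many progressions

module ManyProgressions (k s : ℕ) (A : List ℕ) (2≤k : 2 ≤ k) (3≤s : 3 ≤ s) (uA : Unique A) (free : KAPFree k A)
  (r : ℕ) (maximal : ∀ B → Unique B → All (λ b → 1 ≤ b × b ≤ length A) B → KAPFree k B → length B ≤ r)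
  (1≤n : 1 ≤ length A) (1≤m : 1 ≤ fs s A) where

  private
    n m : ℕ
    n = length A
    m = fs s A

    doubles : List ℕ
    doubles = map (2 *_) A

    open SumGraph doubles A
    open DependentRandomChoice A edge? m hiding (n)

    -- The first and third terms of a progression sum to twice the second, and these two terms
    -- determine the progression.
    edges : m ≤ ∑ A (λ a → ∑ A (λ b → ind (edge? a b)))
    edges = ≤-trans (injection-length (progressions s A) (filter edge′? AA) (λ { (x , d) → x + 0 * d , x + 2 * d })
        (progressions-unique s A)
        (λ { (x , d) p∈ → let _ , ap = ∈-progressions⁻ {s} {A} p∈ in
          ∈-filter⁺ edge′? (∈-cartesianProduct⁺ (APin-lookup ap 0 (≤-trans (s≤s z≤n) 3≤s)) (APin-lookup ap 2 3≤s))
            (subst (_∈ doubles) (middle x d) (∈-map⁺ (2 *_) (APin-lookup ap 1 (≤-trans (s≤s (s≤s z≤n)) 3≤s)))) })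
        (λ { (x , d) (x′ , d′) _ _ eq → let p , q = ,-injective eq in ends x d x′ d′ p q }))
      (≤-reflexive (trans (length-filter-∑ edge′? AA) (∑-× A A _)))
      where
      AA = cartesianProduct A A
      edge′? : ∀ (p : ℕ × ℕ) → Dec (proj₁ p + proj₂ p ∈ doubles)
      edge′? (a , b) = edge? a b
      middle : ∀ x d → 2 * (x + 1 * d) ≡ x + 0 * d + (x + 2 * d)
      middle = solve-∀
      ends : ∀ x d x′ d′ → x + 0 * d ≡ x′ + 0 * d′ → x + 2 * d ≡ x′ + 2 * d′ → (x , d) ≡ (x′ , d′)
      ends x d x′ d′ p q with trans (sym (+-identityʳ x)) (trans p (+-identityʳ x′))
      ... | refl = cong (x ,_) (*-cancelˡ-≡ d d′ 2 (+-cancelˡ-≡ x _ _ q))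

    chosen = choice 1≤n edges

    A′ : List ℕ
    A′ = neighbourhood (proj₁ chosen)

    N : ℕ
    N = length A′

    uA′ : Unique A′
    uA′ = UP.filter⁺ (λ a → edge? a (proj₁ chosen)) uA

    open FewBadPairs A′ (λ a b → ¬? (rich? a b))

    A₁ : List ℕ
    A₁ = tame

    N₁ : ℕ
    N₁ = length A₁

    N≤2N₁ : N ≤ 2 * N₁
    N≤2N₁ = many-tame (proj₂ (proj₂ chosen))

    m≤2nN : m ≤ 2 * n * N
    m≤2nN = square-cancel-≤ (begin
      m * m ≤⟨ proj₁ (proj₂ chosen) ⟩
      -- The factor 2 is raised to 4 so that the bound is a perfect square.
      2 * (n * n) * (N * N) ≤⟨ *-monoˡ-≤ (N * N) (*-monoˡ-≤ (n * n) {2} {4} (s≤s (s≤s z≤n))) ⟩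
      4 * (n * n) * (N * N) ≡⟨ arith n N ⟩
      2 * n * N * (2 * n * N) ∎)
      where
      open ≤-Reasoning
      arith : ∀ n N → 4 * (n * n) * (N * N) ≡ 2 * n * N * (2 * n * N)
      arith = solve-∀

    1≤N₁ : 1 ≤ N₁
    1≤N₁ = n≢0⇒n>0 λ z → <⇒≱ 1≤m (≤-trans m≤2nN (≤-trans (*-monoʳ-≤ (2 * n) (≤-trans N≤2N₁ (≤-reflexive (cong (2 *_) z))))
      (≤-reflexive (*-zeroʳ (2 * n)))))

    uA₁ : Unique A₁
    uA₁ = UP.filter⁺ tame? uA′

    E-spec = representatives ℤP._≟_ diff (cartesianProduct A₁ A₁)

    E : List (ℕ × ℕ)
    E = proj₁ E-spec

    E∈ : ∀ a b → (a , b) ∈ E → a ∈ A₁ × b ∈ A₁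
    E∈ a b e∈ = ∈-cartesianProduct⁻ A₁ A₁ (proj₁ (proj₂ (proj₂ E-spec)) (a , b) e∈)

    cover : ∀ a b → a ∈ A₁ → b ∈ A₁ → diff (a , b) ∈ map diff E
    cover a b a∈ b∈ = proj₂ (proj₂ (proj₂ E-spec)) (a , b) (∈-cartesianProduct⁺ a∈ b∈)

    T M : ℕ
    T = n * n * n * 32
    M = m * m

    -- At least half of the `x` in `A′` are rich with both `a` and `b`, and each of them gives at
    -- least (M / T)² choices of `(y , z)`. The double negations in `good` arise because the bad
    -- pairs are those that are not rich.
    many-paths : ∀ a b → (a , b) ∈ E → M * M * N ≤ T * T * 2 * ∑ A′ (λ x → paths a x * paths b x)
    many-paths a b e∈ = begin
      M * M * N ≤⟨ *-monoʳ-≤ (M * M) (common a b (proj₁ (E∈ a b e∈)) (proj₂ (E∈ a b e∈))) ⟩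
      M * M * (2 * ∑ A′ good) ≡⟨ arith₁ (M * M) (∑ A′ good) ⟩
      2 * (M * M * ∑ A′ good) ≡⟨ cong (2 *_) (sym (∑-*ˡ A′ (M * M) good)) ⟩
      2 * ∑ A′ (λ x → M * M * good x) ≤⟨ *-monoʳ-≤ 2 (∑-mono A′ (λ x _ → pointwise (rich? a x) (rich? b x))) ⟩
      2 * ∑ A′ (λ x → T * T * (paths a x * paths b x)) ≡⟨ cong (2 *_) (∑-*ˡ A′ (T * T) _) ⟩
      2 * (T * T * ∑ A′ (λ x → paths a x * paths b x)) ≡⟨ arith₂ (T * T) _ ⟩
      T * T * 2 * ∑ A′ (λ x → paths a x * paths b x) ∎
      where
      open ≤-Reasoning
      good : ℕ → ℕ
      good x = ind (¬? (¬? (rich? a x))) * ind (¬? (¬? (rich? b x)))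
      arith₁ : ∀ p q → p * (2 * q) ≡ 2 * (p * q)
      arith₁ = solve-∀
      arith₂ : ∀ p q → 2 * (p * q) ≡ p * 2 * q
      arith₂ = solve-∀
      pointwise : ∀ {p q} (d : Dec (M ≤ T * p)) (e : Dec (M ≤ T * q)) →
        M * M * (ind (¬? (¬? d)) * ind (¬? (¬? e))) ≤ T * T * (p * q)
      pointwise {p} {q} (yes d) (yes e) = ≤-trans (≤-reflexive (*-identityʳ (M * M)))
        (≤-trans (*-mono-≤ d e) (≤-reflexive (arith T p q)))
        where
        arith : ∀ T p q → T * p * (T * q) ≡ T * T * (p * q)
        arith = solve-∀
      pointwise (yes _) (no _) = ≤-trans (≤-reflexive (*-zeroʳ (M * M))) z≤n
      pointwise (no _) _ = ≤-trans (≤-reflexive (*-zeroʳ (M * M))) z≤n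

    -- Here `T * T * 2` equals 2^11 n^6, and the four sums range over `doubles`, which has `n`
    -- elements, giving the factor n^4.
    E-bound : length E * (m ^ 4 * N) ≤ 2 ^ 11 * n ^ 10
    E-bound = subst₂ _≤_ (cong (length E *_) (arith₁ m N)) (trans (cong (λ l → T * T * 2 * (l * l * (l * l))) (length-map (2 *_) A)) (arith₂ n))
      (few-differences uA A′ uA′ E (proj₁ (proj₂ E-spec)) (T * T * 2) (M * M * N) many-paths)
      where
      arith₁ : ∀ m N → (m * m) * (m * m) * N ≡ m * (m * (m * (m * 1))) * N
      arith₁ = solve-∀
      arith₃ : ∀ n p τ → (n * n * n * p) * (n * n * n * p) * τ * (n * n * (n * n)) ≡ p * p * τ * (n * (n * (n * (n * (n * (n * (n * (n * (n * (n * 1))))))))))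
      arith₃ = solve-∀
      arith₂ : ∀ n → (n * n * n * 32) * (n * n * n * 32) * 2 * (n * n * (n * n)) ≡ 2 ^ 11 * n ^ 10
      arith₂ n = trans (arith₃ n 32 2) (cong (_* n ^ 10) {x = 32 * 32 * 2} {y = 2 ^ 11} refl)

    open PopularDifferences A₁ (map diff E) (proj₁ (proj₂ E-spec)) cover 1≤N₁

    t : ℕ
    t = proj₁ large-translate

    A₂ : List ℕ
    A₂ = translate t

    A₂⊆A₁ : ∀ {a} → a ∈ A₂ → a ∈ A₁
    A₂⊆A₁ a∈ = proj₁ (∈-filter⁻ (λ a → popular? (diff (a , t))) {xs = A₁} a∈)

    A₂⊆A : ∀ a → a ∈ A₂ → a ∈ A
    A₂⊆A a a∈ = proj₁ (∈-filter⁻ (λ a → edge? a (proj₁ chosen)) {xs = A} (proj₁ (∈-filter⁻ tame? {xs = A′} (A₂⊆A₁ a∈))))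

    triples : List (ℕ × ℕ × ℕ)
    triples = cartesianProduct A₂ (cartesianProduct A₂ A₂)

    V-spec = representatives ℤP._≟_ defect triples

    V : List (ℕ × ℕ × ℕ)
    V = proj₁ V-spec

    V-bound : length V * N₁ ^ 4 ≤ 2 ^ 2 * length E ^ 5
    V-bound = subst₂ _≤_ (cong (length V *_) (arith₁ N₁))
      (trans (cong (λ d → 2 * d * (2 * d) * (d * (d * d))) (length-map diff E)) (arith₂ (length E)))
      (few-defects uA₁ t V (proj₁ (proj₂ V-spec)) λ a b c v∈ →
        let a∈ , bc∈ = ∈-cartesianProduct⁻ A₂ (cartesianProduct A₂ A₂) (proj₁ (proj₂ (proj₂ V-spec)) _ v∈)
            b∈ , c∈ = ∈-cartesianProduct⁻ A₂ A₂ bc∈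
        in a∈ , b∈ , c∈)
      where
      arith₁ : ∀ x → (x * x) * (x * x) ≡ x * (x * (x * (x * 1)))
      arith₁ = solve-∀
      arith₂ : ∀ d → 2 * d * (2 * d) * (d * (d * d)) ≡ 4 * (d * (d * (d * (d * (d * 1)))))
      arith₂ = solve-∀

    W : List ℕ
    W = map ℤ.∣_∣ (map defect V)

    length-W : length W ≡ length V
    length-W = trans (length-map ℤ.∣_∣ (map defect V)) (length-map defect V)

    ∣defect∣ : ∀ a b c v → a + c ≡ 2 * b + v ⊎ 2 * b ≡ a + c + v → ℤ.∣ defect (a , b , c) ∣ ≡ v
    ∣defect∣ a b c v (inj₁ e) = cong ℤ.∣_∣ (trans (cong₂ ℤ._-_ (trans (cong ℤ.+_ e) (cong (ℤ._+ ℤ.+ v) (ℤP.pos-* 2 b))) refl)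
      (arith (ℤ.+ 2 ℤ.* ℤ.+ b) (ℤ.+ v)))
      where
      arith : ∀ p v → p ℤ.+ v ℤ.- p ≡ v
      arith = ℤSolver.solve-∀
    ∣defect∣ a b c v (inj₂ e) = trans (cong ℤ.∣_∣ (trans (cong (λ z → ℤ.+ (a + c) ℤ.- z) (trans (sym (ℤP.pos-* 2 b)) (cong ℤ.+_ e)))
      (arith (ℤ.+ (a + c)) (ℤ.+ v)))) (ℤP.∣-i∣≡∣i∣ (ℤ.+ v))
      where
      arith : ∀ p v → p ℤ.- (p ℤ.+ v) ≡ ℤ.- v
      arith = ℤSolver.solve-∀

    defects∈W : ∀ a b c v → a ∈ A₂ → b ∈ A₂ → c ∈ A₂ → a + c ≡ 2 * b + v ⊎ 2 * b ≡ a + c + v → v ∈ W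
    defects∈W a b c v a∈ b∈ c∈ e = subst (_∈ W) (∣defect∣ a b c v e)
      (∈-map⁺ ℤ.∣_∣ (proj₂ (proj₂ (proj₂ V-spec)) (a , b , c) (∈-cartesianProduct⁺ a∈ (∈-cartesianProduct⁺ b∈ c∈))))

    model-bound : n * length A₂ ≤ 2 * (2 ^ 3 * length V + n) * r
    model-bound = subst (λ w → n * length A₂ ≤ 2 * (2 ^ 3 * w + n) * r) length-W
      (model-density A₂ W n r k 1≤n defects∈W 2≤k (UP.filter⁺ (λ a → popular? (diff (a , t))) uA₁) (KAPFree-⊆ A₂⊆A free) maximal)

  bound : m ^ 108 * n ≤ r * n ^ 216
  bound = upper-arithmetic 2 m n N N₁ (length A₂) (length E) (length V) r ≤-refl m≤2nN N≤2N₁ (proj₂ (proj₂ large-translate))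
    E-bound V-bound model-bound (2fs≤n² s A (≤-trans (s≤s (s≤s z≤n)) 3≤s) uA)

upper-bound : ∀ k s (A : List ℕ) r → 2 ≤ k → 3 ≤ s → Unique A → KAPFree k A → 1 ≤ length A →
  (∀ B → Unique B → All (λ b → 1 ≤ b × b ≤ length A) B → KAPFree k B → length B ≤ r) →
  fs s A ^ 108 * length A ≤ r * length A ^ 216
upper-bound k s A r 2≤k 3≤s uA free 1≤n maximal with fs s A ≟ 0
... | no m≢0 = ManyProgressions.bound k s A 2≤k 3≤s uA free r maximal 1≤n (n≢0⇒n>0 m≢0)
... | yes m≡0 = ≤-trans (≤-reflexive (trans (cong (λ m → m ^ 108 * length A) m≡0) refl)) z≤n

-- Lower bound

Configuration : ℕ → ℕ → ℕ → ℕ → Set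
Configuration s k n c = Σ (List ℕ) λ A → Unique A × length A ≡ n × KAPFree k A × c ≤ fs s A

-- Unions of far-apart sets

module FarUnion (k : ℕ) (3≤k : 3 ≤ k) (A B : List ℕ) (freeA : KAPFree k A) (freeB : KAPFree k B) where

  gap : ℕ
  gap = suc (2 * maxL A + maxL B)

  B⁺ : List ℕ
  B⁺ = map (gap +_) B

  private
    ∈B⁺ : ∀ {z} → z ∈ B⁺ → gap ≤ z × z ≤ gap + maxL B
    ∈B⁺ z∈ with ∈-map⁻ (gap +_) z∈
    ... | b , b∈ , refl = m≤m+n gap b , +-monoʳ-≤ gap (∈⇒≤maxL B b∈)

    2maxA<gap : maxL A + maxL A < gap
    2maxA<gap = s≤s (≤-trans (≤-reflexive (cong (maxL A +_) (sym (+-identityʳ (maxL A))))) (m≤m+n (2 * maxL A) (maxL B)))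

    maxA<gap : maxL A < gap
    maxA<gap = ≤-<-trans (m≤m+n (maxL A) (maxL A)) 2maxA<gap

    low : ∀ {z} → z ∈ A ++ B⁺ → z < gap → z ∈ A
    low z∈ z<gap = [ id , (λ z∈B → contradiction z<gap (≤⇒≯ (proj₁ (∈B⁺ z∈B)))) ]′ (∈-++⁻ A z∈)

    high : ∀ {z} → z ∈ A ++ B⁺ → gap ≤ z → z ∈ B⁺
    high z∈ gap≤z = [ (λ z∈A → contradiction (≤-<-trans (∈⇒≤maxL A z∈A) maxA<gap) (≤⇒≯ gap≤z)) , id ]′ (∈-++⁻ A z∈)

  -- A progression starting in `B⁺` stays there. If its first two terms lie in `A`, each step is at
  -- most `maxL A` and cannot cross the gap. If only the first lies in `A`, the third term is at
  -- least 2 gap - max A, which exceeds gap + max B.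
  KAPFree-union : KAPFree k (A ++ B⁺)
  KAPFree-union x d 1≤d ap = start (∈-++⁻ A (element 0 (≤-trans (s≤s z≤n) 3≤k)))
    where
    element : ∀ i → i < k → x + i * d ∈ A ++ B⁺
    element i i<k = APin-lookup ap i i<k
    1<k : 1 < k
    1<k = ≤-trans (s≤s (s≤s z≤n)) 3≤k
    start : x + 0 * d ∈ A ⊎ x + 0 * d ∈ B⁺ → ⊥
    start (inj₂ x∈B) with ∈-map⁻ (gap +_) (subst (_∈ B⁺) (+-identityʳ x) x∈B)
    ... | y , _ , refl = freeB y d 1≤d (APin-tabulate λ i i<k →
      let b , b∈ , e = ∈-map⁻ (gap +_) (high (element i i<k) (≤-trans (m≤m+n gap y) (m≤m+n (gap + y) (i * d))))
      in subst (_∈ B) (sym (+-cancelˡ-≡ gap _ _ (trans (sym (+-assoc gap y (i * d))) e))) b∈)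
    start (inj₁ x∈A) = next (∈-++⁻ A (element 1 1<k))
      where
      x≤ : x ≤ maxL A
      x≤ = ∈⇒≤maxL A (subst (_∈ A) (+-identityʳ x) x∈A)
      next : x + 1 * d ∈ A ⊎ x + 1 * d ∈ B⁺ → ⊥
      next (inj₁ y∈A) = freeA x d 1≤d (APin-tabulate all-low)
        where
        d≤ : d ≤ maxL A
        d≤ = ≤-trans (≤-trans (≤-reflexive (sym (*-identityˡ d))) (m≤n+m (1 * d) x)) (∈⇒≤maxL A y∈A)
        shift : ∀ x d m → x + (d + m) ≡ d + (x + m)
        shift = solve-∀
        all-low : ∀ i → i < k → x + i * d ∈ A
        all-low zero _ = x∈A
        all-low (suc i) i<k = low (element (suc i) i<k) (≤-<-trans (≤-trans (≤-reflexive (shift x d (i * d)))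
          (+-mono-≤ d≤ (∈⇒≤maxL A (all-low i (<-trans (n<1+n i) i<k))))) 2maxA<gap)
      next (inj₂ y∈B) = <⇒≱ (≤-refl {gap}) (+-cancelˡ-≤ gap _ _ (begin
        gap + gap ≤⟨ +-mono-≤ gap≤ gap≤ ⟩
        x + 1 * d + (x + 1 * d) ≡⟨ regroup x d ⟩
        x + 2 * d + x ≤⟨ +-mono-≤ (proj₂ (∈B⁺ (high (element 2 3≤k) gap≤2))) x≤ ⟩
        gap + maxL B + maxL A ≤⟨ +-monoʳ-≤ (gap + maxL B) (m≤m+n (maxL A) (1 * maxL A)) ⟩
        gap + maxL B + 2 * maxL A ≡⟨ trans (+-assoc gap (maxL B) _) (cong (gap +_) (+-comm (maxL B) _)) ⟩
        gap + pred gap ∎))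
        where
        open ≤-Reasoning
        gap≤ : gap ≤ x + 1 * d
        gap≤ = proj₁ (∈B⁺ y∈B)
        gap≤2 : gap ≤ x + 2 * d
        gap≤2 = ≤-trans gap≤ (+-monoʳ-≤ x (*-monoˡ-≤ d {1} {2} (s≤s z≤n)))
        regroup : ∀ x d → x + 1 * d + (x + 1 * d) ≡ x + 2 * d + x
        regroup = solve-∀

  unique-union : Unique A → Unique B → Unique (A ++ B⁺)
  unique-union uA uB = UP.++⁺ uA (UP.map⁺ (+-cancelˡ-≡ gap _ _) uB)
    λ { (z∈A , z∈B) → <⇒≱ (≤-<-trans (∈⇒≤maxL A z∈A) maxA<gap) (proj₁ (∈B⁺ z∈B)) }

  fs-union : ∀ s → 2 ≤ s → fs s A + fs s B ≤ fs s (A ++ B⁺)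
  fs-union s 2≤s = ≤-trans (≤-reflexive (sym lengths)) (fs-lower {s} {A ++ B⁺} L 2≤s uL progression)
    where
    shift : ℕ × ℕ → ℕ × ℕ
    shift (u , d) = gap + u , d
    shift-injective : ∀ {p q} → shift p ≡ shift q → p ≡ q
    shift-injective {u , d} {u′ , d′} eq = let e , e′ = ,-injective eq in cong₂ _,_ (+-cancelˡ-≡ gap u u′ e) e′
    L : List (ℕ × ℕ)
    L = progressions s A ++ map shift (progressions s B)
    lengths : length L ≡ fs s A + fs s B
    lengths = trans (length-++ (progressions s A)) (cong (fs s A +_) (length-map shift (progressions s B)))
    uL : Unique L
    uL = UP.++⁺ (progressions-unique s A) (UP.map⁺ shift-injective (progressions-unique s B)) disjoint
      where
      disjoint : ∀ {p} → ¬ (p ∈ progressions s A × p ∈ map shift (progressions s B))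
      disjoint {x , d} (p∈ , q∈) with ∈-map⁻ shift q∈
      ... | (u , _) , _ , refl = <⇒≱ maxA<gap (≤-trans (m≤m+n gap u) (≤-trans (m≤m+n (gap + u) (0 * d))
        (∈⇒≤maxL A (APin-lookup {s} {A} {gap + u} {d} (proj₂ (∈-progressions⁻ {s} {A} p∈)) 0 (<-trans (s≤s z≤n) 2≤s)))))
    progression : ∀ x d → (x , d) ∈ L → 1 ≤ d × APin s (A ++ B⁺) x d
    progression x d p∈ with ∈-++⁻ (progressions s A) p∈
    ... | inj₁ q∈ = let 1≤d , ap = ∈-progressions⁻ {s} {A} q∈ in 1≤d , All.map ∈-++⁺ˡ ap
    ... | inj₂ q∈ with ∈-map⁻ shift q∈
    ... | (u , _) , r∈ , refl = let 1≤d , ap = ∈-progressions⁻ {s} {B} r∈ in 1≤d ,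
      APin-tabulate λ i i<s → ∈-++⁺ʳ A (subst (_∈ B⁺) (sym (+-assoc gap u (i * d))) (∈-map⁺ (gap +_) (APin-lookup ap i i<s)))

module _ {s k : ℕ} (2≤s : 2 ≤ s) (3≤k : 3 ≤ k) where

  combine : ∀ {n c n′ c′} → Configuration s k n c → Configuration s k n′ c′ → Configuration s k (n + n′) (c + c′)
  combine (A , uA , refl , fA , cA) (B , uB , refl , fB , cB) =
    A ++ B⁺ , unique-union uA uB , trans (length-++ A) (cong (length A +_) (length-map (gap +_) B)) ,
    KAPFree-union , ≤-trans (+-mono-≤ cA cB) (fs-union s 2≤s)
    where open FarUnion k 3≤k A B fA fB

  empty : Configuration s k 0 0
  empty = [] , [] , refl , (λ x d _ ap → case APin-lookup ap 0 (≤-trans (s≤s z≤n) 3≤k) of λ ()) , z≤n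

  singleton : Configuration s k 1 0
  singleton = [ 0 ] , [] ∷ [] , refl , free , z≤n
    where
    free : KAPFree k [ 0 ]
    free x (suc d) _ ap with APin-lookup ap 1 (≤-trans (s≤s (s≤s z≤n)) 3≤k)
    ... | here eq = case m+n≡0⇒n≡0 x eq of λ ()

  copies : ∀ {n c} J → Configuration s k n c → Configuration s k (J * n) (J * c)
  copies zero C = empty
  copies (suc J) C = combine C (copies J C)

  -- The missing elements are supplied by far-apart single points. With `J` equal to 0 this yields a
  -- set of any size free of k-term progressions.
  padded : ∀ {n c} J N → Configuration s k n c → J * n ≤ N → Configuration s k N (J * c)
  padded {n} {c} J N C Jn≤N with m≤n⇒∃[o]m+o≡n Jn≤N
  ... | o , refl = subst₂ (Configuration s k) (cong (J * n +_) (*-identityʳ o))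
    (trans (cong (J * c +_) (*-zeroʳ o)) (+-identityʳ (J * c))) (combine (copies J C) (copies o singleton))

-- Stacking translates in rows

module Rows (k s : ℕ) (s<k : s < k) (2≤s : 2 ≤ s) (S : List ℕ) (uS : Unique S) (freeS : KAPFree k S)
  (w : ℕ) (1≤w : 1 ≤ w) (S≤w : ∀ y → y ∈ S → y ≤ w) where

  private
    ρ : ℕ
    ρ = length S

  hit? : ∀ u (p : ℕ × ℕ) i → Dec (proj₁ p + i * proj₂ p ∈ map (u +_) S)
  hit? u (x , d) i = (x + i * d) ∈? map (u +_) S

  Central : ℕ × ℕ → Set
  Central (x , d) = ∀ i → i < s → w ≤ x + i * d × x + i * d < w + w

  -- The translates by z - y with y in `S` all contain `z`; they are distinct and in range because y
  -- ≤ w ≤ z < 2 w.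
  count-translates : ∀ z → w ≤ z → z < w + w → ρ ≤ ∑ (upTo (w + w)) (λ u → ind (z ∈? map (u +_) S))
  count-translates z w≤z z<2w = ≤-trans (injection-length S (filter (λ u → z ∈? map (u +_) S) (upTo (w + w))) (z ∸_) uS
      (λ y y∈ → ∈-filter⁺ (λ u → z ∈? map (u +_) S) (∈-upTo⁺ (≤-<-trans (m∸n≤m z y) z<2w))
        (subst (_∈ map (z ∸ y +_) S) (m∸n+n≡m (≤-trans (S≤w y y∈) w≤z)) (∈-map⁺ (z ∸ y +_) y∈)))
      (λ y y′ y∈ y′∈ → ∸-cancelˡ-≡ (≤-trans (S≤w y y∈) w≤z) (≤-trans (S≤w y′ y′∈) w≤z)))
    (≤-reflexive (length-filter-∑ (λ u → z ∈? map (u +_) S) (upTo (w + w))))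

  good-translate : ∀ (Q : List (ℕ × ℕ)) i → i < s → (∀ p → p ∈ Q → Central p) →
    Σ ℕ λ u → u < w + w × ρ * length Q ≤ (w + w) * length (filter (λ p → hit? u p i) Q)
  good-translate Q i i<s central =
    let u , u∈ , h = pigeonhole (upTo (w + w)) (λ _ → ρ * length Q) (λ u → (w + w) * size u)
          (≤-trans (≤-trans 1≤w (m≤m+n w w)) (≤-reflexive (sym (length-upTo (w + w))))) average
    in u , ∈-upTo⁻ u∈ , h
    where
    open ≤-Reasoning
    size : ℕ → ℕ
    size u = length (filter (λ p → hit? u p i) Q)
    average : ∑ (upTo (w + w)) (λ _ → ρ * length Q) ≤ ∑ (upTo (w + w)) (λ u → (w + w) * size u)
    average = begin
      ∑ (upTo (w + w)) (λ _ → ρ * length Q) ≡⟨ trans (∑-const (upTo (w + w)) (ρ * length Q)) (cong (_* (ρ * length Q)) (length-upTo (w + w))) ⟩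
      (w + w) * (ρ * length Q) ≡⟨ cong ((w + w) *_) (trans (*-comm ρ (length Q)) (sym (∑-const Q ρ))) ⟩
      (w + w) * ∑ Q (λ _ → ρ) ≤⟨ *-monoʳ-≤ (w + w) (∑-mono Q λ { (x , d) p∈ →
          let lo , hi = central (x , d) p∈ i i<s in count-translates (x + i * d) lo hi }) ⟩
      (w + w) * ∑ Q (λ p → ∑ (upTo (w + w)) (λ u → ind (hit? u p i))) ≡⟨ cong ((w + w) *_) (∑-swap Q (upTo (w + w)) _) ⟩
      (w + w) * ∑ (upTo (w + w)) (λ u → ∑ Q (λ p → ind (hit? u p i)))
        ≡⟨ cong ((w + w) *_) (∑-cong (upTo (w + w)) (λ u _ → sym (length-filter-∑ (λ p → hit? u p i) Q))) ⟩
      (w + w) * ∑ (upTo (w + w)) size ≡⟨ sym (∑-*ˡ (upTo (w + w)) (w + w) size) ⟩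
      ∑ (upTo (w + w)) (λ u → (w + w) * size u) ∎

  record Selection (P : List (ℕ × ℕ)) (i : ℕ) : Set where
    field
      u : ℕ → ℕ
      u< : ∀ j → u j < w + w
      Q : List (ℕ × ℕ)
      uQ : Unique Q
      Q⊆P : ∀ p → p ∈ Q → p ∈ P
      hits : ∀ x d → (x , d) ∈ Q → ∀ j → j < i → x + j * d ∈ map (u j +_) S
      many : ρ ^ i * length P ≤ (w + w) ^ i * length Q

  -- The translates are chosen one at a time, each keeping its share of the surviving pairs.
  select : ∀ (P : List (ℕ × ℕ)) → Unique P → (∀ p → p ∈ P → Central p) → ∀ i → i ≤ s → Selection P i
  select P uP central zero _ = record
    -- Zero is a placeholder for rows not yet chosen; it satisfies the bound demanded for every row.
    { u = λ _ → 0 ; u< = λ _ → ≤-trans 1≤w (m≤m+n w w) ; Q = P ; uQ = uP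
    ; Q⊆P = λ _ → id ; hits = λ _ _ _ _ () ; many = ≤-refl }
  select P uP central (suc i) i<s = record
    { u = u′ ; u< = u′< ; Q = filter keep? Q ; uQ = UP.filter⁺ keep? uQ
    ; Q⊆P = λ p p∈ → Q⊆P p (proj₁ (∈-filter⁻ keep? {xs = Q} p∈)) ; hits = hits′ ; many = many′ }
    where
    open Selection (select P uP central i (<⇒≤ i<s))
    step = good-translate Q i i<s (λ p p∈ → central p (Q⊆P p p∈))
    v : ℕ
    v = proj₁ step
    keep? : ∀ p → Dec (proj₁ p + i * proj₂ p ∈ map (v +_) S)
    keep? p = hit? v p i
    u′ : ℕ → ℕ
    u′ j with j ≟ i
    ... | yes _ = v
    ... | no _ = u j
    u′< : ∀ j → u′ j < w + w
    u′< j with j ≟ i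
    ... | yes _ = proj₁ (proj₂ step)
    ... | no _ = u< j
    hits′ : ∀ x d → (x , d) ∈ filter keep? Q → ∀ j → j < suc i → x + j * d ∈ map (u′ j +_) S
    hits′ x d p∈ j j<i with j ≟ i
    ... | yes refl = proj₂ (∈-filter⁻ keep? {xs = Q} p∈)
    ... | no j≢i = hits x d (proj₁ (∈-filter⁻ keep? {xs = Q} p∈)) j (≤∧≢⇒< (≤-pred j<i) j≢i)
    open ≤-Reasoning
    many′ : ρ * ρ ^ i * length P ≤ (w + w) * (w + w) ^ i * length (filter keep? Q)
    many′ = begin
      ρ * ρ ^ i * length P ≡⟨ *-assoc ρ (ρ ^ i) (length P) ⟩
      ρ * (ρ ^ i * length P) ≤⟨ *-monoʳ-≤ ρ many ⟩
      ρ * ((w + w) ^ i * length Q) ≡⟨ swap ρ ((w + w) ^ i) (length Q) ⟩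
      (w + w) ^ i * (ρ * length Q) ≤⟨ *-monoʳ-≤ ((w + w) ^ i) (proj₂ (proj₂ step)) ⟩
      (w + w) ^ i * ((w + w) * length (filter keep? Q)) ≡⟨ swap′ ((w + w) ^ i) (w + w) (length (filter keep? Q)) ⟩
      (w + w) * (w + w) ^ i * length (filter keep? Q) ∎
      where
      swap : ∀ a b c → a * (b * c) ≡ b * (a * c)
      swap = solve-∀
      swap′ : ∀ a b c → a * (b * c) ≡ b * a * c
      swap′ = solve-∀

  module Stack (u : ℕ → ℕ) (u< : ∀ j → u j < w + w) (W : ℕ) {{_ : NonZero W}} (W≡ : W ≡ w + w + w + (w + w + w)) where

    -- A translate has offsets below 3 w, half of the row spacing W = 6 w. So a step below 3 w
    -- cannot reach the next row from within a row, while a step of at least 3 w cannot remain in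
    -- its row.
    place : ℕ × ℕ → ℕ
    place (i , y) = u i + y + i * W

    stack : List ℕ
    stack = map place (cartesianProduct (upTo s) S)

    3w : ℕ
    3w = w + w + w

    offset< : ∀ i {y} → y ∈ S → u i + y < 3w
    offset< i y∈ = +-mono-<-≤ (u< i) (S≤w _ y∈)

    3w≤W : 3w ≤ W
    3w≤W = ≤-trans (m≤m+n 3w 3w) (≤-reflexive (sym W≡))

    row : ∀ {v} i → v < W → (v + i * W) / W ≡ i
    row {v} i v<W = trans (+-distrib-/-∣ʳ v (divides i refl)) (trans (cong₂ _+_ (m<n⇒m/n≡0 v<W) (m*n/n≡m i W)) refl)

    unplace : ∀ {z} → z ∈ stack → Σ ℕ λ i → Σ ℕ λ y → i < s × y ∈ S × z ≡ u i + y + i * W × z / W ≡ i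
    unplace z∈ with ∈-map⁻ place z∈
    ... | (i , y) , p∈ , refl = let i∈ , y∈ = ∈-cartesianProduct⁻ (upTo s) S p∈ in
      i , y , ∈-upTo⁻ i∈ , y∈ , refl , row i (<-≤-trans (offset< i y∈) 3w≤W)

    unique-stack : Unique stack
    unique-stack = unique-map (cartesianProduct (upTo s) S) place (UP.cartesianProduct⁺ (UP.upTo⁺ s) uS)
      λ { (i , y) (i′ , y′) p∈ p′∈ eq → injective i y i′ y′
            (proj₂ (∈-cartesianProduct⁻ (upTo s) S p∈)) (proj₂ (∈-cartesianProduct⁻ (upTo s) S p′∈)) eq }
      where
      injective : ∀ i y i′ y′ → y ∈ S → y′ ∈ S → place (i , y) ≡ place (i′ , y′) → (i , y) ≡ (i′ , y′)
      injective i y i′ y′ y∈ y′∈ eq with trans (sym (row i (<-≤-trans (offset< i y∈) 3w≤W))) (trans (cong (_/ W) eq) (row i′ (<-≤-trans (offset< i′ y′∈) 3w≤W)))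
      ... | refl = cong (i ,_) (+-cancelˡ-≡ (u i) y y′ (+-cancelʳ-≡ (i * W) (u i + y) (u i + y′) eq))

    length-stack : length stack ≡ s * ρ
    length-stack = trans (length-map place (cartesianProduct (upTo s) S)) (trans (length-× (upTo s) S) (cong (_* ρ) (length-upTo s)))

    -- A progression either climbs through too many rows or stays inside one of them.
    KAPFree-stack : KAPFree k stack
    KAPFree-stack x d 1≤d ap with d <? 3w
    ... | no d≥ = <⇒≱ (<-≤-trans row<s s≤row) ≤-refl
      where
      element : ∀ i → i < k → x + i * d ∈ stack
      element i i<k = APin-lookup ap i i<k
      -- The term of index `s` exists because `s < k`. After `s` strict climbs its row number would
      -- be at least `s`, whereas rows are numbered below `s`.
      row<s : (x + s * d) / W < s
      row<s = let i , _ , i<s , _ , _ , e = unplace (element s s<k) in ≤-trans (≤-reflexive (cong suc e)) i<s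
      climb : ∀ i → suc i < k → (x + i * d) / W < (x + suc i * d) / W
      climb i i<k with unplace (element i (<-trans (n<1+n i) i<k)) | unplace (element (suc i) i<k)
      ... | a , y , _ , y∈ , e , ea | b , y′ , _ , y′∈ , e′ , eb with a <? b
      ... | yes a<b = subst₂ _<_ (sym ea) (sym eb) a<b
      ... | no a≥b = contradiction too-far (<⇒≱ (offset< b y′∈))
        where
        too-far : 3w ≤ u b + y′
        too-far = +-cancelʳ-≤ (a * W) 3w (u b + y′) (begin
          3w + a * W ≤⟨ +-mono-≤ (≮⇒≥ d≥) (m≤n+m (a * W) (u a + y)) ⟩
          d + (u a + y + a * W) ≡⟨ cong (d +_) (sym e) ⟩
          d + (x + i * d) ≡⟨ shift d x (i * d) ⟩
          x + suc i * d ≡⟨ e′ ⟩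
          u b + y′ + b * W ≤⟨ +-monoʳ-≤ (u b + y′) (*-monoˡ-≤ W (≮⇒≥ a≥b)) ⟩
          u b + y′ + a * W ∎)
          where
          open ≤-Reasoning
          shift : ∀ d x m → d + (x + m) ≡ x + (d + m)
          shift = solve-∀
      at-least : ∀ i → i < k → i ≤ (x + i * d) / W
      at-least zero _ = z≤n
      at-least (suc i) i<k = ≤-trans (s≤s (at-least i (<-trans (n<1+n i) i<k))) (climb i i<k)
      s≤row : s ≤ (x + s * d) / W
      s≤row = at-least s s<k
    ... | yes d<3w with unplace (APin-lookup ap 0 (≤-trans (s≤s z≤n) s<k))
    ... | r , y , _ , y∈ , e , er = freeS y d 1≤d (APin-tabulate inside)
      where
      element : ∀ i → i < k → x + i * d ∈ stack
      element i i<k = APin-lookup ap i i<k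
      shift : ∀ d x m → x + (d + m) ≡ d + (x + m)
      shift = solve-∀
      -- The offset plus `d` stays below 3 w + 3 w = W, so adding `d` leaves the quotient by `W`
      -- unchanged.
      same-row : ∀ i → i < k → (x + i * d) / W ≡ r
      same-row zero _ = er
      same-row (suc i) i<k with unplace (element i (<-trans (n<1+n i) i<k)) | same-row i (<-trans (n<1+n i) i<k)
      ... | a , y′ , _ , y′∈ , e′ , ea | ih = trans (cong (_/ W) (trans (shift d x (i * d)) (trans (cong (d +_) e′) (sym (+-assoc d (u a + y′) (a * W))))))
        (trans (row a (<-≤-trans (+-mono-< d<3w (offset< a y′∈)) (≤-reflexive (sym W≡)))) (trans (sym ea) ih))
      inside : ∀ i → i < k → y + i * d ∈ S
      inside i i<k with unplace (element i i<k) | same-row i i<k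
      ... | a , y′ , _ , y′∈ , e′ , ea | ih with trans (sym ea) ih
      ... | refl = subst (_∈ S) (sym (+-cancelˡ-≡ (u a) _ _ (+-cancelʳ-≡ (a * W) _ _ (trans (regroup (u a) y (a * W) (i * d))
          (trans (cong (_+ i * d) (trans (sym e) (+-identityʳ x))) e′))))) y′∈
        where
        regroup : ∀ u y m q → u + (y + q) + m ≡ u + y + m + q
        regroup = solve-∀

    -- Adding `W` to the difference lifts the term of index `i` from the translate by `u i` into row
    -- `i`. It also makes the difference positive, so pairs with difference 0 may be used.
    fs-stack : ∀ (Q : List (ℕ × ℕ)) → Unique Q → (∀ x d → (x , d) ∈ Q → ∀ j → j < s → x + j * d ∈ map (u j +_) S) →
      length Q ≤ fs s stack
    fs-stack Q uQ hits = ≤-trans (≤-reflexive (sym (length-map tilt Q))) (fs-lower {s} {stack} (map tilt Q) 2≤s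
        (UP.map⁺ (λ { {x , d} {x′ , d′} eq → let p , q = ,-injective eq in cong₂ _,_ p (+-cancelʳ-≡ W d d′ q) }) uQ) progression)
      where
      tilt : ℕ × ℕ → ℕ × ℕ
      tilt (x , d) = x , d + W
      progression : ∀ x d → (x , d) ∈ map tilt Q → 1 ≤ d × APin s stack x d
      progression x d p∈ with ∈-map⁻ tilt p∈
      ... | (_ , e) , q∈ , refl = ≤-trans (>-nonZero⁻¹ W) (m≤n+m W e) , APin-tabulate λ i i<s →
        let y , y∈ , eq = ∈-map⁻ (u i +_) (hits x e q∈ i i<s) in
        subst (_∈ stack) (trans (cong (_+ i * W) (sym eq)) (regroup x i e W)) (∈-map⁺ place (∈-cartesianProduct⁺ (∈-upTo⁺ i<s) y∈))
        where
        regroup : ∀ x i e W → x + i * e + i * W ≡ x + i * (e + W)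
        regroup = solve-∀

  block : ∀ (P : List (ℕ × ℕ)) → Unique P → (∀ p → p ∈ P → Central p) →
    Σ ℕ λ c → Configuration s k (s * ρ) c × ρ ^ s * length P ≤ (w + w) ^ s * c
  block P uP central = length Q , (stack , unique-stack , length-stack , KAPFree-stack , fs-stack Q uQ hits) , many
    where
    open Selection (select P uP central s ≤-refl)
    instance
      W≢0 : NonZero (w + w + w + (w + w + w))
      W≢0 = >-nonZero (≤-trans 1≤w (≤-trans (m≤m+n w w) (≤-trans (m≤m+n (w + w) w) (m≤m+n (w + w + w) (w + w + w)))))
    open Stack u u< (w + w + w + (w + w + w)) refl

-- Within one window of length `w` the map `β` is a translation and keeps midpoint relations; the
-- fullest of the `q` windows holds at least a q-th of `A`.
window : ∀ k q w n (A : List ℕ) → 2 ≤ k → 1 ≤ q → 1 ≤ w → n ≤ q * w →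
  Unique A → All (λ a → 1 ≤ a × a ≤ n) A → KAPFree k A →
  Σ (List ℕ) λ B → Unique B × (∀ b → b ∈ B → 1 ≤ b × b ≤ w) × KAPFree k B × length A ≤ q * length B
window k q w n A 2≤k 1≤q 1≤w n≤qw uA bd free = map β A₀ ,
  unique-map A₀ β (UP.filter⁺ in-class? uA) (λ a b a∈ b∈ → preserves-≡ β id lift a b a∈ b∈) , range ,
  KAPFree-transfer {L = A₀} {β} {id} 2≤k lift (λ a b _ _ → cong β)
    (KAPFree-⊆ (λ x x∈ → proj₁ (∈A₀ (subst (x ∈_) (map-id A₀) x∈))) free) ,
  ≤-trans (proj₂ chosen) (≤-reflexive (cong₂ _*_ (length-upTo q) (sym (length-map β A₀))))
  where
  instance
    w≢0 : NonZero w
    w≢0 = >-nonZero 1≤w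
  class β : ℕ → ℕ
  class x = pred x / w
  β x = suc (pred x % w)
  pred< : ∀ {x} → 1 ≤ x × x ≤ n → pred x < q * w
  pred< {suc x} (_ , x≤n) = ≤-trans x≤n n≤qw
  chosen = pigeonhole-class A (upTo q) _≟_ class (≤-trans 1≤q (≤-reflexive (sym (length-upTo q))))
    (λ x x∈ → ∈-upTo⁺ (m<n*o⇒m/o<n (pred< (All.lookup bd x∈))))
  in-class? : ∀ x → Dec (class x ≡ proj₁ chosen)
  in-class? x = class x ≟ proj₁ chosen
  A₀ : List ℕ
  A₀ = filter in-class? A
  ∈A₀ : ∀ {x} → x ∈ A₀ → x ∈ A × class x ≡ proj₁ chosen
  ∈A₀ x∈ = ∈-filter⁻ in-class? {xs = A} x∈
  decompose : ∀ x → x ∈ A₀ → x ≡ β x + proj₁ chosen * w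
  decompose x x∈ = let x∈A , c = ∈A₀ x∈ in go x (proj₁ (All.lookup bd x∈A)) c
    where
    go : ∀ x → 1 ≤ x → class x ≡ proj₁ chosen → x ≡ β x + proj₁ chosen * w
    go (suc x) _ c = cong suc (trans (m≡m%n+[m/n]*n x w) (cong (λ z → x % w + z * w) c))
  lift : PreservesMidpoints A₀ β id
  lift a b c a∈ b∈ c∈ eq = trans (cong₂ _+_ (decompose a a∈) (decompose c c∈))
    (trans (collect (β a) (β c) (proj₁ chosen * w)) (trans (cong (_+ 2 * (proj₁ chosen * w)) eq)
    (trans (sym (*-distribˡ-+ 2 (β b) _)) (cong (2 *_) (sym (decompose b b∈))))))
    where
    collect : ∀ p q m → p + m + (q + m) ≡ p + q + 2 * m
    collect = solve-∀
  range : ∀ b → b ∈ map β A₀ → 1 ≤ b × b ≤ w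
  range b b∈ with ∈-map⁻ β b∈
  ... | x , _ , refl = s≤s z≤n , m%n<n (pred x) w

-- About n / (s ρ) blocks, each with at least (ρ / 2w)^s s h² progressions, give (r / n)^(s-1) n² up
-- to a constant. The exponent s - 1 is at most 2 (s - 2), and the surplus `t′` = s - 3 factors are
-- given up using `r ≤ n`.
lower-arithmetic : ∀ b t n r m s h w ρ J c → 1 ≤ t → s ≡ 2 + t → 1 ≤ n → 1 ≤ ρ →
  n ≤ 2 * (J * (s * ρ)) → ρ ^ s * (s * h * h) ≤ (w + w) ^ s * c → J * c ≤ m → r ≤ 2 * s * ρ →
  s * w ≤ n → n ≤ 4 * (s * (s * h)) → r ≤ n → s * (s * s) * 16 * 4 ^ s ≤ b ^ (2 * t) →
  r ^ (2 * t) * n ^ 2 ≤ m * b ^ (2 * t) * n ^ (2 * t)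
lower-arithmetic b t@(suc t′) n r m s h w ρ J c _ refl 1≤n 1≤ρ n≤J many Jc≤m r≤ρ sw≤n n≤h r≤n const≤ = begin
  r ^ (2 * t) * n ^ 2 ≡⟨ cong (_* n ^ 2) (trans (cong (r ^_) (exponent t′)) (^-distribˡ-+-* r (1 + t) t′)) ⟩
  r ^ (1 + t) * r ^ t′ * n ^ 2 ≤⟨ *-monoˡ-≤ (n ^ 2) (*-monoʳ-≤ (r ^ (1 + t)) (^-monoˡ-≤ t′ r≤n)) ⟩
  r ^ (1 + t) * n ^ t′ * n ^ 2 ≡⟨ swap (r ^ (1 + t)) (n ^ t′) (n ^ 2) ⟩
  n ^ t′ * (n ^ 2 * r ^ (1 + t)) ≤⟨ *-monoʳ-≤ (n ^ t′) step-C ⟩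
  n ^ t′ * (b ^ (2 * t) * n ^ (1 + t) * m) ≡⟨ regroup (n ^ t′) (b ^ (2 * t)) (n ^ (1 + t)) m ⟩
  m * b ^ (2 * t) * (n ^ (1 + t) * n ^ t′) ≡⟨ cong (m * b ^ (2 * t) *_) (trans (sym (^-distribˡ-+-* n (1 + t) t′)) (cong (n ^_) (sym (exponent t′)))) ⟩
  m * b ^ (2 * t) * n ^ (2 * t) ∎
  where
  open ≤-Reasoning
  exponent : ∀ t′ → 2 * suc t′ ≡ 1 + suc t′ + t′
  exponent = solve-∀
  swap : ∀ p q x → p * q * x ≡ q * (x * p)
  swap = solve-∀
  regroup : ∀ p q x m → p * (q * x * m) ≡ m * q * (x * p)
  regroup = solve-∀
  R D : ℕ
  R = ρ ^ (1 + t)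
  D = (w + w) ^ s
  step-A : n * R * (h * h) ≤ 2 * (D * m)
  step-A = *-cancelˡ-≤ (s * ρ) {{>-nonZero (*-mono-≤ {1} {s} (s≤s z≤n) 1≤ρ)}} (begin
    s * ρ * (n * R * (h * h)) ≡⟨ e₁ s ρ n R h ⟩
    n * (ρ * R * (s * h * h)) ≤⟨ *-monoʳ-≤ n many ⟩
    n * (D * c) ≤⟨ *-monoˡ-≤ (D * c) n≤J ⟩
    2 * (J * (s * ρ)) * (D * c) ≡⟨ e₂ J s ρ D c ⟩
    s * ρ * (2 * (D * (J * c))) ≤⟨ *-monoʳ-≤ (s * ρ) (*-monoʳ-≤ 2 (*-monoʳ-≤ D Jc≤m)) ⟩
    s * ρ * (2 * (D * m)) ∎)
    where
    e₁ : ∀ s ρ n R h → s * ρ * (n * R * (h * h)) ≡ n * (ρ * R * (s * h * h))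
    e₁ = solve-∀
    e₂ : ∀ J s ρ D c → 2 * (J * (s * ρ)) * (D * c) ≡ s * ρ * (2 * (D * (J * c)))
    e₂ = solve-∀
  step-B : s * h * h * r ^ (1 + t) ≤ 4 ^ s * n ^ (1 + t) * m
  step-B = *-cancelˡ-≤ (2 * n) {{>-nonZero (*-mono-≤ {1} {2} (s≤s z≤n) 1≤n)}} (begin
    2 * n * (s * h * h * r ^ (1 + t)) ≤⟨ *-monoʳ-≤ (2 * n) (*-monoʳ-≤ (s * h * h) (≤-trans (^-monoˡ-≤ (1 + t) r≤ρ) (≤-reflexive (^-distribʳ-* (1 + t) (2 * s) ρ)))) ⟩
    2 * n * (s * h * h * ((2 * s) ^ (1 + t) * R)) ≡⟨ e₁ n s h ((2 * s) ^ (1 + t)) R ⟩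
    2 * s * (2 * s) ^ (1 + t) * (n * R * (h * h)) ≤⟨ *-monoʳ-≤ ((2 * s) ^ s) step-A ⟩
    (2 * s) ^ s * (2 * (D * m)) ≡⟨ e₂ ((2 * s) ^ s) D m ⟩
    2 * ((2 * s) ^ s * D * m) ≡⟨ cong (λ z → 2 * (z * m)) (sym (^-distribʳ-* s (2 * s) (w + w))) ⟩
    2 * ((2 * s * (w + w)) ^ s * m) ≤⟨ *-monoʳ-≤ 2 (*-monoˡ-≤ m (^-monoˡ-≤ s (≤-trans (≤-reflexive (e₃ s w)) (*-monoʳ-≤ 4 sw≤n)))) ⟩
    2 * ((4 * n) ^ s * m) ≡⟨ cong (λ z → 2 * (z * m)) (^-distribʳ-* s 4 n) ⟩
    2 * (4 ^ s * (n * n ^ (1 + t)) * m) ≡⟨ e₄ (4 ^ s) n (n ^ (1 + t)) m ⟩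
    2 * n * (4 ^ s * n ^ (1 + t) * m) ∎)
    where
    e₁ : ∀ n s h p R → 2 * n * (s * h * h * (p * R)) ≡ 2 * s * p * (n * R * (h * h))
    e₁ = solve-∀
    e₂ : ∀ p D m → p * (2 * (D * m)) ≡ 2 * (p * D * m)
    e₂ = solve-∀
    e₃ : ∀ s w → 2 * s * (w + w) ≡ 4 * (s * w)
    e₃ = solve-∀
    e₄ : ∀ p n q m → 2 * (p * (n * q) * m) ≡ 2 * n * (p * q * m)
    e₄ = solve-∀
  step-C : n ^ 2 * r ^ (1 + t) ≤ b ^ (2 * t) * n ^ (1 + t) * m
  step-C = begin
    n ^ 2 * r ^ (1 + t) ≤⟨ *-monoˡ-≤ (r ^ (1 + t)) (^-monoˡ-≤ 2 n≤h) ⟩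
    (4 * (s * (s * h))) ^ 2 * r ^ (1 + t) ≡⟨ e₁ s h (r ^ (1 + t)) ⟩
    s * (s * s) * 16 * (s * h * h * r ^ (1 + t)) ≤⟨ *-monoʳ-≤ (s * (s * s) * 16) step-B ⟩
    s * (s * s) * 16 * (4 ^ s * n ^ (1 + t) * m) ≡⟨ e₂ (s * (s * s) * 16) (4 ^ s) (n ^ (1 + t)) m ⟩
    s * (s * s) * 16 * 4 ^ s * n ^ (1 + t) * m ≤⟨ *-monoˡ-≤ m (*-monoˡ-≤ (n ^ (1 + t)) const≤) ⟩
    b ^ (2 * t) * n ^ (1 + t) * m ∎
    where
    e₁ : ∀ s h p → (4 * (s * (s * h))) * ((4 * (s * (s * h))) * 1) * p ≡ s * (s * s) * 16 * (s * h * h * p)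
    e₁ = solve-∀
    e₂ : ∀ a p q m → a * (p * q * m) ≡ a * p * q * m
    e₂ = solve-∀

2+t≤3^t : ∀ t → 1 ≤ t → 2 + t ≤ 3 ^ t
2+t≤3^t (suc zero) _ = ≤-refl
2+t≤3^t (suc t@(suc t′)) _ = ≤-trans (+-mono-≤ {1} {3 ^ t} (>-nonZero⁻¹ (3 ^ t) {{m^n≢0 3 t}}) (2+t≤3^t t (s≤s z≤n)))
  (+-monoʳ-≤ (3 ^ t) (m≤m+n (3 ^ t) (3 ^ t + 0)))

-- Every factor is at most a t-th power: s ≤ 3^t, 16 ≤ 16^t and 4^s ≤ 16^t 4^t. The product of the
-- bases is 27 · 16 · 64 = 27648, below 256² = 65536.
constant-bound : ∀ t → 1 ≤ t → (2 + t) * ((2 + t) * (2 + t)) * 16 * 4 ^ (2 + t) ≤ 256 ^ (2 * t)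
constant-bound t@(suc t′) 1≤t = begin
  (2 + t) * ((2 + t) * (2 + t)) * 16 * 4 ^ (2 + t) ≤⟨ *-mono-≤ (*-mono-≤ (*-mono-≤ (2+t≤3^t t 1≤t) (*-mono-≤ (2+t≤3^t t 1≤t) (2+t≤3^t t 1≤t))) 16≤) (≤-reflexive (^-distribˡ-+-* 4 2 t)) ⟩
  3 ^ t * (3 ^ t * 3 ^ t) * 16 ^ t * (16 * 4 ^ t) ≤⟨ *-monoʳ-≤ (3 ^ t * (3 ^ t * 3 ^ t) * 16 ^ t) (*-monoˡ-≤ (4 ^ t) 16≤) ⟩
  3 ^ t * (3 ^ t * 3 ^ t) * 16 ^ t * (16 ^ t * 4 ^ t) ≡⟨ merge 3 16 4 ⟩
  (3 * (3 * 3) * 16 * (16 * 4)) ^ t ≤⟨ ^-monoˡ-≤ t (≤ᵇ⇒≤ (3 * (3 * 3) * 16 * (16 * 4)) (256 ^ 2) _) ⟩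
  (256 ^ 2) ^ t ≡⟨ ^-*-assoc 256 2 t ⟩
  256 ^ (2 * t) ∎
  where
  open ≤-Reasoning
  16≤ : 16 ≤ 16 ^ t
  16≤ = ≤-trans (≤-reflexive (sym (^-identityʳ 16))) (^-monoʳ-≤ 16 1≤t)
  merge : ∀ a b c → a ^ t * (a ^ t * a ^ t) * b ^ t * (b ^ t * c ^ t) ≡ (a * (a * a) * b * (b * c)) ^ t
  merge a b c = sym (trans (^-distribʳ-* t (a * (a * a) * b) (b * c)) (cong₂ _*_
    (trans (^-distribʳ-* t (a * (a * a)) b) (cong (_* b ^ t) (trans (^-distribʳ-* t a (a * a)) (cong (a ^ t *_) (^-distribʳ-* t a a)))))
    (^-distribʳ-* t b c)))

-- Starting points fill the first half of [w, 2w) and differences stay below `h`, so for w = 2 s h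
-- all `s` terms remain below 2 w.
central-pairs : ℕ → ℕ → ℕ → List (ℕ × ℕ)
central-pairs s w h = cartesianProduct (map (w +_) (upTo (s * h))) (upTo h)

central-pairs-central : ∀ s w h → w ≡ s * h + s * h → ∀ x d → (x , d) ∈ central-pairs s w h →
  ∀ i → i < s → w ≤ x + i * d × x + i * d < w + w
central-pairs-central s w h w≡ x d p∈ i i<s with ∈-cartesianProduct⁻ (map (w +_) (upTo (s * h))) (upTo h) p∈
... | x∈ , d∈ with ∈-map⁻ (w +_) x∈
... | a , a∈ , refl = ≤-trans (m≤m+n w a) (m≤m+n (w + a) (i * d)) ,
  (begin-strict
    w + a + i * d ≡⟨ +-assoc w a (i * d) ⟩
    w + (a + i * d) <⟨ +-monoʳ-< w (+-mono-<-≤ (∈-upTo⁻ a∈) (*-mono-≤ (<⇒≤ i<s) (<⇒≤ (∈-upTo⁻ d∈)))) ⟩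
    w + (s * h + s * h) ≡⟨ cong (w +_) (sym w≡) ⟩
    w + w ∎)
  where open ≤-Reasoning

central-pairs-unique : ∀ s w h → Unique (central-pairs s w h)
central-pairs-unique s w h = UP.cartesianProduct⁺ (UP.map⁺ (+-cancelˡ-≡ w _ _) (UP.upTo⁺ (s * h))) (UP.upTo⁺ h)

length-central-pairs : ∀ s w h → length (central-pairs s w h) ≡ s * h * h
length-central-pairs s w h = trans (length-× (map (w +_) (upTo (s * h))) (upTo h))
  (cong₂ _*_ (trans (length-map (w +_) (upTo (s * h))) (length-upTo (s * h))) (length-upTo h))

interval-bound : ∀ w (A : List ℕ) → Unique A → (∀ a → a ∈ A → 1 ≤ a × a ≤ w) → length A ≤ w
interval-bound w A uA bd = ≤-trans (injection-length A (interval w) id uA (λ a a∈ → let p , q = bd a a∈ in ∈-interval⁺ p q) (λ _ _ _ _ eq → eq))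
  (≤-reflexive (trans (length-map suc (upTo w)) (length-upTo w)))

floor-upper : ∀ n d .{{_ : NonZero d}} → d ≤ n → n ≤ 2 * (n / d * d)
floor-upper n d d≤n = begin
  n ≡⟨ m≡m%n+[m/n]*n n d ⟩
  n % d + n / d * d ≤⟨ +-monoˡ-≤ (n / d * d) (≤-trans (<⇒≤ (m%n<n n d)) (≤-trans (≤-reflexive (sym (*-identityˡ d))) (*-monoˡ-≤ d 1≤n/d))) ⟩
  n / d * d + n / d * d ≡⟨ cong (n / d * d +_) (sym (+-identityʳ (n / d * d))) ⟩
  2 * (n / d * d) ∎
  where
  open ≤-Reasoning
  1≤n/d : 1 ≤ n / d
  1≤n/d = ≤-trans (≤-reflexive (sym (n/n≡1 d))) (/-monoˡ-≤ d d≤n)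

lower-bound : ∀ t k n r m → 1 ≤ t → 2 + t < k → 2 * ((2 + t) * (2 + t)) ≤ n →
  (Σ (List ℕ) λ A → Unique A × All (λ a → 1 ≤ a × a ≤ n) A × KAPFree k A × length A ≡ r) →
  (∀ A → Unique A → length A ≡ n → KAPFree k A → fs (2 + t) A ≤ m) →
  r ^ (2 * t) * n ^ 2 ≤ m * 256 ^ (2 * t) * n ^ (2 * t)
lower-bound t k n r m 1≤t s<k N≤n (A , uA , bdA , fA , refl) maximal = cases (ρ ≟ 0)
  where
  s = 2 + t
  1≤ss : 1 ≤ 2 * (s * s)
  1≤ss = s≤s z≤n
  instance
    ss≢0 : NonZero (2 * (s * s))
    ss≢0 = >-nonZero 1≤ss
  h w : ℕ
  -- Then w = 2 s h satisfies s w ≤ n, so `s` rows of at most `w` elements fit, and n ≤ 2 s w, so 2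
  -- s windows cover the interval.
  h = n / (2 * (s * s))
  w = s * h + s * h
  1≤h : 1 ≤ h
  1≤h = ≤-trans (≤-reflexive (sym (n/n≡1 (2 * (s * s))))) (/-monoˡ-≤ (2 * (s * s)) N≤n)
  1≤w : 1 ≤ w
  1≤w = ≤-trans (*-mono-≤ {1} {s} (s≤s z≤n) 1≤h) (m≤m+n (s * h) (s * h))
  2≤k : 2 ≤ k
  2≤k = ≤-trans (m≤m+n 2 t) (<⇒≤ s<k)
  3≤k : 3 ≤ k
  3≤k = ≤-trans (s≤s (m≤m+n 2 t)) s<k
  sw≤n : s * w ≤ n
  sw≤n = ≤-trans (≤-reflexive (arith s h)) (m/n*n≤m n (2 * (s * s)))
    where
    arith : ∀ s h → s * (s * h + s * h) ≡ h * (2 * (s * s))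
    arith = solve-∀
  n≤ : n ≤ 2 * (h * (2 * (s * s)))
  n≤ = floor-upper n (2 * (s * s)) N≤n
  n≤2sw : n ≤ 2 * s * w
  n≤2sw = ≤-trans n≤ (≤-reflexive (arith s h))
    where
    arith : ∀ s h → 2 * (h * (2 * (s * s))) ≡ 2 * s * (s * h + s * h)
    arith = solve-∀
  n≤4ssh : n ≤ 4 * (s * (s * h))
  n≤4ssh = ≤-trans n≤ (≤-reflexive (arith s h))
    where
    arith : ∀ s h → 2 * (h * (2 * (s * s))) ≡ 4 * (s * (s * h))
    arith = solve-∀
  windowed = window k (2 * s) w n A 2≤k (s≤s z≤n) 1≤w n≤2sw uA bdA fA
  S : List ℕ
  S = proj₁ windowed
  uS : Unique S
  uS = proj₁ (proj₂ windowed)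
  bdS : ∀ b → b ∈ S → 1 ≤ b × b ≤ w
  bdS = proj₁ (proj₂ (proj₂ windowed))
  fS : KAPFree k S
  fS = proj₁ (proj₂ (proj₂ (proj₂ windowed)))
  ρ : ℕ
  ρ = length S
  r≤ : r ≤ 2 * s * ρ
  r≤ = proj₂ (proj₂ (proj₂ (proj₂ windowed)))
  r≤n : r ≤ n
  r≤n = interval-bound n A uA (λ a a∈ → All.lookup bdA a∈)
  1≤n : 1 ≤ n
  1≤n = ≤-trans 1≤ss N≤n
  open Rows k s s<k (m≤m+n 2 t) S uS fS w 1≤w (λ y y∈ → proj₂ (bdS y y∈))
  built = block (central-pairs s w h) (central-pairs-unique s w h)
    (λ { (x , d) p∈ → central-pairs-central s w h refl x d p∈ })
  cases : Dec (ρ ≡ 0) → r ^ (2 * t) * n ^ 2 ≤ m * 256 ^ (2 * t) * n ^ (2 * t)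
  -- The number `J` of blocks is a quotient by `s * ρ`, so an empty window is treated apart; it
  -- forces `r` to be 0.
  cases (yes ρ≡0) = ≤-trans (≤-reflexive (cong (_* n ^ 2) (trans (cong (_^ (2 * t)) r≡0) (zero-power t 1≤t)))) z≤n
    where
    r≡0 : r ≡ 0
    r≡0 = n≤0⇒n≡0 (≤-trans r≤ (≤-reflexive (trans (cong (2 * s *_) ρ≡0) (*-zeroʳ (2 * s)))))
    zero-power : ∀ t → 1 ≤ t → 0 ^ (2 * t) ≡ 0
    zero-power (suc t) _ = refl
  cases (no ρ≢0) = lower-arithmetic 256 t n r m s h w ρ J c 1≤t refl 1≤n 1≤ρ (floor-upper n (s * ρ) sρ≤n)
    (subst (λ l → ρ ^ s * l ≤ (w + w) ^ s * c) (length-central-pairs s w h) (proj₂ (proj₂ built)))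
    Jc≤m r≤ sw≤n n≤4ssh r≤n (constant-bound t 1≤t)
    where
    1≤ρ : 1 ≤ ρ
    1≤ρ = n≢0⇒n>0 ρ≢0
    sρ≤n : s * ρ ≤ n
    sρ≤n = ≤-trans (*-monoʳ-≤ s (interval-bound w S uS bdS)) sw≤n
    instance
      sρ≢0 : NonZero (s * ρ)
      sρ≢0 = >-nonZero (*-mono-≤ {1} {s} (s≤s z≤n) 1≤ρ)
    J c : ℕ
    J = n / (s * ρ)
    c = proj₁ built
    Jc≤m : J * c ≤ m
    Jc≤m = let B , uB , lB , fB , cB = padded (m≤m+n 2 t) 3≤k J n (proj₁ (proj₂ built)) (m/n*n≤m n (s * ρ))
           in ≤-trans cB (maximal B uB lB fB)

-- The constants are c = a / b and C = p / q, chosen before `k` and `s`. Clearing denominators, and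
-- taking the q-th power in the upper bound, avoids real numbers. The values are c = 1/256 from
-- `constant-bound` and C = 1/108 from `upper-arithmetic`.
theorem2 : Σ ℕ λ a → Σ ℕ λ b → Σ ℕ λ p → Σ ℕ λ q →
    1 ≤ a × 1 ≤ b × 1 ≤ p × 1 ≤ q ×
    (∀ k s → 3 ≤ s → s < k →
    Σ ℕ λ N → ∀ n → N ≤ n →
    Σ ℕ λ r → Σ ℕ λ m →
    IsRk k n r × IsFsk s k n m ×
    (a ^ (2 * (s ∸ 2)) * r ^ (2 * (s ∸ 2)) * n ^ 2 ≤ m * b ^ (2 * (s ∸ 2)) * n ^ (2 * (s ∸ 2))) ×
    (m ^ q * n ^ p ≤ r ^ p * n ^ (2 * q)))
theorem2 = 1 , 256 , 1 , 108 , s≤s z≤n , s≤s z≤n , s≤s z≤n , s≤s z≤n , bounds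
  where
  bounds : ∀ k s → 3 ≤ s → s < k → Σ ℕ λ N → ∀ n → N ≤ n → Σ ℕ λ r → Σ ℕ λ m →
    IsRk k n r × IsFsk s k n m ×
    (1 ^ (2 * (s ∸ 2)) * r ^ (2 * (s ∸ 2)) * n ^ 2 ≤ m * 256 ^ (2 * (s ∸ 2)) * n ^ (2 * (s ∸ 2))) ×
    (m ^ 108 * n ^ 1 ≤ r ^ 1 * n ^ 216)
  bounds k (suc zero) (s≤s ()) _
  bounds k s@(suc (suc t)) 3≤s s<k = 2 * (s * s) , λ n N≤n →
    let r , isR = IsRk-exists k n 2≤k
        m , isF = IsFsk-exists s k n 2≤s 2≤k (initial n)
    in r , m , isR , isF , lower n r m N≤n isR isF , upper n r m N≤n isR isF
    where
    2≤s : 2 ≤ s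
    2≤s = s≤s (s≤s z≤n)
    3≤k : 3 ≤ k
    3≤k = ≤-trans 3≤s (<⇒≤ s<k)
    2≤k : 2 ≤ k
    2≤k = ≤-trans (s≤s (s≤s z≤n)) 3≤k
    initial : ∀ n → Σ (List ℕ) λ A → Unique A × length A ≡ n × KAPFree k A
    initial n = let A , uA , lA , fA , _ = padded {s} 2≤s 3≤k 0 n (empty 2≤s 3≤k) z≤n in A , uA , lA , fA
    lower : ∀ n r m → 2 * (s * s) ≤ n → IsRk k n r → IsFsk s k n m →
      1 ^ (2 * t) * r ^ (2 * t) * n ^ 2 ≤ m * 256 ^ (2 * t) * n ^ (2 * t)
    lower n r m N≤n (witness , _) (_ , maximal) = ≤-trans
      (≤-reflexive (cong (_* n ^ 2) (trans (cong (_* r ^ (2 * t)) (^-zeroˡ (2 * t))) (*-identityˡ (r ^ (2 * t))))))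
      (lower-bound t k n r m (≤-pred (≤-pred 3≤s)) s<k N≤n witness maximal)
    upper : ∀ n r m → 2 * (s * s) ≤ n → IsRk k n r → IsFsk s k n m → m ^ 108 * n ^ 1 ≤ r ^ 1 * n ^ 216
    upper n r m N≤n (_ , maximal) ((A , uA , refl , fA , refl) , _) = subst₂ _≤_
      (cong (fs s A ^ 108 *_) (sym (*-identityʳ (length A)))) (cong (_* length A ^ 216) (sym (*-identityʳ r)))
      (upper-bound k s A r 2≤k 3≤s uA fA (≤-trans (s≤s z≤n) N≤n) maximal)
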